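{- Let $p\in(0,1)$ be a constant. There exist an existential monadic second order sentence $\varphi_1$ using only 3 first order variables and an existential monadic second order sentence $\varphi_2$ using only 1 monadic variable such that, for both $j=1,2$, the probability ${\sf P}(G(n,p)\models\varphi_j)$ does not converge as $n\to\infty$.
   Context: $G(n,p)$ is the random graph on vertex set $\{1,\ldots,n\}$ in which each pair of vertices is joined by an edge independently with probability $p$. Sentences are about undirected graphs with relations $\sim$ (adjacency) and $=$. An existential monadic second order (EMSO) sentence is one of the form $\exists X_1\ldots\exists X_m\,\phi(X_1,\ldots,X_m)$, where the $X_i$ are monadic variables ranging over subsets of the vertex set and $\phi$ is a (finite) first order sentence in $\sim,=$ and the unary predicates $X_1,\ldots,X_m$; first order variables range over vertices. -}

module Defs where

open import Data.Bool.Base using (Bool; true; false; if_then_else_)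
import Data.Bool.Properties as Bool
open import Data.Empty using (⊥)
open import Data.Fin.Base using (Fin; zero; suc)
import Data.Fin.Properties as Fin
open import Data.Fin.Subset using (Subset; _∈_; _∪_; ⁅_⁆) renaming (⊥ to ∅)
open import Data.Fin.Subset.Properties using (∉⊥; _∈?_; anySubset?; x∈p∪q⁻; x∈⁅y⁆⇒x≡y)
open import Data.List.Base using (List; []; _∷_; [_]; map; foldr; cartesianProductWith)
open import Data.Nat.Base as ℕ using (ℕ; zero; suc)
import Data.Nat.Properties as ℕ
open import Data.Product.Base using (∃; _×_; _,_)
open import Data.Rational.Base as ℚ using (ℚ; 0ℚ; 1ℚ; ½; Positive; NonZero)
import Data.Rational.Properties as ℚ
open import Data.Rational.Solver using (module +-*-Solver)
open import Data.Sum.Base using (_⊎_; inj₁; inj₂; [_,_]′)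
open import Data.Vec.Base using (Vec; []; _∷_; lookup)
open import Relation.Binary.PropositionalEquality using (_≡_; refl; sym; trans; cong; subst)
open import Relation.Nullary using (¬_; Dec; yes; no; does; contradiction)
open import Relation.Nullary.Decidable using (map′; ¬?; _×-dec_; _⊎-dec_; _→-dec_)

------------------------------------------------------------------------
-- Real numbers as Cauchy sequences of rationals.  Two sequences denote the
-- same real when their difference tends to 0; everything below respects
-- this identification.

Cauchy : (ℕ → ℚ) → Set
Cauchy x = ∀ ε → 0ℚ ℚ.< ε →
  ∃ λ N → ∀ m n → N ℕ.≤ m → N ℕ.≤ n → ℚ.∣ x m ℚ.- x n ∣ ℚ.< ε

record ℝ : Set where
  constructor mkℝ
  field
    seq    : ℕ → ℚ
    cauchy : Cauchy seq
open ℝ public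

private
  module Identities where
    open import Data.Rational.Base using (_+_; _-_; _*_; -_)
    open +-*-Solver

    p≡[p-q]+q : ∀ p q → p ≡ (p - q) + q
    p≡[p-q]+q = solve 2 (λ p q → p := (p :- q) :+ q) refl

    [p+q]-q≡p : ∀ p q → (p + q) - q ≡ p
    [p+q]-q≡p = solve 2 (λ p q → (p :+ q) :- q := p) refl

    -[p-q]≡q-p : ∀ p q → - (p - q) ≡ q - p
    -[p-q]≡q-p = solve 2 (λ p q → :- (p :- q) := q :- p) refl

    -p--q≡q-p : ∀ p q → (- p) - (- q) ≡ q - p
    -p--q≡q-p = solve 2 (λ p q → (:- p) :- (:- q) := q :- p) refl

    +-interchange : ∀ a b c d → (a + b) - (c + d) ≡ (a - c) + (b - d)
    +-interchange = solve 4 (λ a b c d → (a :+ b) :- (c :+ d) := (a :- c) :+ (b :- d)) refl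

    *-interchange : ∀ a b c d → a * b - c * d ≡ a * (b - d) + (a - c) * d
    *-interchange = solve 4 (λ a b c d → a :* b :- c :* d := a :* (b :- d) :+ (a :- c) :* d) refl

    factor : ∀ a b e i → a * (e * i) + b * (e * i) ≡ e * ((a + b) * i)
    factor = solve 4 (λ a b e i → a :* (e :* i) :+ b :* (e :* i) := e :* ((a :+ b) :* i)) refl

  open Identities

  abstract
    halve : ∀ ε → 0ℚ ℚ.< ε → ∃ λ δ → 0ℚ ℚ.< δ × δ ℚ.+ δ ≡ ε
    halve ε 0<ε = ε ℚ.* ½
      , ℚ.positive⁻¹ (ε ℚ.* ½) {{ℚ.pos*pos⇒pos ε {{ℚ.positive 0<ε}} ½}}
      , trans (sym (ℚ.*-distribˡ-+ ε ½ ½)) (ℚ.*-identityʳ ε)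

    ∣p∣-∣q∣≤∣p-q∣ : ∀ p q → ℚ.∣ p ∣ ℚ.- ℚ.∣ q ∣ ℚ.≤ ℚ.∣ p ℚ.- q ∣
    ∣p∣-∣q∣≤∣p-q∣ p q = begin
      ℚ.∣ p ∣ ℚ.- ℚ.∣ q ∣
        ≡⟨ cong (λ r → ℚ.∣ r ∣ ℚ.- ℚ.∣ q ∣) (p≡[p-q]+q p q) ⟩
      ℚ.∣ (p ℚ.- q) ℚ.+ q ∣ ℚ.- ℚ.∣ q ∣
        ≤⟨ ℚ.+-monoˡ-≤ (ℚ.- ℚ.∣ q ∣) (ℚ.∣p+q∣≤∣p∣+∣q∣ (p ℚ.- q) q) ⟩
      (ℚ.∣ p ℚ.- q ∣ ℚ.+ ℚ.∣ q ∣) ℚ.- ℚ.∣ q ∣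
        ≡⟨ [p+q]-q≡p ℚ.∣ p ℚ.- q ∣ ℚ.∣ q ∣ ⟩
      ℚ.∣ p ℚ.- q ∣ ∎
      where open ℚ.≤-Reasoning

    ∣p-q∣≡∣q-p∣ : ∀ p q → ℚ.∣ p ℚ.- q ∣ ≡ ℚ.∣ q ℚ.- p ∣
    ∣p-q∣≡∣q-p∣ p q =
      trans (cong ℚ.∣_∣ (sym (-[p-q]≡q-p q p))) (ℚ.∣-p∣≡∣p∣ (q ℚ.- p))

    ∣∣p∣-∣q∣∣≤∣p-q∣ : ∀ p q → ℚ.∣ ℚ.∣ p ∣ ℚ.- ℚ.∣ q ∣ ∣ ℚ.≤ ℚ.∣ p ℚ.- q ∣
    ∣∣p∣-∣q∣∣≤∣p-q∣ p q with ℚ.∣p∣≡p∨∣p∣≡-p (ℚ.∣ p ∣ ℚ.- ℚ.∣ q ∣)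
    ... | inj₁ eq = subst (ℚ._≤ ℚ.∣ p ℚ.- q ∣) (sym eq) (∣p∣-∣q∣≤∣p-q∣ p q)
    ... | inj₂ eq = begin
      ℚ.∣ ℚ.∣ p ∣ ℚ.- ℚ.∣ q ∣ ∣  ≡⟨ eq ⟩
      ℚ.- (ℚ.∣ p ∣ ℚ.- ℚ.∣ q ∣)
        ≡⟨ -[p-q]≡q-p ℚ.∣ p ∣ ℚ.∣ q ∣ ⟩
      ℚ.∣ q ∣ ℚ.- ℚ.∣ p ∣        ≤⟨ ∣p∣-∣q∣≤∣p-q∣ q p ⟩
      ℚ.∣ q ℚ.- p ∣              ≡⟨ ∣p-q∣≡∣q-p∣ q p ⟩
      ℚ.∣ p ℚ.- q ∣              ∎
      where open ℚ.≤-Reasoning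

    eventually-bounded : ∀ {x} → Cauchy x →
      ∃ λ B → 0ℚ ℚ.< B × ∃ λ N → ∀ n → N ℕ.≤ n → ℚ.∣ x n ∣ ℚ.≤ B
    eventually-bounded {x} cx with cx 1ℚ (ℚ.positive⁻¹ 1ℚ)
    ... | N , close = 1ℚ ℚ.+ ℚ.∣ x N ∣
                    , ℚ.+-mono-<-≤ (ℚ.positive⁻¹ 1ℚ) (ℚ.0≤∣p∣ (x N))
                    , N , bound
      where
      open ℚ.≤-Reasoning
      bound : ∀ n → N ℕ.≤ n → ℚ.∣ x n ∣ ℚ.≤ 1ℚ ℚ.+ ℚ.∣ x N ∣
      bound n N≤n = begin
        ℚ.∣ x n ∣
          ≡⟨ cong ℚ.∣_∣ (p≡[p-q]+q (x n) (x N)) ⟩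
        ℚ.∣ (x n ℚ.- x N) ℚ.+ x N ∣       ≤⟨ ℚ.∣p+q∣≤∣p∣+∣q∣ (x n ℚ.- x N) (x N) ⟩
        ℚ.∣ x n ℚ.- x N ∣ ℚ.+ ℚ.∣ x N ∣
          ≤⟨ ℚ.+-monoˡ-≤ ℚ.∣ x N ∣ (ℚ.<⇒≤ (close n N N≤n ℕ.≤-refl)) ⟩
        1ℚ ℚ.+ ℚ.∣ x N ∣                  ∎

    const-cauchy : ∀ q → Cauchy (λ _ → q)
    const-cauchy q ε 0<ε = 0 , λ _ _ _ _ →
      subst (λ r → ℚ.∣ r ∣ ℚ.< ε) (sym (ℚ.+-inverseʳ q)) 0<ε

    +-close : ∀ {δ} a b c d → ℚ.∣ a ℚ.- c ∣ ℚ.< δ → ℚ.∣ b ℚ.- d ∣ ℚ.< δ →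
              ℚ.∣ (a ℚ.+ b) ℚ.- (c ℚ.+ d) ∣ ℚ.< δ ℚ.+ δ
    +-close {δ} a b c d a≈c b≈d = begin-strict
      ℚ.∣ (a ℚ.+ b) ℚ.- (c ℚ.+ d) ∣        ≡⟨ cong ℚ.∣_∣ (+-interchange a b c d) ⟩
      ℚ.∣ (a ℚ.- c) ℚ.+ (b ℚ.- d) ∣        ≤⟨ ℚ.∣p+q∣≤∣p∣+∣q∣ (a ℚ.- c) (b ℚ.- d) ⟩
      ℚ.∣ a ℚ.- c ∣ ℚ.+ ℚ.∣ b ℚ.- d ∣
        <⟨ ℚ.+-mono-< {ℚ.∣ a ℚ.- c ∣} {δ} {ℚ.∣ b ℚ.- d ∣} {δ} a≈c b≈d ⟩
      δ ℚ.+ δ                              ∎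
      where open ℚ.≤-Reasoning

    +-cauchy : ∀ {x y} → Cauchy x → Cauchy y → Cauchy (λ n → x n ℚ.+ y n)
    +-cauchy {x} {y} cx cy ε 0<ε =
      let δ , 0<δ , δ+δ≡ε = halve ε 0<ε
          M , closeˣ = cx δ 0<δ
          N , closeʸ = cy δ 0<δ
      in M ℕ.⊔ N , λ m n p q →
        subst (ℚ.∣ (x m ℚ.+ y m) ℚ.- (x n ℚ.+ y n) ∣ ℚ.<_) δ+δ≡ε
          (+-close {δ} (x m) (y m) (x n) (y n)
            (closeˣ m n (ℕ.m⊔n≤o⇒m≤o M N p) (ℕ.m⊔n≤o⇒m≤o M N q))
            (closeʸ m n (ℕ.m⊔n≤o⇒n≤o M N p) (ℕ.m⊔n≤o⇒n≤o M N q)))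

    neg-cauchy : ∀ {x} → Cauchy x → Cauchy (λ n → ℚ.- x n)
    neg-cauchy {x} cx ε 0<ε with cx ε 0<ε
    ... | N , close = N , λ m n p q → subst (ℚ._< ε) (sym (flip (x m) (x n))) (close m n p q)
      where
      flip : ∀ a b → ℚ.∣ (ℚ.- a) ℚ.- (ℚ.- b) ∣ ≡ ℚ.∣ a ℚ.- b ∣
      flip a b = trans (cong ℚ.∣_∣ (-p--q≡q-p a b))
                       (∣p-q∣≡∣q-p∣ b a)

    abs-cauchy : ∀ {x} → Cauchy x → Cauchy (λ n → ℚ.∣ x n ∣)
    abs-cauchy {x} cx ε 0<ε with cx ε 0<ε
    ... | N , close = N , λ m n p q →
      ℚ.≤-<-trans (∣∣p∣-∣q∣∣≤∣p-q∣ (x m) (x n)) (close m n p q)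

    ∣a*b∣<C*δ : ∀ {δ} a b C → 0ℚ ℚ.< C → ℚ.∣ a ∣ ℚ.≤ C → ℚ.∣ b ∣ ℚ.< δ →
                ℚ.∣ a ℚ.* b ∣ ℚ.< C ℚ.* δ
    ∣a*b∣<C*δ {δ} a b C 0<C a≤C b<δ = begin-strict
      ℚ.∣ a ℚ.* b ∣          ≡⟨ ℚ.∣p*q∣≡∣p∣*∣q∣ a b ⟩
      ℚ.∣ a ∣ ℚ.* ℚ.∣ b ∣
        ≤⟨ ℚ.*-monoʳ-≤-nonNeg ℚ.∣ b ∣ {{ℚ.nonNegative (ℚ.0≤∣p∣ b)}} a≤C ⟩
      C ℚ.* ℚ.∣ b ∣          <⟨ ℚ.*-monoʳ-<-pos C {{ℚ.positive 0<C}} b<δ ⟩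
      C ℚ.* δ                ∎
      where open ℚ.≤-Reasoning

    split : ∀ A B → 0ℚ ℚ.< A → 0ℚ ℚ.< B → ∀ ε → 0ℚ ℚ.< ε →
            ∃ λ δ → 0ℚ ℚ.< δ × A ℚ.* δ ℚ.+ B ℚ.* δ ≡ ε
    split A B 0<A 0<B ε 0<ε = ε ℚ.* inv
      , ℚ.positive⁻¹ (ε ℚ.* inv)
          {{ℚ.pos*pos⇒pos ε {{ℚ.positive 0<ε}} inv {{ℚ.1/pos⇒pos (A ℚ.+ B) {{pos}}}}}}
      , trans (factor A B ε inv)
          (trans (cong (ε ℚ.*_) (ℚ.*-inverseʳ (A ℚ.+ B) {{nz}})) (ℚ.*-identityʳ ε))
      where
      pos : Positive (A ℚ.+ B)
      pos = ℚ.positive (ℚ.+-mono-< 0<A 0<B)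
      nz : NonZero (A ℚ.+ B)
      nz = ℚ.pos⇒nonZero (A ℚ.+ B) {{pos}}
      inv : ℚ
      inv = ℚ.1/_ (A ℚ.+ B) {{nz}}

    *-close : ∀ {A B δ} a b c d → 0ℚ ℚ.< A → 0ℚ ℚ.< B →
              ℚ.∣ a ∣ ℚ.≤ A → ℚ.∣ d ∣ ℚ.≤ B → ℚ.∣ a ℚ.- c ∣ ℚ.< δ → ℚ.∣ b ℚ.- d ∣ ℚ.< δ →
              ℚ.∣ a ℚ.* b ℚ.- c ℚ.* d ∣ ℚ.< A ℚ.* δ ℚ.+ B ℚ.* δ
    *-close {A} {B} {δ} a b c d 0<A 0<B a≤A d≤B a≈c b≈d = begin-strict
      ℚ.∣ a ℚ.* b ℚ.- c ℚ.* d ∣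
        ≡⟨ cong ℚ.∣_∣ (*-interchange a b c d) ⟩
      ℚ.∣ a ℚ.* (b ℚ.- d) ℚ.+ (a ℚ.- c) ℚ.* d ∣
        ≤⟨ ℚ.∣p+q∣≤∣p∣+∣q∣ (a ℚ.* (b ℚ.- d)) ((a ℚ.- c) ℚ.* d) ⟩
      ℚ.∣ a ℚ.* (b ℚ.- d) ∣ ℚ.+ ℚ.∣ (a ℚ.- c) ℚ.* d ∣
        <⟨ ℚ.+-mono-< {ℚ.∣ a ℚ.* (b ℚ.- d) ∣} {A ℚ.* δ} {ℚ.∣ (a ℚ.- c) ℚ.* d ∣} {B ℚ.* δ}
             (∣a*b∣<C*δ a (b ℚ.- d) A 0<A a≤A b≈d)
             (subst (λ r → ℚ.∣ r ∣ ℚ.< B ℚ.* δ) (ℚ.*-comm d (a ℚ.- c))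
               (∣a*b∣<C*δ d (a ℚ.- c) B 0<B d≤B a≈c)) ⟩
      A ℚ.* δ ℚ.+ B ℚ.* δ ∎
      where open ℚ.≤-Reasoning

    *-cauchy : ∀ {x y} → Cauchy x → Cauchy y → Cauchy (λ n → x n ℚ.* y n)
    *-cauchy {x} {y} cx cy ε 0<ε =
      let A , 0<A , K , boundˣ = eventually-bounded {x} cx
          B , 0<B , L , boundʸ = eventually-bounded {y} cy
          δ , 0<δ , Aδ+Bδ≡ε = split A B 0<A 0<B ε 0<ε
          M , closeˣ = cx δ 0<δ
          N , closeʸ = cy δ 0<δ
      in (K ℕ.⊔ L) ℕ.⊔ (M ℕ.⊔ N) , λ m n p q →
        let KL≤m = ℕ.m⊔n≤o⇒m≤o (K ℕ.⊔ L) (M ℕ.⊔ N) p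
            KL≤n = ℕ.m⊔n≤o⇒m≤o (K ℕ.⊔ L) (M ℕ.⊔ N) q
            MN≤m = ℕ.m⊔n≤o⇒n≤o (K ℕ.⊔ L) (M ℕ.⊔ N) p
            MN≤n = ℕ.m⊔n≤o⇒n≤o (K ℕ.⊔ L) (M ℕ.⊔ N) q
        in subst (ℚ.∣ x m ℚ.* y m ℚ.- x n ℚ.* y n ∣ ℚ.<_) Aδ+Bδ≡ε
          (*-close {A} {B} {δ} (x m) (y m) (x n) (y n) 0<A 0<B
            (boundˣ m (ℕ.m⊔n≤o⇒m≤o K L KL≤m)) (boundʸ n (ℕ.m⊔n≤o⇒n≤o K L KL≤n))
            (closeˣ m n (ℕ.m⊔n≤o⇒m≤o M N MN≤m) (ℕ.m⊔n≤o⇒m≤o M N MN≤n))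
            (closeʸ m n (ℕ.m⊔n≤o⇒n≤o M N MN≤m) (ℕ.m⊔n≤o⇒n≤o M N MN≤n)))

fromℚ : ℚ → ℝ
fromℚ q = mkℝ (λ _ → q) (const-cauchy q)

0ℝ 1ℝ : ℝ
0ℝ = fromℚ 0ℚ
1ℝ = fromℚ 1ℚ

infix  8 -_
infixl 7 _*_
infixl 6 _+_ _-_
infix  4 _<_

_+_ : ℝ → ℝ → ℝ
x + y = mkℝ (λ n → seq x n ℚ.+ seq y n) (+-cauchy {seq x} {seq y} (cauchy x) (cauchy y))

-_ : ℝ → ℝ
- x = mkℝ (λ n → ℚ.- seq x n) (neg-cauchy {seq x} (cauchy x))

_-_ : ℝ → ℝ → ℝ
x - y = x + - y

_*_ : ℝ → ℝ → ℝ
x * y = mkℝ (λ n → seq x n ℚ.* seq y n) (*-cauchy {seq x} {seq y} (cauchy x) (cauchy y))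

∣_∣ : ℝ → ℝ
∣ x ∣ = mkℝ (λ n → ℚ.∣ seq x n ∣) (abs-cauchy {seq x} (cauchy x))

-- A fixed rational gap is needed: pointwise strict inequality of the
-- approximations would allow equal limits.
_<_ : ℝ → ℝ → Set
x < y = ∃ λ δ → 0ℚ ℚ.< δ × ∃ λ N → ∀ n → N ℕ.≤ n → seq x n ℚ.+ δ ℚ.≤ seq y n

sum : List ℝ → ℝ
sum = foldr _+_ 0ℝ

_⟶_ : (ℕ → ℝ) → ℝ → Set
a ⟶ L = ∀ ε → 0ℝ < ε → ∃ λ N → ∀ n → N ℕ.≤ n → ∣ a n - L ∣ < ε

Converges : (ℕ → ℝ) → Set
Converges a = ∃ λ L → a ⟶ L

------------------------------------------------------------------------
-- A simple graph on Fin n is given by its strict upper triangle, one bit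
-- per unordered pair: the row r of `r ∷ G` says which of the vertices
-- suc i are adjacent to vertex zero.

data Graph : ℕ → Set where
  []  : Graph zero
  _∷_ : ∀ {n} → Vec Bool n → Graph n → Graph (suc n)

adjacent : ∀ {n} → Graph n → Fin n → Fin n → Bool
adjacent (r ∷ G) zero    zero    = false
adjacent (r ∷ G) zero    (suc j) = lookup r j
adjacent (r ∷ G) (suc i) zero    = lookup r i
adjacent (r ∷ G) (suc i) (suc j) = adjacent G i j

allBits : ∀ n → List (Vec Bool n)
allBits zero    = [ [] ]
allBits (suc n) = cartesianProductWith _∷_ (true ∷ false ∷ []) (allBits n)

allGraphs : ∀ n → List (Graph n)
allGraphs zero    = [ [] ]
allGraphs (suc n) = cartesianProductWith _∷_ (allBits n) (allGraphs n)

bitProb : ℝ → Bool → ℝ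
bitProb p b = if b then p else 1ℝ - p

rowProb : ℝ → ∀ {n} → Vec Bool n → ℝ
rowProb p []      = 1ℝ
rowProb p (b ∷ r) = bitProb p b * rowProb p r

-- The probability that G(n,p) equals the given graph.
graphProb : ℝ → ∀ {n} → Graph n → ℝ
graphProb p []      = 1ℝ
graphProb p (r ∷ G) = rowProb p r * graphProb p G

ℙ[G⟨_,_⟩∈_] : (n : ℕ) (p : ℝ) {A : Graph n → Set} → (∀ G → Dec (A G)) → ℝ
ℙ[G⟨ n , p ⟩∈ A? ] =
  sum (map (λ G → if does (A? G) then graphProb p G else 0ℝ) (allGraphs n))

------------------------------------------------------------------------
-- First-order formulas over ∼, = and m unary predicates, written with k
-- named variables and with free variables in S.  Variables may be
-- requantified, as is usual when the number of variables is restricted; an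
-- inner quantifier shadows an outer one over the same variable.

Var : ∀ {k} → Subset k → Set
Var S = ∃ λ x → x ∈ S

infix  9 _∼′_ _≐′_
infix  8 ¬′_
infixr 7 _∧′_
infixr 6 _∨′_
infixr 5 _⇒′_

data Formula (m k : ℕ) : Subset k → Set where
  _∼′_ : ∀ {S} → Var S → Var S → Formula m k S
  _≐′_ : ∀ {S} → Var S → Var S → Formula m k S
  X′   : ∀ {S} → Fin m → Var S → Formula m k S
  ⊥′   : ∀ {S} → Formula m k S
  ¬′_  : ∀ {S} → Formula m k S → Formula m k S
  _∧′_ : ∀ {S} → Formula m k S → Formula m k S → Formula m k S
  _∨′_ : ∀ {S} → Formula m k S → Formula m k S → Formula m k S
  _⇒′_ : ∀ {S} → Formula m k S → Formula m k S → Formula m k S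
  ∀′   : ∀ {S} (x : Fin k) → Formula m k (S ∪ ⁅ x ⁆) → Formula m k S
  ∃′   : ∀ {S} (x : Fin k) → Formula m k (S ∪ ⁅ x ⁆) → Formula m k S

Assignment : ∀ {k} → Subset k → ℕ → Set
Assignment S n = Var S → Fin n

_[_↦_] : ∀ {k n} {S : Subset k} →
         Assignment S n → (x : Fin k) → Fin n → Assignment (S ∪ ⁅ x ⁆) n
_[_↦_] {S = S} σ x v (y , y∈) with y Fin.≟ x
... | yes _   = v
... | no  y≢x = [ (λ y∈S → σ (y , y∈S))
                , (λ y∈⁅x⁆ → contradiction (x∈⁅y⁆⇒x≡y x y∈⁅x⁆) y≢x)
                ]′ (x∈p∪q⁻ S ⁅ x ⁆ y∈)

noVars : ∀ {k n} → Assignment {k} ∅ n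
noVars (_ , x∈∅) = contradiction x∈∅ ∉⊥

module _ {n m k : ℕ} (G : Graph n) (Xs : Vec (Subset n) m) where

  Sat : ∀ {S : Subset k} → Formula m k S → Assignment S n → Set
  Sat (x ∼′ y)  σ = adjacent G (σ x) (σ y) ≡ true
  Sat (x ≐′ y)  σ = σ x ≡ σ y
  Sat (X′ i x)  σ = σ x ∈ lookup Xs i
  Sat ⊥′        σ = ⊥
  Sat (¬′ φ)    σ = ¬ Sat φ σ
  Sat (φ ∧′ ψ)  σ = Sat φ σ × Sat ψ σ
  Sat (φ ∨′ ψ)  σ = Sat φ σ ⊎ Sat ψ σ
  Sat (φ ⇒′ ψ)  σ = Sat φ σ → Sat ψ σ
  Sat (∀′ x φ)  σ = ∀ v → Sat φ (σ [ x ↦ v ])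
  Sat (∃′ x φ)  σ = ∃ λ v → Sat φ (σ [ x ↦ v ])

  sat? : ∀ {S : Subset k} (φ : Formula m k S) (σ : Assignment S n) → Dec (Sat φ σ)
  sat? (x ∼′ y)  σ = adjacent G (σ x) (σ y) Bool.≟ true
  sat? (x ≐′ y)  σ = σ x Fin.≟ σ y
  sat? (X′ i x)  σ = σ x ∈? lookup Xs i
  sat? ⊥′        σ = no λ ()
  sat? (¬′ φ)    σ = ¬? (sat? φ σ)
  sat? (φ ∧′ ψ)  σ = sat? φ σ ×-dec sat? ψ σ
  sat? (φ ∨′ ψ)  σ = sat? φ σ ⊎-dec sat? ψ σ
  sat? (φ ⇒′ ψ)  σ = sat? φ σ →-dec sat? ψ σ
  sat? (∀′ x φ)  σ = Fin.all? λ v → sat? φ (σ [ x ↦ v ])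
  sat? (∃′ x φ)  σ = Fin.any? λ v → sat? φ (σ [ x ↦ v ])

-- ∃X₁…∃Xₘ φ with φ a first-order sentence in k first-order variables.
record EMSO (m k : ℕ) : Set where
  constructor ∃X
  field
    matrix : Formula m k ∅
open EMSO public

infix 4 _⊨_ _⊨?_

_⊨_ : ∀ {n m k} → Graph n → EMSO m k → Set
_⊨_ {n} {m} G φ = ∃ λ (Xs : Vec (Subset n) m) → Sat G Xs (matrix φ) noVars

anySubsets? : ∀ {n} m {P : Vec (Subset n) m → Set} → (∀ Xs → Dec (P Xs)) → Dec (∃ P)
anySubsets? zero    P? = map′ (λ p → [] , p) (λ where ([] , p) → p) (P? [])
anySubsets? (suc m) P? =
  map′ (λ where (X , Xs , p) → X ∷ Xs , p) (λ where (X ∷ Xs , p) → X , Xs , p)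
       (anySubset? λ X → anySubsets? m λ Xs → P? (X ∷ Xs))

_⊨?_ : ∀ {n m k} (G : Graph n) (φ : EMSO m k) → Dec (G ⊨ φ)
_⊨?_ {m = m} G φ = anySubsets? m λ Xs → sat? G Xs (matrix φ) noVars

-- The probability that G(n,p) ⊨ φ.
ℙ[G⟨_,_⟩⊨_] : ∀ {m k} → ℕ → ℝ → EMSO m k → ℝ
ℙ[G⟨ n , p ⟩⊨ φ ] = ℙ[G⟨ n , p ⟩∈ _⊨? φ ]

{-# OPTIONS --safe #-}
module Submission where

-- Call a graph s-extensible if every prescription of adjacencies to at most s
-- vertices is met by some further vertex.  If 2^-d ≤ p ≤ 1 - 2^-d, then G(n,p)
-- with n = 2^(2ds) is s-extensible with probability at least 3/4, by a union
-- bound, as soon as ds ≥ 8.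
--
-- The sentence asserts a tower Q₀, Q₁, Q₂ in which Q₁ realises every subset of
-- Q₀ as a neighbourhood exactly once, Q₂ likewise every subset of Q₁, and the
-- whole vertex set realises every subset of Q₂.  So |Q₂| = K for some K of the
-- form 2^2^i, and 2^K ≤ n.  That all subsets are realised is said with three
-- variables: reading neighbourhoods as binary numbers along an order given by a
-- half graph, they are closed under adding 1.  Moreover B sets, each injected
-- into Q₂, together leave no vertex adjacent to all of their elements; in an
-- s-extensible graph this forces B K > s.  Hence K lies within a constant factor
-- of log n, and as the numbers 2^2^i are sparse this is impossible for suitable
-- arbitrarily large n.
--
-- Conversely, for n = 2^(16dK), extensibility embeds the tower vertex by vertex
-- and also yields the B sets: if no candidate vertex missed a fixed fraction of
-- the vertices still adjacent to everything chosen so far, one could greedily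
-- pick few of the latter to which no candidate is simultaneously nonadjacent.
--
-- The monadic variables of the first sentence become X ∩ N(c) in the second, for
-- one set X and first order variables c.

-- The inequality `2 ^ K ≤ n` alone would let a fixed small tower serve every large n. The B sets
-- supply the opposite inequality K > s / B, where s is log n divided by 2d. The two bounds on K
-- differ by a factor depending on p, and the double exponential is there to beat it: consecutive
-- candidates for K are a number and its square, so any constant factor is eventually smaller than
-- the gap between them. The sentences depend on p through d only, by way of the number B of sets.
--
-- Reals are sequences of rationals on which the operations act index by index, so the probability
-- at index i is exactly the expectation for the rational approximation of p at i. Every estimate
-- uses only 2^-d ≤ p ≤ 1 - 2^-d, which holds from some index on, with constants independent of the
-- index; the probabilistic part thus stays within rational arithmetic. Nor is independence ever
-- formulated: a graph is a sequence of rows, and expectations are computed by reading the rows in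
-- turn.

-- Powers and multiples of rationals; Bernoulli's inequality

module Rationals where

  open import Data.Bool.Base using (Bool; true; false; _∧_; if_then_else_)
  open import Data.Nat.Base as ℕ using (ℕ; zero; suc)
  import Data.Nat.Properties as ℕ
  open import Data.Rational.Base using (ℚ; 0ℚ; 1ℚ; ½; _+_; _*_; _-_; -_; _≤_; nonNegative)
  open import Data.Rational.Properties
  open import Data.Rational.Solver using (module +-*-Solver)
  open import Relation.Binary.PropositionalEquality hiding ([_])

  infixr 8 _^_
  _^_ : ℚ → ℕ → ℚ
  x ^ zero  = 1ℚ
  x ^ suc n = x * x ^ n

  [_]ᵇ : Bool → ℚ
  [ b ]ᵇ = if b then 1ℚ else 0ℚ

  0≤[]ᵇ : ∀ b → 0ℚ ≤ [ b ]ᵇ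
  0≤[]ᵇ true  = nonNegative⁻¹ 1ℚ
  0≤[]ᵇ false = ≤-refl

  []ᵇ-∧ : ∀ b c → [ b ∧ c ]ᵇ ≡ [ b ]ᵇ * [ c ]ᵇ
  []ᵇ-∧ true  c = sym (*-identityˡ [ c ]ᵇ)
  []ᵇ-∧ false c = sym (*-zeroˡ [ c ]ᵇ)

  *-monoˡ : ∀ {x y} z → 0ℚ ≤ z → x ≤ y → z * x ≤ z * y
  *-monoˡ z 0≤z = *-monoˡ-≤-nonNeg z {{nonNegative 0≤z}}

  *-mono : ∀ {w x y z} → 0ℚ ≤ w → 0ℚ ≤ z → w ≤ x → y ≤ z → w * y ≤ x * z
  *-mono {w} {x} {y} {z} 0≤w 0≤z w≤x y≤z =
    ≤-trans (*-monoˡ w 0≤w y≤z) (*-monoʳ-≤-nonNeg z {{nonNegative 0≤z}} w≤x)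

  0≤* : ∀ {x y} → 0ℚ ≤ x → 0ℚ ≤ y → 0ℚ ≤ x * y
  0≤* {x} {y} 0≤x 0≤y = subst (_≤ x * y) (*-zeroʳ x) (*-monoˡ x 0≤x 0≤y)

  0≤^ : ∀ {x} n → 0ℚ ≤ x → 0ℚ ≤ x ^ n
  0≤^ zero    _   = nonNegative⁻¹ 1ℚ
  0≤^ (suc n) 0≤x = 0≤* 0≤x (0≤^ n 0≤x)

  ^≤1 : ∀ {x} n → 0ℚ ≤ x → x ≤ 1ℚ → x ^ n ≤ 1ℚ
  ^≤1 zero    _   _   = ≤-refl
  ^≤1 (suc n) 0≤x x≤1 = *-mono 0≤x (nonNegative⁻¹ 1ℚ) x≤1 (^≤1 n 0≤x x≤1)

  ^-mono : ∀ {x y} n → 0ℚ ≤ x → x ≤ y → x ^ n ≤ y ^ n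
  ^-mono zero    _   _   = ≤-refl
  ^-mono (suc n) 0≤x x≤y = *-mono 0≤x (0≤^ n (≤-trans 0≤x x≤y)) x≤y (^-mono n 0≤x x≤y)

  ^-anti : ∀ {x} {m n} → 0ℚ ≤ x → x ≤ 1ℚ → m ℕ.≤ n → x ^ n ≤ x ^ m
  ^-anti {n = n} 0≤x x≤1 ℕ.z≤n       = ^≤1 n 0≤x x≤1
  ^-anti {x}     0≤x x≤1 (ℕ.s≤s m≤n) = *-monoˡ x 0≤x (^-anti 0≤x x≤1 m≤n)

  ^-distribˡ-+ : ∀ x m n → x ^ (m ℕ.+ n) ≡ x ^ m * x ^ n
  ^-distribˡ-+ x zero    n = sym (*-identityˡ (x ^ n))
  ^-distribˡ-+ x (suc m) n =
    trans (cong (x *_) (^-distribˡ-+ x m n)) (sym (*-assoc x (x ^ m) (x ^ n)))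

  ^-*-assoc : ∀ x m n → (x ^ m) ^ n ≡ x ^ (m ℕ.* n)
  ^-*-assoc x m zero    = cong (x ^_) (sym (ℕ.*-zeroʳ m))
  ^-*-assoc x m (suc n) = begin
    x ^ m * (x ^ m) ^ n    ≡⟨ cong (x ^ m *_) (^-*-assoc x m n) ⟩
    x ^ m * x ^ (m ℕ.* n)  ≡⟨ ^-distribˡ-+ x m (m ℕ.* n) ⟨
    x ^ (m ℕ.+ m ℕ.* n)    ≡⟨ cong (x ^_) (ℕ.*-suc m n) ⟨
    x ^ (m ℕ.* suc n)      ∎
    where open ≡-Reasoning

  1-mono : ∀ {x y} → x ≤ y → 1ℚ - y ≤ 1ℚ - x
  1-mono x≤y = +-monoʳ-≤ 1ℚ (neg-antimono-≤ x≤y)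

  infixl 7 _·_
  _·_ : ℕ → ℚ → ℚ
  zero  · x = 0ℚ
  suc n · x = x + n · x

  ·-distribʳ-+ : ∀ x m n → (m ℕ.+ n) · x ≡ m · x + n · x
  ·-distribʳ-+ x zero    n = sym (+-identityˡ (n · x))
  ·-distribʳ-+ x (suc m) n =
    trans (cong (x +_) (·-distribʳ-+ x m n)) (sym (+-assoc x (m · x) (n · x)))

  ·-*-assoc : ∀ n x y → n · (x * y) ≡ n · x * y
  ·-*-assoc zero    x y = sym (*-zeroˡ y)
  ·-*-assoc (suc n) x y =
    trans (cong (x * y +_) (·-*-assoc n x y)) (sym (*-distribʳ-+ y x (n · x)))

  0≤· : ∀ n {x} → 0ℚ ≤ x → 0ℚ ≤ n · x
  0≤· zero    0≤x = ≤-refl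
  0≤· (suc n) 0≤x = +-mono-≤ 0≤x (0≤· n 0≤x)

  ·-mono : ∀ {m n x} → 0ℚ ≤ x → m ℕ.≤ n → m · x ≤ n · x
  ·-mono {n = n} 0≤x ℕ.z≤n       = 0≤· n 0≤x
  ·-mono {x = x} 0≤x (ℕ.s≤s m≤n) = +-monoʳ-≤ x (·-mono 0≤x m≤n)

  0≤½ : 0ℚ ≤ ½
  0≤½ = nonNegative⁻¹ ½

  ½≤1 : ½ ≤ 1ℚ
  ½≤1 = ≤-trans (≤-reflexive (sym (+-identityˡ ½))) (+-monoˡ-≤ ½ 0≤½)

  2^n·½^n : ∀ n → (2 ℕ.^ n) · (½ ^ n) ≡ 1ℚ
  2^n·½^n zero    = refl
  2^n·½^n (suc n) = begin
    (M ℕ.+ (M ℕ.+ 0)) · (½ * ½ ^ n)          ≡⟨ ·-distribʳ-+ _ M (M ℕ.+ 0) ⟩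
    M · (½ * ½ ^ n) + (M ℕ.+ 0) · (½ * ½ ^ n)
      ≡⟨ cong (λ m → M · (½ * ½ ^ n) + m · (½ * ½ ^ n)) (ℕ.+-identityʳ M) ⟩
    M · (½ * ½ ^ n) + M · (½ * ½ ^ n)        ≡⟨ cong (λ x → M · x + M · x) (*-comm ½ (½ ^ n)) ⟩
    M · (½ ^ n * ½) + M · (½ ^ n * ½)        ≡⟨ cong (λ x → x + x) (·-*-assoc M (½ ^ n) ½) ⟩
    M · (½ ^ n) * ½ + M · (½ ^ n) * ½        ≡⟨ cong (λ x → x * ½ + x * ½) (2^n·½^n n) ⟩
    1ℚ                                       ∎
    where
    open ≡-Reasoning
    M = 2 ℕ.^ n

  -- Multiplied out so that an upper bound on `(1ℚ - x) ^ n` needs neither division nor the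
  -- exponential function.
  bernoulli : ∀ x → 0ℚ ≤ x → x ≤ 1ℚ → ∀ n → (1ℚ - x) ^ n * (1ℚ + n · x) ≤ 1ℚ
  bernoulli x 0≤x x≤1 zero    = ≤-refl
  bernoulli x 0≤x x≤1 (suc n) = begin
    y * y ^ n * (1ℚ + (x + n · x))    ≡⟨ rearrange x (y ^ n) (n · x) ⟩
    y ^ n * (1ℚ + n · x - x * (x + n · x))
      ≤⟨ *-monoˡ (y ^ n) (0≤^ n 0≤y) step ⟩
    y ^ n * (1ℚ + n · x)              ≤⟨ bernoulli x 0≤x x≤1 n ⟩
    1ℚ                                ∎
    where
    open ≤-Reasoning
    open +-*-Solver
    y = 1ℚ - x
    0≤y : 0ℚ ≤ y
    0≤y = 1-mono x≤1
    rearrange : ∀ x z w → (1ℚ - x) * z * (1ℚ + (x + w)) ≡ z * (1ℚ + w - x * (x + w))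
    rearrange = solve 3 (λ x z w → (con 1ℚ :- x) :* z :* (con 1ℚ :+ (x :+ w))
                               := z :* (con 1ℚ :+ w :- x :* (x :+ w))) refl
    step : 1ℚ + n · x - x * (x + n · x) ≤ 1ℚ + n · x
    step = ≤-trans (+-monoʳ-≤ (1ℚ + n · x) (neg-antimono-≤ (0≤* 0≤x (0≤· (suc n) 0≤x))))
                   (≤-reflexive (+-identityʳ (1ℚ + n · x)))

  -- Bernoulli with `2 ^ n` factors and `x = ½ ^ n`: there `n · x` becomes exactly 1, so the second
  -- factor is 2.
  [1-½^n]^2^n≤½ : ∀ n → (1ℚ - ½ ^ n) ^ (2 ℕ.^ n) ≤ ½
  [1-½^n]^2^n≤½ n = begin
    y                      ≡⟨ halves y ⟩
    y * (1ℚ + 1ℚ) * ½      ≡⟨ cong (λ z → y * (1ℚ + z) * ½) (2^n·½^n n) ⟨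
    y * (1ℚ + (2 ℕ.^ n) · (½ ^ n)) * ½
      ≤⟨ *-monoʳ-≤-nonNeg ½ (bernoulli (½ ^ n) (0≤^ n 0≤½) (^≤1 n 0≤½ ½≤1) (2 ℕ.^ n)) ⟩
    1ℚ * ½                 ≡⟨⟩
    ½                      ∎
    where
    open ≤-Reasoning
    open +-*-Solver
    y = (1ℚ - ½ ^ n) ^ (2 ℕ.^ n)
    halves : ∀ y → y ≡ y * (1ℚ + 1ℚ) * ½
    halves = solve 1 (λ y → y := y :* (con 1ℚ :+ con 1ℚ) :* con ½) refl

-- The probability that no vertex meets a prescription

module RandomGraphs where

  open import Data.Bool.Base using (Bool; true; false; not; _∧_; if_then_else_)
  open import Data.Fin.Base using (zero; suc)
  open import Data.List.Base using (List; []; _∷_; map; foldr; length; _++_; cartesianProductWith)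
  open import Data.List.Properties using (map-++; map-∘)
  open import Data.List.Relation.Unary.All using (All; []; _∷_)
  open import Data.Nat.Base as ℕ using (ℕ; zero; suc)
  import Data.Nat.Properties as ℕ
  open import Data.Product using (∃; _×_; _,_)
  open import Data.Rational.Base using (ℚ; 0ℚ; 1ℚ; _+_; _*_; _-_; -_; _≤_; nonNegative)
  open import Data.Rational.Properties
  open import Data.Rational.Solver using (module +-*-Solver)
  open import Data.Vec.Base using (Vec; []; _∷_; lookup; zipWith)
  open import Function using (_∘_)
  open import Relation.Binary.PropositionalEquality hiding ([_])
  open import Relation.Nullary using (does; Dec)
  open import Defs using (Graph; []; _∷_; adjacent; ℝ; seq; 0ℝ; allBits; allGraphs; bitProb; rowProb; graphProb; ℙ[G⟨_,_⟩∈_])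
  import Defs
  open Rationals

  -- `fixed` vertices carry the prescription, `free` ones are candidates for meeting it, and `idle`
  -- ones include candidates ruled out by a row already read.
  data Label : Set where
    fixed     : Bool → Label
    free idle : Label

  #fixed : ∀ {n} → Vec Label n → ℕ
  #fixed []            = 0
  #fixed (fixed _ ∷ ℓ) = suc (#fixed ℓ)
  #fixed (free    ∷ ℓ) = #fixed ℓ
  #fixed (idle    ∷ ℓ) = #fixed ℓ

  #free : ∀ {n} → Vec Label n → ℕ
  #free []            = 0
  #free (fixed _ ∷ ℓ) = #free ℓ
  #free (free    ∷ ℓ) = suc (#free ℓ)
  #free (idle    ∷ ℓ) = #free ℓ

  agree : Bool → Bool → Bool
  agree true  c = c
  agree false c = not c

  -- A pair of vertices is stored in the row of the smaller one. Hence the condition between a fixed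
  -- vertex and a later candidate is settled on reaching the fixed vertex, where failing candidates
  -- become `idle`; the condition between a candidate and a later fixed vertex is left to `matches`.
  hide : Bool → Label → Bool → Label
  hide b (fixed c) _ = fixed c
  hide b free      c = if agree b c then free else idle
  hide b idle      _ = idle

  matches : ∀ {n} → Vec Label n → Vec Bool n → Bool
  matches []            []      = true
  matches (fixed b ∷ ℓ) (c ∷ r) = agree b c ∧ matches ℓ r
  matches (free    ∷ ℓ) (_ ∷ r) = matches ℓ r
  matches (idle    ∷ ℓ) (_ ∷ r) = matches ℓ r

  -- No free vertex v has, for every vertex u labelled fixed b, adjacency bit b to u.
  missed : ∀ {n} → Vec Label n → Graph n → Bool
  missed []            []      = true
  missed (fixed b ∷ ℓ) (r ∷ G) = missed (zipWith (hide b) ℓ r) G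
  missed (free    ∷ ℓ) (r ∷ G) = not (matches ℓ r) ∧ missed ℓ G
  missed (idle    ∷ ℓ) (r ∷ G) = missed ℓ G

  #fixed-hide : ∀ {n} b (ℓ : Vec Label n) r → #fixed (zipWith (hide b) ℓ r) ≡ #fixed ℓ
  #fixed-hide b []            []      = refl
  #fixed-hide b (fixed _ ∷ ℓ) (c ∷ r) = cong suc (#fixed-hide b ℓ r)
  #fixed-hide b (free    ∷ ℓ) (c ∷ r) with agree b c
  ... | true  = #fixed-hide b ℓ r
  ... | false = #fixed-hide b ℓ r
  #fixed-hide b (idle    ∷ ℓ) (c ∷ r) = #fixed-hide b ℓ r

  agree-≡ : ∀ b c → agree b c ≡ true → c ≡ b
  agree-≡ true  true  _ = refl
  agree-≡ false false _ = refl

  matches-sound : ∀ {n} (ℓ : Vec Label n) r → matches ℓ r ≡ true →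
                  ∀ u b → lookup ℓ u ≡ fixed b → lookup r u ≡ b
  matches-sound (fixed b ∷ ℓ) (c ∷ r) eq zero b refl with agree b c in e
  ... | true = agree-≡ b c e
  matches-sound (fixed b ∷ ℓ) (c ∷ r) eq (suc u) with agree b c
  ... | true = matches-sound ℓ r eq u
  matches-sound (free ∷ ℓ) (c ∷ r) eq (suc u) = matches-sound ℓ r eq u
  matches-sound (idle ∷ ℓ) (c ∷ r) eq (suc u) = matches-sound ℓ r eq u

  hide-free : ∀ {n} b (ℓ : Vec Label n) r v → lookup (zipWith (hide b) ℓ r) v ≡ free →
              lookup ℓ v ≡ free × lookup r v ≡ b
  hide-free b (free ∷ ℓ) (c ∷ r) zero eq with agree b c in e
  ... | true = refl , agree-≡ b c e
  hide-free b (_ ∷ ℓ) (c ∷ r) (suc v) eq = hide-free b ℓ r v eq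

  hide-fixed : ∀ {n} b (ℓ : Vec Label n) r u c → lookup ℓ u ≡ fixed c →
               lookup (zipWith (hide b) ℓ r) u ≡ fixed c
  hide-fixed b (_ ∷ ℓ) (_ ∷ r) zero    c refl = refl
  hide-fixed b (_ ∷ ℓ) (_ ∷ r) (suc u) c eq   = hide-fixed b ℓ r u c eq

  ¬missed⇒witness : ∀ {n} (ℓ : Vec Label n) G → missed ℓ G ≡ false →
    ∃ λ v → lookup ℓ v ≡ free × (∀ u b → lookup ℓ u ≡ fixed b → adjacent G u v ≡ b)
  ¬missed⇒witness [] [] ()
  ¬missed⇒witness (fixed b ∷ ℓ) (r ∷ G) eq with ¬missed⇒witness (zipWith (hide b) ℓ r) G eq
  ... | v , v-free , adj with hide-free b ℓ r v v-free
  ... | v-free′ , rv≡b = suc v , v-free′ , λ where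
    zero    _ refl → rv≡b
    (suc u) c e    → adj u c (hide-fixed b ℓ r u c e)
  ¬missed⇒witness (free ∷ ℓ) (r ∷ G) eq with matches ℓ r in m
  ... | true  = zero , refl , λ where (suc u) b e → matches-sound ℓ r m u b e
  ... | false with ¬missed⇒witness ℓ G eq
  ...   | v , v-free , adj = suc v , v-free , λ where (suc u) b e → adj u b e
  ¬missed⇒witness (idle ∷ ℓ) (r ∷ G) eq with ¬missed⇒witness ℓ G eq
  ... | v , v-free , adj = suc v , v-free , λ where (suc u) b e → adj u b e

  module Expectation (p : ℚ) where

    q : ℚ
    q = 1ℚ - p

    -- Merely a weighted sum: an early approximation of the edge probability may lie outside the
    -- unit interval, and linearity holds all the same. Positivity enters only in `Bounds`.
    Erow : ∀ n → (Vec Bool n → ℚ) → ℚ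
    Erow zero    f = f []
    Erow (suc n) f = p * Erow n (f ∘ (true ∷_)) + q * Erow n (f ∘ (false ∷_))

    E : ∀ n → (Graph n → ℚ) → ℚ
    E zero    f = f []
    E (suc n) f = Erow n λ r → E n λ G → f (r ∷ G)

    Erow-cong : ∀ n {f g} → (∀ r → f r ≡ g r) → Erow n f ≡ Erow n g
    Erow-cong zero    f≡g = f≡g []
    Erow-cong (suc n) f≡g =
      cong₂ (λ x y → p * x + q * y) (Erow-cong n (f≡g ∘ (true ∷_))) (Erow-cong n (f≡g ∘ (false ∷_)))

    pX+qX≡X : ∀ x → p * x + q * x ≡ x
    pX+qX≡X = solve 2 (λ p x → p :* x :+ (con 1ℚ :- p) :* x := x) refl p
      where open +-*-Solver

    Erow-const : ∀ n c → Erow n (λ _ → c) ≡ c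
    Erow-const zero    c = refl
    Erow-const (suc n) c = trans (pX+qX≡X _) (Erow-const n c)

    E-const : ∀ n c → E n (λ _ → c) ≡ c
    E-const zero    c = refl
    E-const (suc n) c = trans (Erow-cong n λ _ → E-const n c) (Erow-const n c)

    Erow-+ : ∀ n f g → Erow n (λ r → f r + g r) ≡ Erow n f + Erow n g
    Erow-+ zero    f g = refl
    Erow-+ (suc n) f g =
      trans (cong₂ (λ x y → p * x + q * y) (Erow-+ n _ _) (Erow-+ n _ _))
            (lemma p q (Erow n (f ∘ (true ∷_))) _ (Erow n (f ∘ (false ∷_))) _)
      where
      open +-*-Solver
      lemma : ∀ p q a b c d → p * (a + b) + q * (c + d) ≡ (p * a + q * c) + (p * b + q * d)
      lemma = solve 6 (λ p q a b c d → p :* (a :+ b) :+ q :* (c :+ d)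
                                    := (p :* a :+ q :* c) :+ (p :* b :+ q :* d)) refl

    E-+ : ∀ n f g → E n (λ G → f G + g G) ≡ E n f + E n g
    E-+ zero    f g = refl
    E-+ (suc n) f g = trans (Erow-cong n λ r → E-+ n _ _) (Erow-+ n _ _)

    Erow-* : ∀ n c f → Erow n (λ r → c * f r) ≡ c * Erow n f
    Erow-* zero    c f = refl
    Erow-* (suc n) c f =
      trans (cong₂ (λ x y → p * x + q * y) (Erow-* n c _) (Erow-* n c _))
            (lemma p q c (Erow n (f ∘ (true ∷_))) (Erow n (f ∘ (false ∷_))))
      where
      open +-*-Solver
      lemma : ∀ p q c a b → p * (c * a) + q * (c * b) ≡ c * (p * a + q * b)
      lemma = solve 5 (λ p q c a b → p :* (c :* a) :+ q :* (c :* b)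
                                  := c :* (p :* a :+ q :* b)) refl

    E-* : ∀ n c f → E n (λ G → c * f G) ≡ c * E n f
    E-* zero    c f = refl
    E-* (suc n) c f = trans (Erow-cong n λ r → E-* n c _) (Erow-* n c _)

    module Bounds (π : ℚ) (0≤π : 0ℚ ≤ π) (π≤p : π ≤ p) (π≤q : π ≤ q) where

      0≤p : 0ℚ ≤ p
      0≤p = ≤-trans 0≤π π≤p

      0≤q : 0ℚ ≤ q
      0≤q = ≤-trans 0≤π π≤q

      π≤1 : π ≤ 1ℚ
      π≤1 = begin
        π           ≡⟨ +-identityʳ π ⟨
        π + 0ℚ      ≤⟨ +-mono-≤ π≤p 0≤q ⟩
        p + q       ≡⟨ cong₂ _+_ (*-identityʳ p) (*-identityʳ q) ⟨
        p * 1ℚ + q * 1ℚ  ≡⟨ pX+qX≡X 1ℚ ⟩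
        1ℚ          ∎
        where open ≤-Reasoning

      Erow-mono : ∀ n {f g} → (∀ r → f r ≤ g r) → Erow n f ≤ Erow n g
      Erow-mono zero    f≤g = f≤g []
      Erow-mono (suc n) f≤g = +-mono-≤ (*-monoˡ p 0≤p (Erow-mono n (f≤g ∘ (true ∷_))))
                                       (*-monoˡ q 0≤q (Erow-mono n (f≤g ∘ (false ∷_))))

      E-mono : ∀ n {f g} → (∀ G → f G ≤ g G) → E n f ≤ E n g
      E-mono zero    f≤g = f≤g []
      E-mono (suc n) f≤g = Erow-mono n λ r → E-mono n λ G → f≤g (r ∷ G)

      p-step : ∀ {x} → 0ℚ ≤ x → p * (1ℚ - x) + q ≤ 1ℚ - π * x
      p-step {x} 0≤x = ≤-trans (≤-reflexive (lemma p x)) (1-mono (*-monoʳ-≤-nonNeg x {{nonNegative 0≤x}} π≤p))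
        where
        open +-*-Solver
        lemma : ∀ p x → p * (1ℚ - x) + (1ℚ - p) ≡ 1ℚ - p * x
        lemma = solve 2 (λ p x → p :* (con 1ℚ :- x) :+ (con 1ℚ :- p) := con 1ℚ :- p :* x) refl

      q-step : ∀ {x} → 0ℚ ≤ x → p + q * (1ℚ - x) ≤ 1ℚ - π * x
      q-step {x} 0≤x = ≤-trans (≤-reflexive (lemma p x)) (1-mono (*-monoʳ-≤-nonNeg x {{nonNegative 0≤x}} π≤q))
        where
        open +-*-Solver
        lemma : ∀ p x → p + (1ℚ - p) * (1ℚ - x) ≡ 1ℚ - (1ℚ - p) * x
        lemma = solve 2 (λ p x → p :+ (con 1ℚ :- p) :* (con 1ℚ :- x) := con 1ℚ :- (con 1ℚ :- p) :* x) refl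

      0≤π^ : ∀ k → 0ℚ ≤ π ^ k
      0≤π^ k = 0≤^ k 0≤π

      0≤1-π^ : ∀ k → 0ℚ ≤ 1ℚ - π ^ k
      0≤1-π^ k = 1-mono (^≤1 k 0≤π π≤1)

      -- Every fixed position is matched with weight `p` or `q`, both at least `π`; the other
      -- positions sum out.
      row-mismatch : ∀ {n} (ℓ : Vec Label n) →
        Erow n (λ r → [ not (matches ℓ r) ]ᵇ) ≤ 1ℚ - π ^ #fixed ℓ
      row-mismatch []                    = ≤-refl
      row-mismatch {suc n} (fixed true  ∷ ℓ) = begin
        p * X + q * Erow n (λ _ → 1ℚ)
          ≡⟨ cong (λ y → p * X + y) (trans (cong (q *_) (Erow-const n 1ℚ)) (*-identityʳ q)) ⟩
        p * X + q                       ≤⟨ +-monoˡ-≤ q (*-monoˡ p 0≤p (row-mismatch ℓ)) ⟩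
        p * (1ℚ - π ^ #fixed ℓ) + q     ≤⟨ p-step (0≤π^ (#fixed ℓ)) ⟩
        1ℚ - π * π ^ #fixed ℓ           ∎
        where
        open ≤-Reasoning
        X = Erow n (λ r → [ not (matches ℓ r) ]ᵇ)
      row-mismatch {suc n} (fixed false ∷ ℓ) = begin
        p * Erow n (λ _ → 1ℚ) + q * X
          ≡⟨ cong (λ y → y + q * X) (trans (cong (p *_) (Erow-const n 1ℚ)) (*-identityʳ p)) ⟩
        p + q * X                       ≤⟨ +-monoʳ-≤ p (*-monoˡ q 0≤q (row-mismatch ℓ)) ⟩
        p + q * (1ℚ - π ^ #fixed ℓ)     ≤⟨ q-step (0≤π^ (#fixed ℓ)) ⟩
        1ℚ - π * π ^ #fixed ℓ           ∎
        where
        open ≤-Reasoning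
        X = Erow n (λ r → [ not (matches ℓ r) ]ᵇ)
      row-mismatch (free ∷ ℓ) = ≤-trans (≤-reflexive (pX+qX≡X _)) (row-mismatch ℓ)
      row-mismatch (idle ∷ ℓ) = ≤-trans (≤-reflexive (pX+qX≡X _)) (row-mismatch ℓ)

      -- The number of surviving candidates is random, so the induction needs the mean of a power of
      -- `1ℚ - x`. Each candidate survives with weight at least `π`, which replaces its factor
      -- `1ℚ - x` by at most `1ℚ - π * x`.
      row-hide : ∀ {n} b (ℓ : Vec Label n) x → 0ℚ ≤ x → x ≤ 1ℚ →
        Erow n (λ r → (1ℚ - x) ^ #free (zipWith (hide b) ℓ r)) ≤ (1ℚ - π * x) ^ #free ℓ
      row-hide b     []            x 0≤x x≤1 = ≤-refl
      row-hide b     (fixed _ ∷ ℓ) x 0≤x x≤1 = ≤-trans (≤-reflexive (pX+qX≡X _)) (row-hide b ℓ x 0≤x x≤1)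
      row-hide b     (idle    ∷ ℓ) x 0≤x x≤1 = ≤-trans (≤-reflexive (pX+qX≡X _)) (row-hide b ℓ x 0≤x x≤1)
      row-hide {suc n} true  (free ∷ ℓ) x 0≤x x≤1 = begin
        p * Erow n (λ r → y * f r) + q * Erow n f
          ≡⟨ cong (λ z → p * z + q * Erow n f) (Erow-* n y f) ⟩
        p * (y * Erow n f) + q * Erow n f  ≡⟨ lemma p q y (Erow n f) ⟩
        (p * y + q) * Erow n f
          ≤⟨ *-mono (+-mono-≤ (0≤* 0≤p 0≤y) 0≤q) (0≤^ (#free ℓ) 0≤πx) (p-step 0≤x) (row-hide true ℓ x 0≤x x≤1) ⟩
        (1ℚ - π * x) * (1ℚ - π * x) ^ #free ℓ ∎
        where
        open ≤-Reasoning
        open +-*-Solver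
        y = 1ℚ - x
        0≤y : 0ℚ ≤ y
        0≤y = 1-mono x≤1
        0≤πx : 0ℚ ≤ 1ℚ - π * x
        0≤πx = 1-mono (*-mono 0≤π (nonNegative⁻¹ 1ℚ) π≤1 x≤1)
        f = λ r → y ^ #free (zipWith (hide true) ℓ r)
        lemma : ∀ p q y e → p * (y * e) + q * e ≡ (p * y + q) * e
        lemma = solve 4 (λ p q y e → p :* (y :* e) :+ q :* e := (p :* y :+ q) :* e) refl
      row-hide {suc n} false (free ∷ ℓ) x 0≤x x≤1 = begin
        p * Erow n f + q * Erow n (λ r → y * f r)
          ≡⟨ cong (λ z → p * Erow n f + q * z) (Erow-* n y f) ⟩
        p * Erow n f + q * (y * Erow n f)  ≡⟨ lemma p q y (Erow n f) ⟩
        (p + q * y) * Erow n f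
          ≤⟨ *-mono (+-mono-≤ 0≤p (0≤* 0≤q 0≤y)) (0≤^ (#free ℓ) 0≤πx) (q-step 0≤x) (row-hide false ℓ x 0≤x x≤1) ⟩
        (1ℚ - π * x) * (1ℚ - π * x) ^ #free ℓ ∎
        where
        open ≤-Reasoning
        open +-*-Solver
        y = 1ℚ - x
        0≤y : 0ℚ ≤ y
        0≤y = 1-mono x≤1
        0≤πx : 0ℚ ≤ 1ℚ - π * x
        0≤πx = 1-mono (*-mono 0≤π (nonNegative⁻¹ 1ℚ) π≤1 x≤1)
        f = λ r → y ^ #free (zipWith (hide false) ℓ r)
        lemma : ∀ p q y e → p * e + q * (y * e) ≡ (p + q * y) * e
        lemma = solve 4 (λ p q y e → p :* e :+ q :* (y :* e) := (p :+ q :* y) :* e) refl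

      0≤Erow : ∀ n f → (∀ r → 0ℚ ≤ f r) → 0ℚ ≤ Erow n f
      0≤Erow n f 0≤f = ≤-trans (≤-reflexive (sym (Erow-const n 0ℚ))) (Erow-mono n 0≤f)

      -- Candidates fail independently, each succeeding with weight at least `π ^ #fixed ℓ`. A fixed
      -- vertex is handled by `row-hide`; the row of a free vertex is independent of all later rows,
      -- so its factor splits off.
      E-missed : ∀ {n} (ℓ : Vec Label n) →
        E n (λ G → [ missed ℓ G ]ᵇ) ≤ (1ℚ - π ^ #fixed ℓ) ^ #free ℓ
      E-missed []            = ≤-refl
      E-missed {suc n} (fixed b ∷ ℓ) = begin
        Erow n (λ r → E n λ G → [ missed (zipWith (hide b) ℓ r) G ]ᵇ)
          ≤⟨ Erow-mono n (λ r → E-missed (zipWith (hide b) ℓ r)) ⟩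
        Erow n (λ r → (1ℚ - π ^ #fixed (zipWith (hide b) ℓ r)) ^ #free (zipWith (hide b) ℓ r))
          ≡⟨ Erow-cong n (λ r → cong (λ k → (1ℚ - π ^ k) ^ #free (zipWith (hide b) ℓ r)) (#fixed-hide b ℓ r)) ⟩
        Erow n (λ r → (1ℚ - π ^ #fixed ℓ) ^ #free (zipWith (hide b) ℓ r))
          ≤⟨ row-hide b ℓ (π ^ #fixed ℓ) (0≤π^ (#fixed ℓ)) (^≤1 (#fixed ℓ) 0≤π π≤1) ⟩
        (1ℚ - π * π ^ #fixed ℓ) ^ #free ℓ  ∎
        where open ≤-Reasoning
      E-missed {suc n} (free ∷ ℓ) = begin
        Erow n (λ r → E n λ G → [ not (matches ℓ r) ∧ missed ℓ G ]ᵇ)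
          ≡⟨ Erow-cong n (λ r → trans (E-cong n λ G → []ᵇ-∧ (not (matches ℓ r)) (missed ℓ G))
                                      (trans (E-* n [ not (matches ℓ r) ]ᵇ _) (*-comm [ not (matches ℓ r) ]ᵇ M))) ⟩
        Erow n (λ r → M * [ not (matches ℓ r) ]ᵇ)
          ≡⟨ trans (Erow-* n M _) (*-comm M _) ⟩
        Erow n (λ r → [ not (matches ℓ r) ]ᵇ) * M
          ≤⟨ *-mono (0≤Erow n _ (λ r → 0≤[]ᵇ (not (matches ℓ r)))) (0≤^ (#free ℓ) (0≤1-π^ (#fixed ℓ)))
                    (row-mismatch ℓ) (E-missed ℓ) ⟩
        (1ℚ - π ^ #fixed ℓ) * (1ℚ - π ^ #fixed ℓ) ^ #free ℓ ∎
        where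
        open ≤-Reasoning
        M = E n (λ G → [ missed ℓ G ]ᵇ)
        E-cong : ∀ n {f g} → (∀ G → f G ≡ g G) → E n f ≡ E n g
        E-cong zero    f≡g = f≡g []
        E-cong (suc n) f≡g = Erow-cong n λ r → E-cong n λ G → f≡g (r ∷ G)
      E-missed {suc n} (idle ∷ ℓ) = ≤-trans (≤-reflexive (Erow-const n _)) (E-missed ℓ)

      E-union : ∀ {A : Set} n (f : A → Graph n → ℚ) {c} {xs : List A} →
        All (λ x → E n (f x) ≤ c) xs →
        E n (λ G → foldr (λ x y → f x G + y) 0ℚ xs) ≤ length xs · c
      E-union n f []           = ≤-reflexive (E-const n 0ℚ)
      E-union n f (Efx≤c ∷ Efxs≤c) =
        ≤-trans (≤-reflexive (E-+ n _ _)) (+-mono-≤ Efx≤c (E-union n f Efxs≤c))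

  sum : List ℚ → ℚ
  sum = foldr _+_ 0ℚ

  sum-++ : ∀ xs ys → sum (xs ++ ys) ≡ sum xs + sum ys
  sum-++ []       ys = sym (+-identityˡ (sum ys))
  sum-++ (x ∷ xs) ys = trans (cong (x +_) (sum-++ xs ys)) (sym (+-assoc x (sum xs) (sum ys)))

  sum-map-* : ∀ {A : Set} c (f : A → ℚ) xs → sum (map (λ x → c * f x) xs) ≡ c * sum (map f xs)
  sum-map-* c f []       = sym (*-zeroʳ c)
  sum-map-* c f (x ∷ xs) =
    trans (cong (c * f x +_) (sum-map-* c f xs)) (sym (*-distribˡ-+ c (f x) (sum (map f xs))))

  sum-map-cong : ∀ {A : Set} {f g : A → ℚ} → (∀ x → f x ≡ g x) → ∀ xs → sum (map f xs) ≡ sum (map g xs)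
  sum-map-cong f≡g []       = refl
  sum-map-cong f≡g (x ∷ xs) = cong₂ _+_ (f≡g x) (sum-map-cong f≡g xs)

  sum-cartesian : ∀ {A B C : Set} (f : C → ℚ) (g : A → B → C) xs ys →
    sum (map f (cartesianProductWith g xs ys)) ≡ sum (map (λ x → sum (map (λ y → f (g x y)) ys)) xs)
  sum-cartesian f g []       ys = refl
  sum-cartesian f g (x ∷ xs) ys = begin
    sum (map f (map (g x) ys ++ rest))              ≡⟨ cong sum (map-++ f (map (g x) ys) rest) ⟩
    sum (map f (map (g x) ys) ++ map f rest)        ≡⟨ sum-++ (map f (map (g x) ys)) (map f rest) ⟩
    sum (map f (map (g x) ys)) + sum (map f rest)
      ≡⟨ cong₂ _+_ (cong sum (sym (map-∘ ys))) (sum-cartesian f g xs ys) ⟩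
    sum (map (λ y → f (g x y)) ys) + sum (map (λ x → sum (map (λ y → f (g x y)) ys)) xs) ∎
    where
    open ≡-Reasoning
    rest = cartesianProductWith g xs ys

  module _ (p : ℝ) (i : ℕ) where
    open Expectation (seq p i)

    sum-allBits : ∀ n (f : Vec Bool n → ℚ) →
      sum (map (λ r → seq (rowProb p r) i * f r) (allBits n)) ≡ Erow n f
    sum-allBits zero    f = trans (+-identityʳ _) (*-identityˡ (f []))
    sum-allBits (suc n) f = begin
      sum (map F (allBits (suc n)))
        ≡⟨ sum-cartesian F _∷_ (true ∷ false ∷ []) (allBits n) ⟩
      sum (map (λ r → F (true ∷ r)) (allBits n)) + (sum (map (λ r → F (false ∷ r)) (allBits n)) + 0ℚ)
        ≡⟨ cong₂ _+_ (half true) (trans (+-identityʳ _) (half false)) ⟩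
      Erow (suc n) f ∎
      where
      open ≡-Reasoning
      F : Vec Bool (suc n) → ℚ
      F r = seq (rowProb p r) i * f r
      half : ∀ b → sum (map (λ r → F (b ∷ r)) (allBits n)) ≡ seq (bitProb p b) i * Erow n (f ∘ (b ∷_))
      half b = trans (sum-map-cong (λ r → *-assoc (seq (bitProb p b) i) (seq (rowProb p r) i) (f (b ∷ r))) (allBits n))
               (trans (sum-map-* (seq (bitProb p b) i) _ (allBits n))
                      (cong (seq (bitProb p b) i *_) (sum-allBits n (f ∘ (b ∷_)))))

    sum-allGraphs : ∀ n (f : Graph n → ℚ) →
      sum (map (λ G → seq (graphProb p G) i * f G) (allGraphs n)) ≡ E n f
    sum-allGraphs zero    f = trans (+-identityʳ _) (*-identityˡ (f []))
    sum-allGraphs (suc n) f = begin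
      sum (map F (allGraphs (suc n)))
        ≡⟨ sum-cartesian F _∷_ (allBits n) (allGraphs n) ⟩
      sum (map (λ r → sum (map (λ G → F (r ∷ G)) (allGraphs n))) (allBits n))
        ≡⟨ sum-map-cong row (allBits n) ⟩
      sum (map (λ r → seq (rowProb p r) i * E n (λ G → f (r ∷ G))) (allBits n))
        ≡⟨ sum-allBits n _ ⟩
      E (suc n) f ∎
      where
      open ≡-Reasoning
      F : Graph (suc n) → ℚ
      F G = seq (graphProb p G) i * f G
      row : ∀ r → sum (map (λ G → F (r ∷ G)) (allGraphs n)) ≡ seq (rowProb p r) i * E n (λ G → f (r ∷ G))
      row r = trans (sum-map-cong (λ G → *-assoc (seq (rowProb p r) i) (seq (graphProb p G) i) (f (r ∷ G))) (allGraphs n))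
              (trans (sum-map-* (seq (rowProb p r) i) _ (allGraphs n))
                     (cong (seq (rowProb p r) i *_) (sum-allGraphs n (λ G → f (r ∷ G)))))

    -- An equality of rationals at each index, not only in the limit, because sums and products of
    -- reals are formed index by index.
    seq-ℙ : ∀ n {A : Graph n → Set} (A? : ∀ G → Dec (A G)) →
      seq ℙ[G⟨ n , p ⟩∈ A? ] i ≡ E n (λ G → [ does (A? G) ]ᵇ)
    seq-ℙ n A? = trans (go (allGraphs n)) (sum-allGraphs n _)
      where
      term : ∀ b (G : Graph n) → seq (if b then graphProb p G else 0ℝ) i ≡ seq (graphProb p G) i * [ b ]ᵇ
      term true  G = sym (*-identityʳ _)
      term false G = sym (*-zeroʳ (seq (graphProb p G) i))
      go : ∀ Gs → seq (Defs.sum (map (λ G → if does (A? G) then graphProb p G else 0ℝ) Gs)) i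
                ≡ sum (map (λ G → seq (graphProb p G) i * [ does (A? G) ]ᵇ) Gs)
      go []       = refl
      go (G ∷ Gs) = cong₂ _+_ (term (does (A? G)) G) (go Gs)

-- Extensibility by a union bound

module Extensibility where

  open import Data.Bool.Base using (Bool; true; false)
  open import Data.Empty using (⊥-elim)
  open import Data.Fin.Base using (Fin; zero; suc)
  import Data.Fin.Properties as Fin
  open import Data.List.Base using (List; []; _∷_; map; foldr; length; _++_; cartesianProductWith; cartesianProduct; allFin)
  open import Data.List.Properties using (length-++; length-map; length-tabulate)
  open import Data.List.Membership.Propositional using (_∈_)
  open import Data.List.Membership.Propositional.Properties using (∈-++⁺ˡ; ∈-++⁺ʳ; ∈-cartesianProductWith⁺; ∈-cartesianProduct⁺; ∈-allFin)
  open import Data.List.Relation.Unary.Any using (here; there)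
  open import Data.List.Relation.Unary.All as All using (All; []; _∷_)
  import Data.List.Relation.Unary.All.Properties as All
  open import Data.Nat.Base as ℕ using (ℕ; zero; suc; s≤s; z≤n; _∸_)
  import Data.Nat.Properties as ℕ
  open import Data.Nat.Tactic.RingSolver using (solve-∀)
  open import Data.Product using (∃; _×_; _,_)
  open import Data.Sum using (_⊎_; inj₁; inj₂)
  open import Data.Rational.Base using (ℚ; 0ℚ; 1ℚ; ½; _+_; _*_; _-_; -_; _≤_)
  open import Data.Rational.Properties
  open import Data.Vec.Base using (Vec; []; _∷_; lookup; replicate; _[_]≔_)
  open import Data.Vec.Properties using (lookup∘update; lookup∘update′)
  open import Function using (_∘_; case_of_)
  open import Relation.Binary.PropositionalEquality hiding ([_])
  open import Relation.Nullary using (¬_; does; Dec; yes; no)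
  open import Defs using (Graph; []; _∷_; adjacent)
  open Rationals
  open RandomGraphs

  Functional : ∀ {A B : Set} → List (A × B) → Set
  Functional us = ∀ u b c → (u , b) ∈ us → (u , c) ∈ us → b ≡ c

  Extensible : ∀ {n} → ℕ → Graph n → Set
  Extensible {n} s G = ∀ (us : List (Fin n × Bool)) → length us ℕ.≤ s → Functional us →
    ∃ λ v → ∀ u b → (u , b) ∈ us → u ≢ v × adjacent G u v ≡ b

  labels : ∀ {n} → List (Fin n × Bool) → Vec Label n
  labels []             = replicate _ free
  labels ((u , b) ∷ us) = labels us [ u ]≔ fixed b

  labels-fixed : ∀ {n} (us : List (Fin n × Bool)) → Functional us →
    ∀ u b → (u , b) ∈ us → lookup (labels us) u ≡ fixed b
  labels-fixed ((w , c) ∷ us) fun u b u∈ with w Fin.≟ u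
  ... | yes refl = trans (lookup∘update w (labels us) (fixed c)) (cong fixed (fun w c b (here refl) u∈))
  ... | no  w≢u  with u∈
  ...   | here refl = ⊥-elim (w≢u refl)
  ...   | there u∈′ = trans (lookup∘update′ (w≢u ∘ sym) (labels us) (fixed c))
                            (labels-fixed us (λ u b c p q → fun u b c (there p) (there q)) u b u∈′)

  place : ∀ {n} → Fin n × Bool → Vec Label n → Vec Label n
  place (u , b) ℓ = ℓ [ u ]≔ fixed b

  pairs : ∀ n → List (Fin n × Bool)
  pairs n = cartesianProduct (allFin n) (true ∷ false ∷ [])

  -- Repetitions are harmless in a union bound. Retaining `specs n s` admits prescriptions of every
  -- length up to the bound, and makes the total exactly `(1 + 2n) ^ s`.
  specs : ∀ n → ℕ → List (Vec Label n)
  specs n zero    = replicate n free ∷ []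
  specs n (suc s) = specs n s ++ cartesianProductWith place (pairs n) (specs n s)

  ∈-bools : ∀ b → b ∈ true ∷ false ∷ []
  ∈-bools true  = here refl
  ∈-bools false = there (here refl)

  labels∈specs : ∀ {n} s (us : List (Fin n × Bool)) → length us ℕ.≤ s → labels us ∈ specs n s
  labels∈specs zero    []       _         = here refl
  labels∈specs (suc s) []       _         = ∈-++⁺ˡ (labels∈specs s [] z≤n)
  labels∈specs {n} (suc s) ((u , b) ∷ us) (s≤s ≤s) = ∈-++⁺ʳ (specs n s)
    (∈-cartesianProductWith⁺ place (∈-cartesianProduct⁺ (∈-allFin u) (∈-bools b)) (labels∈specs s us ≤s))

  length-cartesianProductWith : ∀ {A B C : Set} (f : A → B → C) xs ys →
    length (cartesianProductWith f xs ys) ≡ length xs ℕ.* length ys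
  length-cartesianProductWith f []       ys = refl
  length-cartesianProductWith f (x ∷ xs) ys =
    trans (length-++ (map (f x) ys)) (cong₂ ℕ._+_ (length-map (f x) ys) (length-cartesianProductWith f xs ys))

  length-specs : ∀ n s → length (specs n s) ≡ (1 ℕ.+ n ℕ.* 2) ℕ.^ s
  length-specs n zero    = refl
  length-specs n (suc s) = begin
    length (specs n s ++ cartesianProductWith place (pairs n) (specs n s))
      ≡⟨ length-++ (specs n s) ⟩
    L ℕ.+ length (cartesianProductWith place (pairs n) (specs n s))
      ≡⟨ cong (L ℕ.+_) (length-cartesianProductWith place (pairs n) (specs n s)) ⟩
    L ℕ.+ length (pairs n) ℕ.* L
      ≡⟨ cong (λ k → L ℕ.+ k ℕ.* L) (trans (length-cartesianProductWith _,_ (allFin n) (true ∷ false ∷ []))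
                                           (cong (ℕ._* 2) (length-tabulate {n = n} (λ i → i)))) ⟩
    L ℕ.+ n ℕ.* 2 ℕ.* L   ≡⟨ cong ((1 ℕ.+ n ℕ.* 2) ℕ.*_) (length-specs n s) ⟩
    (1 ℕ.+ n ℕ.* 2) ℕ.* (1 ℕ.+ n ℕ.* 2) ℕ.^ s ∎
    where
    open ≡-Reasoning
    L = length (specs n s)

  #fixed-place : ∀ {n} (ℓ : Vec Label n) u b → #fixed (place (u , b) ℓ) ℕ.≤ suc (#fixed ℓ)
  #fixed-place (fixed _ ∷ ℓ) zero    b = ℕ.n≤1+n _
  #fixed-place (free    ∷ ℓ) zero    b = ℕ.≤-refl
  #fixed-place (idle    ∷ ℓ) zero    b = ℕ.≤-refl
  #fixed-place (fixed _ ∷ ℓ) (suc u) b = s≤s (#fixed-place ℓ u b)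
  #fixed-place (free    ∷ ℓ) (suc u) b = #fixed-place ℓ u b
  #fixed-place (idle    ∷ ℓ) (suc u) b = #fixed-place ℓ u b

  #free-place : ∀ {n} (ℓ : Vec Label n) u b → #free ℓ ℕ.≤ suc (#free (place (u , b) ℓ))
  #free-place (fixed _ ∷ ℓ) zero    b = ℕ.n≤1+n _
  #free-place (free    ∷ ℓ) zero    b = ℕ.≤-refl
  #free-place (idle    ∷ ℓ) zero    b = ℕ.n≤1+n _
  #free-place (fixed _ ∷ ℓ) (suc u) b = #free-place ℓ u b
  #free-place (free    ∷ ℓ) (suc u) b = s≤s (#free-place ℓ u b)
  #free-place (idle    ∷ ℓ) (suc u) b = #free-place ℓ u b

  Sparse : ∀ {n} → ℕ → Vec Label n → Set
  Sparse {n} s ℓ = #fixed ℓ ℕ.≤ s × n ℕ.≤ s ℕ.+ #free ℓ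

  All-cartesianProductWith : ∀ {A B C : Set} {P : B → Set} {Q : C → Set} (f : A → B → C) →
    (∀ x {y} → P y → Q (f x y)) → ∀ xs {ys} → All P ys → All Q (cartesianProductWith f xs ys)
  All-cartesianProductWith f PQ []       Pys = []
  All-cartesianProductWith f PQ (x ∷ xs) Pys =
    All.++⁺ (All.map⁺ (All.map (PQ x) Pys)) (All-cartesianProductWith f PQ xs Pys)

  specs-sparse : ∀ n s → All (Sparse s) (specs n s)
  specs-sparse n zero    = (#fixed-free n , ℕ.≤-reflexive (sym (#free-free n))) ∷ []
    where
    #fixed-free : ∀ n → #fixed (replicate n free) ℕ.≤ 0
    #fixed-free zero    = z≤n
    #fixed-free (suc n) = #fixed-free n
    #free-free : ∀ n → #free (replicate n free) ≡ n
    #free-free zero    = refl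
    #free-free (suc n) = cong suc (#free-free n)
  specs-sparse n (suc s) = All.++⁺
    (All.map (λ (a , b) → ℕ.m≤n⇒m≤1+n a , ℕ.m≤n⇒m≤1+n b) (specs-sparse n s))
    (All-cartesianProductWith place
      (λ (u , b) {ℓ} (x , y) → ℕ.≤-trans (#fixed-place ℓ u b) (s≤s x)
                             , ℕ.≤-trans y (ℕ.≤-trans (ℕ.+-monoʳ-≤ s (#free-place ℓ u b))
                                                      (ℕ.≤-reflexive (ℕ.+-suc s _))))
      (pairs n) (specs-sparse n s))

  #missed : ∀ {n} → ℕ → Graph n → ℚ
  #missed {n} s G = foldr (λ ℓ x → [ missed ℓ G ]ᵇ + x) 0ℚ (specs n s)

  -- The first moment method, pointwise: either no labelling is missed and the graph is extensible,
  -- or the count is at least 1 and can absorb the failure.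
  extensible⊎missed : ∀ {n} s (G : Graph n) → (Extensible s G × 0ℚ ≤ #missed s G) ⊎ 1ℚ ≤ #missed s G
  extensible⊎missed {n} s G with go (specs n s)
    where
    count : List (Vec Label n) → ℚ
    count = foldr (λ ℓ x → [ missed ℓ G ]ᵇ + x) 0ℚ
    0≤count : ∀ ℓs → 0ℚ ≤ count ℓs
    0≤count []       = ≤-refl
    0≤count (ℓ ∷ ℓs) = +-mono-≤ (0≤[]ᵇ (missed ℓ G)) (0≤count ℓs)
    go : ∀ ℓs → (All (λ ℓ → missed ℓ G ≡ false) ℓs × 0ℚ ≤ count ℓs) ⊎ 1ℚ ≤ count ℓs
    go []       = inj₁ ([] , ≤-refl)
    go (ℓ ∷ ℓs) with missed ℓ G in eq | go ℓs
    ... | true  | _               = inj₂ (≤-trans (≤-reflexive (sym (+-identityʳ 1ℚ))) (+-monoʳ-≤ 1ℚ (0≤count ℓs)))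
    ... | false | inj₁ (all , 0≤) = inj₁ (eq ∷ all , ≤-trans 0≤ (≤-reflexive (sym (+-identityˡ (count ℓs)))))
    ... | false | inj₂ 1≤         = inj₂ (≤-trans 1≤ (≤-reflexive (sym (+-identityˡ (count ℓs)))))
  ... | inj₂ 1≤         = inj₂ 1≤
  ... | inj₁ (all , 0≤) = inj₁ (ext , 0≤)
    where
    ext : Extensible s G
    ext us ≤s fun with ¬missed⇒witness (labels us) G (All.lookup all (labels∈specs s us ≤s))
    ... | v , v-free , adj = v , λ u b u∈ →
      (λ where refl → case trans (sym v-free) (labels-fixed us fun u b u∈) of λ ())
      , adj u b (labels-fixed us fun u b u∈)

  -- The exponent `j` below, with `s` enlarged to `D`, leaves room for one more unit. The
  -- requirement `8 ≤ D` comes from here.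
  polynomial≤2^ : ∀ m → let D = 8 ℕ.+ m in suc ((2 ℕ.+ (D ℕ.+ D)) ℕ.* D ℕ.+ 2) ℕ.≤ 2 ℕ.^ D
  polynomial≤2^ zero    = ℕ.≤ᵇ⇒≤ _ _ _
  polynomial≤2^ (suc m) = begin
    suc ((2 ℕ.+ (suc D ℕ.+ suc D)) ℕ.* suc D ℕ.+ 2)  ≤⟨ ℕ.m≤m+n _ _ ⟩
    -- The added polynomial is the exact difference between twice the bound at `D` and the bound at
    -- `suc D`.
    suc ((2 ℕ.+ (suc D ℕ.+ suc D)) ℕ.* suc D ℕ.+ 2) ℕ.+ (2 ℕ.* m ℕ.* m ℕ.+ 30 ℕ.* m ℕ.+ 111)
      ≡⟨ lemma m ⟩
    2 ℕ.* suc ((2 ℕ.+ (D ℕ.+ D)) ℕ.* D ℕ.+ 2)        ≤⟨ ℕ.*-monoʳ-≤ 2 (polynomial≤2^ m) ⟩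
    2 ℕ.* 2 ℕ.^ D ∎
    where
    open ℕ.≤-Reasoning
    D = 8 ℕ.+ m
    lemma : ∀ m → suc ((2 ℕ.+ (suc (8 ℕ.+ m) ℕ.+ suc (8 ℕ.+ m))) ℕ.* suc (8 ℕ.+ m) ℕ.+ 2) ℕ.+ (2 ℕ.* m ℕ.* m ℕ.+ 30 ℕ.* m ℕ.+ 111)
            ≡ 2 ℕ.* suc ((2 ℕ.+ ((8 ℕ.+ m) ℕ.+ (8 ℕ.+ m))) ℕ.* (8 ℕ.+ m) ℕ.+ 2)
    lemma = solve-∀

  D<2^D : ∀ D → D ℕ.< 2 ℕ.^ D
  D<2^D zero    = s≤s z≤n
  D<2^D (suc D) = ℕ.≤-trans (s≤s (D<2^D D))
    (ℕ.≤-trans (ℕ.+-monoˡ-≤ (2 ℕ.^ D) (ℕ.m^n>0 2 D)) (ℕ.+-monoʳ-≤ (2 ℕ.^ D) (ℕ.m≤m+n _ 0)))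

  ¼ : ℚ
  ¼ = ½ * ½

  module _ (p : ℚ) (d : ℕ) (π≤p : ½ ^ d ≤ p) (π≤q : ½ ^ d ≤ 1ℚ - p)
           (s : ℕ) (8≤D : 8 ℕ.≤ d ℕ.* s) (s≤D : s ℕ.≤ d ℕ.* s) where

    private
      D = d ℕ.* s
      n = 2 ℕ.^ (D ℕ.+ D)
      π = ½ ^ d
      y = 1ℚ - ½ ^ D
      -- There are at most `(4n) ^ s = 2 ^ ((2 + 2D) s)` labellings; the final 2 leaves the factor
      -- `¼`.
      j = (2 ℕ.+ (D ℕ.+ D)) ℕ.* s ℕ.+ 2
    open Expectation p
    open Bounds π (0≤^ d 0≤½) π≤p π≤q

    private
      0≤y : 0ℚ ≤ y
      0≤y = 1-mono (^≤1 D 0≤½ ½≤1)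

      y≤1 : y ≤ 1ℚ
      y≤1 = ≤-trans (1-mono (0≤^ D 0≤½)) (≤-reflexive (+-identityʳ 1ℚ))

      -- Each block of `2 ^ D` candidates halves the failure bound. As `n` is the square of `2 ^ D`,
      -- there is room for `j` blocks and one more, which pays for the at most `s` vertices that are
      -- fixed.
      exponents : 2 ℕ.^ D ℕ.* j ℕ.+ s ℕ.≤ n
      exponents = begin
        2 ℕ.^ D ℕ.* j ℕ.+ s           ≤⟨ ℕ.+-monoʳ-≤ _ (ℕ.≤-trans s≤D (ℕ.<⇒≤ (D<2^D D))) ⟩
        2 ℕ.^ D ℕ.* j ℕ.+ 2 ℕ.^ D     ≡⟨ trans (ℕ.+-comm _ (2 ℕ.^ D)) (sym (ℕ.*-suc (2 ℕ.^ D) j)) ⟩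
        2 ℕ.^ D ℕ.* suc j             ≤⟨ ℕ.*-monoʳ-≤ (2 ℕ.^ D) suc-j≤ ⟩
        2 ℕ.^ D ℕ.* 2 ℕ.^ D           ≡⟨ ℕ.^-distribˡ-+-* 2 D D ⟨
        2 ℕ.^ (D ℕ.+ D)               ∎
        where
        open ℕ.≤-Reasoning
        suc-j≤ : suc j ℕ.≤ 2 ℕ.^ D
        suc-j≤ = ℕ.≤-trans (s≤s (ℕ.+-monoˡ-≤ 2 (ℕ.*-monoʳ-≤ (2 ℕ.+ (D ℕ.+ D)) s≤D)))
          (subst (λ D → suc ((2 ℕ.+ (D ℕ.+ D)) ℕ.* D ℕ.+ 2) ℕ.≤ 2 ℕ.^ D) (ℕ.m+[n∸m]≡n 8≤D) (polynomial≤2^ (D ∸ 8)))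

      E-missed-sparse : ∀ {ℓ : Vec Label n} → Sparse s ℓ → E n (λ G → [ missed ℓ G ]ᵇ) ≤ ½ ^ j
      E-missed-sparse {ℓ} (few , many) = begin
        E n (λ G → [ missed ℓ G ]ᵇ)      ≤⟨ E-missed ℓ ⟩
        (1ℚ - π ^ #fixed ℓ) ^ #free ℓ    ≤⟨ ^-mono (#free ℓ) (0≤1-π^ (#fixed ℓ)) (1-mono (^-anti (0≤^ d 0≤½) π≤1 few)) ⟩
        (1ℚ - π ^ s) ^ #free ℓ           ≡⟨ cong (λ x → (1ℚ - x) ^ #free ℓ) (^-*-assoc ½ d s) ⟩
        y ^ #free ℓ                      ≤⟨ ^-anti 0≤y y≤1 (ℕ.+-cancelˡ-≤ s _ _ (ℕ.≤-trans (ℕ.≤-reflexive (ℕ.+-comm s _)) (ℕ.≤-trans exponents many))) ⟩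
        y ^ (2 ℕ.^ D ℕ.* j)              ≡⟨ ^-*-assoc y (2 ℕ.^ D) j ⟨
        (y ^ (2 ℕ.^ D)) ^ j              ≤⟨ ^-mono j (0≤^ (2 ℕ.^ D) 0≤y) ([1-½^n]^2^n≤½ D) ⟩
        ½ ^ j                            ∎
        where open ≤-Reasoning

    E-#missed : E n (#missed s) ≤ ¼
    E-#missed = begin
      E n (#missed s)                            ≤⟨ E-union n (λ ℓ G → [ missed ℓ G ]ᵇ) (All.map (λ {ℓ} → E-missed-sparse {ℓ}) (specs-sparse n s)) ⟩
      length (specs n s) · (½ ^ j)               ≤⟨ ·-mono (0≤^ j 0≤½) length≤ ⟩
      (2 ℕ.^ ((2 ℕ.+ (D ℕ.+ D)) ℕ.* s)) · (½ ^ j)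
        ≡⟨ cong (2 ℕ.^ a ·_) (^-distribˡ-+ ½ a 2) ⟩
      (2 ℕ.^ a) · (½ ^ a * ½ ^ 2)                ≡⟨ ·-*-assoc (2 ℕ.^ a) (½ ^ a) (½ ^ 2) ⟩
      (2 ℕ.^ a) · (½ ^ a) * ½ ^ 2                ≡⟨ cong (_* ½ ^ 2) (2^n·½^n a) ⟩
      1ℚ * ½ ^ 2                                 ≡⟨⟩
      ¼                                          ∎
      where
      open ≤-Reasoning
      a = (2 ℕ.+ (D ℕ.+ D)) ℕ.* s
      length≤ : length (specs n s) ℕ.≤ 2 ℕ.^ a
      length≤ = ℕ.≤-trans (ℕ.≤-reflexive (length-specs n s))
        (ℕ.≤-trans (ℕ.^-monoˡ-≤ s 1+2n≤4n) (ℕ.≤-reflexive (ℕ.^-*-assoc 2 (2 ℕ.+ (D ℕ.+ D)) s)))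
        where
        1+2n≤4n : 1 ℕ.+ n ℕ.* 2 ℕ.≤ 2 ℕ.* (2 ℕ.* n)
        1+2n≤4n = ℕ.≤-trans (ℕ.+-mono-≤ (ℕ.≤-trans (ℕ.m^n>0 2 (D ℕ.+ D)) (ℕ.m≤m+n n (n ℕ.+ 0))) (ℕ.≤-reflexive (ℕ.*-comm n 2)))
                            (ℕ.+-monoʳ-≤ (2 ℕ.* n) (ℕ.m≤m+n (2 ℕ.* n) 0))

    module _ {A : Graph n → Set} (A? : ∀ G → Dec (A G)) where

      -- The indicator of `A` plus the number of missed labellings is at least 1 for every graph;
      -- the bound follows on averaging.
      likely : (∀ G → Extensible s G → A G) → 1ℚ ≤ E n (λ G → [ does (A? G) ]ᵇ) + ¼
      likely ext⇒A = begin
        1ℚ                               ≡⟨ E-const n 1ℚ ⟨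
        E n (λ _ → 1ℚ)                   ≤⟨ E-mono n pointwise ⟩
        E n (λ G → [ does (A? G) ]ᵇ + #missed s G)     ≡⟨ E-+ n _ _ ⟩
        E n (λ G → [ does (A? G) ]ᵇ) + E n (#missed s) ≤⟨ +-monoʳ-≤ (E n (λ G → [ does (A? G) ]ᵇ)) E-#missed ⟩
        E n (λ G → [ does (A? G) ]ᵇ) + ¼               ∎
        where
        open ≤-Reasoning
        pointwise : ∀ G → 1ℚ ≤ [ does (A? G) ]ᵇ + #missed s G
        pointwise G with extensible⊎missed s G | A? G
        ... | inj₂ 1≤         | a?    = ≤-trans (≤-trans 1≤ (≤-reflexive (sym (+-identityˡ _)))) (+-monoˡ-≤ _ (0≤[]ᵇ (does a?)))
        ... | inj₁ (ext , 0≤) | yes _ = ≤-trans (≤-reflexive (sym (+-identityʳ 1ℚ))) (+-monoʳ-≤ 1ℚ 0≤)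
        ... | inj₁ (ext , 0≤) | no ¬a = ⊥-elim (¬a (ext⇒A G ext))

      unlikely : (∀ G → Extensible s G → ¬ A G) → E n (λ G → [ does (A? G) ]ᵇ) ≤ ¼
      unlikely ext⇒¬A = ≤-trans (E-mono n pointwise) E-#missed
        where
        pointwise : ∀ G → [ does (A? G) ]ᵇ ≤ #missed s G
        pointwise G with extensible⊎missed s G | A? G
        ... | inj₂ 1≤         | yes _ = 1≤
        ... | inj₂ 1≤         | no  _ = ≤-trans (0≤[]ᵇ true) 1≤
        ... | inj₁ (ext , 0≤) | yes a = ⊥-elim (ext⇒¬A G ext a)
        ... | inj₁ (ext , 0≤) | no  _ = 0≤

-- Formulas with every variable in scope

module Formulas where

  open import Data.Bool.Base using (true; if_then_else_)
  open import Data.Empty using (⊥-elim)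
  open import Data.Fin.Base using (Fin; zero; suc)
  import Data.Fin.Properties as Fin
  open import Data.Fin.Subset using (Subset; _∪_; ⁅_⁆) renaming (_∈_ to _∈ₛ_)
  open import Data.Fin.Subset.Properties using (∉⊥; x∈p∪q⁻; x∈p∪q⁺; x∈⁅x⁆; x∈⁅y⁆⇒x≡y)
  open import Data.List.Base using (List; []; _∷_; allFin)
  open import Data.List.Membership.Propositional using (_∈_)
  open import Data.List.Membership.Propositional.Properties using (∈-allFin)
  open import Data.List.Relation.Unary.Any using (here; there)
  open import Data.Nat.Base as ℕ using (ℕ; zero; suc)
  open import Data.Product using (∃; _×_; _,_)
  open import Data.Sum using (_⊎_; inj₁; inj₂)
  open import Data.Vec.Base using (Vec; lookup)
  open import Data.Vec.Properties.WithK using ([]=-irrelevant)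
  open import Function using (_∘_)
  open import Relation.Binary.PropositionalEquality
  open import Relation.Nullary using (¬_; does; yes; no)
  open import Defs using (Graph; adjacent; Formula; _∼′_; _≐′_; X′; ⊥′; ¬′_; _∧′_; _∨′_; _⇒′_; ∀′; ∃′; Assignment; _[_↦_]; Sat; EMSO; ∃X; _⊨_)

  infix  9 _∼_ _≐_
  infix  8 ¬̇_
  infixr 7 _∧̇_
  infixr 6 _∨̇_
  infixr 5 _⇒_

  -- Formulas without scopes: sentences are obtained by binding all k variables in
  -- front, so that every variable is in scope everywhere.
  data Raw (m k : ℕ) : Set where
    _∼_ _≐_         : Fin k → Fin k → Raw m k
    X               : Fin m → Fin k → Raw m k
    ¬̇_              : Raw m k → Raw m k
    _∧̇_ _∨̇_ _⇒_     : Raw m k → Raw m k → Raw m k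
    ∀̇ ∃̇             : Fin k → Raw m k → Raw m k
    ⋀ ⋁             : ∀ {B} → (Fin B → Raw m k) → Raw m k

  _≔_∣_ : ∀ {k n} → Fin k → Fin n → (Fin k → Fin n) → (Fin k → Fin n)
  (x ≔ v ∣ ρ) y = if does (y Fin.≟ x) then v else ρ y

  ⟦_⟧ : ∀ {m k n} → Raw m k → Graph n → Vec (Subset n) m → (Fin k → Fin n) → Set
  ⟦ x ∼ y ⟧ G Xs ρ = adjacent G (ρ x) (ρ y) ≡ true
  ⟦ x ≐ y ⟧ G Xs ρ = ρ x ≡ ρ y
  ⟦ X i x ⟧ G Xs ρ = ρ x ∈ₛ lookup Xs i
  ⟦ ¬̇ φ   ⟧ G Xs ρ = ¬ ⟦ φ ⟧ G Xs ρ
  ⟦ φ ∧̇ ψ ⟧ G Xs ρ = ⟦ φ ⟧ G Xs ρ × ⟦ ψ ⟧ G Xs ρ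
  ⟦ φ ∨̇ ψ ⟧ G Xs ρ = ⟦ φ ⟧ G Xs ρ ⊎ ⟦ ψ ⟧ G Xs ρ
  ⟦ φ ⇒ ψ ⟧ G Xs ρ = ⟦ φ ⟧ G Xs ρ → ⟦ ψ ⟧ G Xs ρ
  ⟦ ∀̇ x φ ⟧ G Xs ρ = ∀ v → ⟦ φ ⟧ G Xs (x ≔ v ∣ ρ)
  ⟦ ∃̇ x φ ⟧ G Xs ρ = ∃ λ v → ⟦ φ ⟧ G Xs (x ≔ v ∣ ρ)
  ⟦ ⋀ φ   ⟧ G Xs ρ = ∀ b → ⟦ φ b ⟧ G Xs ρ
  ⟦ ⋁ φ   ⟧ G Xs ρ = ∃ λ b → ⟦ φ b ⟧ G Xs ρ

  Full : ∀ {k} → Subset k → Set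
  Full S = ∀ x → x ∈ₛ S

  module _ {m k : ℕ} where

    ⋀′ ⋁′ : ∀ {S B} → (Fin B → Formula m k S) → Formula m k S
    ⋀′ {B = zero}  φ = ¬′ ⊥′
    ⋀′ {B = suc B} φ = φ zero ∧′ ⋀′ (φ ∘ suc)
    ⋁′ {B = zero}  φ = ⊥′
    ⋁′ {B = suc B} φ = φ zero ∨′ ⋁′ (φ ∘ suc)

    extend : ∀ {S : Subset k} x → Full S → Full (S ∪ ⁅ x ⁆)
    extend x full y = x∈p∪q⁺ (inj₁ (full y))

    ⌈_⌉ : Raw m k → ∀ {S} → Full S → Formula m k S
    ⌈ x ∼ y ⌉ full = (x , full x) ∼′ (y , full y)
    ⌈ x ≐ y ⌉ full = (x , full x) ≐′ (y , full y)
    ⌈ X i x ⌉ full = X′ i (x , full x)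
    ⌈ ¬̇ φ   ⌉ full = ¬′ ⌈ φ ⌉ full
    ⌈ φ ∧̇ ψ ⌉ full = ⌈ φ ⌉ full ∧′ ⌈ ψ ⌉ full
    ⌈ φ ∨̇ ψ ⌉ full = ⌈ φ ⌉ full ∨′ ⌈ ψ ⌉ full
    ⌈ φ ⇒ ψ ⌉ full = ⌈ φ ⌉ full ⇒′ ⌈ ψ ⌉ full
    ⌈ ∀̇ x φ ⌉ full = ∀′ x (⌈ φ ⌉ (extend x full))
    ⌈ ∃̇ x φ ⌉ full = ∃′ x (⌈ φ ⌉ (extend x full))
    ⌈ ⋀ φ   ⌉ full = ⋀′ λ b → ⌈ φ b ⌉ full
    ⌈ ⋁ φ   ⌉ full = ⋁′ λ b → ⌈ φ b ⌉ full

    Covered : List (Fin k) → Subset k → Set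
    Covered xs S = ∀ x → x ∈ xs ⊎ x ∈ₛ S

    bind : ∀ {x xs S} → Covered (x ∷ xs) S → Covered xs (S ∪ ⁅ x ⁆)
    bind {x} cov y with cov y
    ... | inj₁ (here refl)  = inj₂ (x∈p∪q⁺ (inj₂ (x∈⁅x⁆ x)))
    ... | inj₁ (there y∈xs) = inj₁ y∈xs
    ... | inj₂ y∈S          = inj₂ (x∈p∪q⁺ (inj₁ y∈S))

    covered⇒full : ∀ {S} → Covered [] S → Full S
    covered⇒full cov x with cov x
    ... | inj₂ x∈S = x∈S

    ∃′s : ∀ xs {S} → Covered xs S → Raw m k → Formula m k S
    ∃′s []       cov φ = ⌈ φ ⌉ (covered⇒full cov)
    ∃′s (x ∷ xs) cov φ = ∃′ x (∃′s xs (bind cov) φ)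

    -- The quantifiers in front cost no variable: they use the same k. For `φ₁` they only supply
    -- initial values, as `tower` requantifies its variables before use; for `φ₂` they also choose
    -- the vertices c.
    sentence : Raw m k → EMSO m k
    sentence φ = ∃X (∃′s (allFin k) (inj₁ ∘ ∈-allFin) φ)

    module _ {n : ℕ} (G : Graph n) (Xs : Vec (Subset n) m) where

      Agree : ∀ {S : Subset k} → Assignment S n → (Fin k → Fin n) → Set
      Agree {S} σ ρ = ∀ y (y∈S : y ∈ₛ S) → σ (y , y∈S) ≡ ρ y

      agree-bind : ∀ {S : Subset k} {σ : Assignment S n} {ρ} → Agree σ ρ →
                   ∀ x v → Agree (σ [ x ↦ v ]) (x ≔ v ∣ ρ)
      agree-bind {S} agr x v y y∈ with y Fin.≟ x
      ... | yes _ = refl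
      ... | no y≢x with x∈p∪q⁻ S ⁅ x ⁆ y∈
      ...   | inj₁ y∈S   = agr y y∈S
      ...   | inj₂ y∈⁅x⁆ = ⊥-elim (y≢x (x∈⁅y⁆⇒x≡y x y∈⁅x⁆))

      ⋀′⁻ : ∀ {S B} {σ : Assignment S n} (φ : Fin B → Formula m k S) → Sat G Xs (⋀′ φ) σ → ∀ b → Sat G Xs (φ b) σ
      ⋀′⁻ φ (s , _) zero    = s
      ⋀′⁻ φ (_ , s) (suc b) = ⋀′⁻ (φ ∘ suc) s b

      ⋀′⁺ : ∀ {S B} {σ : Assignment S n} (φ : Fin B → Formula m k S) → (∀ b → Sat G Xs (φ b) σ) → Sat G Xs (⋀′ φ) σ
      ⋀′⁺ {B = zero}  φ s = λ ()
      ⋀′⁺ {B = suc B} φ s = s zero , ⋀′⁺ (φ ∘ suc) (s ∘ suc)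

      ⋁′⁻ : ∀ {S B} {σ : Assignment S n} (φ : Fin B → Formula m k S) → Sat G Xs (⋁′ φ) σ → ∃ λ b → Sat G Xs (φ b) σ
      ⋁′⁻ {B = suc B} φ (inj₁ s) = zero , s
      ⋁′⁻ {B = suc B} φ (inj₂ s) with ⋁′⁻ (φ ∘ suc) s
      ... | b , s′ = suc b , s′

      ⋁′⁺ : ∀ {S B} {σ : Assignment S n} (φ : Fin B → Formula m k S) → ∀ b → Sat G Xs (φ b) σ → Sat G Xs (⋁′ φ) σ
      ⋁′⁺ φ zero    s = inj₁ s
      ⋁′⁺ φ (suc b) s = inj₂ (⋁′⁺ (φ ∘ suc) b s)

      -- Proved together with the converse, since negations and premises of implications reverse the
      -- direction.
      ⌈⌉-sound    : ∀ φ {S} (full : Full S) {σ ρ} → Agree σ ρ → Sat G Xs (⌈ φ ⌉ full) σ → ⟦ φ ⟧ G Xs ρ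
      ⌈⌉-complete : ∀ φ {S} (full : Full S) {σ ρ} → Agree σ ρ → ⟦ φ ⟧ G Xs ρ → Sat G Xs (⌈ φ ⌉ full) σ

      ⌈⌉-sound (x ∼ y) full agr s = trans (cong₂ (adjacent G) (sym (agr x _)) (sym (agr y _))) s
      ⌈⌉-sound (x ≐ y) full agr s = trans (sym (agr x _)) (trans s (agr y _))
      ⌈⌉-sound (X i x) full agr s = subst (_∈ₛ lookup Xs i) (agr x _) s
      ⌈⌉-sound (¬̇ φ)   full agr s = s ∘ ⌈⌉-complete φ full agr
      ⌈⌉-sound (φ ∧̇ ψ) full agr (s , t) = ⌈⌉-sound φ full agr s , ⌈⌉-sound ψ full agr t
      ⌈⌉-sound (φ ∨̇ ψ) full agr (inj₁ s) = inj₁ (⌈⌉-sound φ full agr s)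
      ⌈⌉-sound (φ ∨̇ ψ) full agr (inj₂ s) = inj₂ (⌈⌉-sound ψ full agr s)
      ⌈⌉-sound (φ ⇒ ψ) full agr s = ⌈⌉-sound ψ full agr ∘ s ∘ ⌈⌉-complete φ full agr
      ⌈⌉-sound (∀̇ x φ) full agr s v = ⌈⌉-sound φ (extend x full) (agree-bind agr x v) (s v)
      ⌈⌉-sound (∃̇ x φ) full agr (v , s) = v , ⌈⌉-sound φ (extend x full) (agree-bind agr x v) s
      ⌈⌉-sound (⋀ φ)   full agr s b = ⌈⌉-sound (φ b) full agr (⋀′⁻ _ s b)
      ⌈⌉-sound (⋁ φ)   full agr s with ⋁′⁻ _ s
      ... | b , t = b , ⌈⌉-sound (φ b) full agr t

      ⌈⌉-complete (x ∼ y) full agr s = trans (cong₂ (adjacent G) (agr x _) (agr y _)) s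
      ⌈⌉-complete (x ≐ y) full agr s = trans (agr x _) (trans s (sym (agr y _)))
      ⌈⌉-complete (X i x) full agr s = subst (_∈ₛ lookup Xs i) (sym (agr x _)) s
      ⌈⌉-complete (¬̇ φ)   full agr s = s ∘ ⌈⌉-sound φ full agr
      ⌈⌉-complete (φ ∧̇ ψ) full agr (s , t) = ⌈⌉-complete φ full agr s , ⌈⌉-complete ψ full agr t
      ⌈⌉-complete (φ ∨̇ ψ) full agr (inj₁ s) = inj₁ (⌈⌉-complete φ full agr s)
      ⌈⌉-complete (φ ∨̇ ψ) full agr (inj₂ s) = inj₂ (⌈⌉-complete ψ full agr s)
      ⌈⌉-complete (φ ⇒ ψ) full agr s = ⌈⌉-complete ψ full agr ∘ s ∘ ⌈⌉-sound φ full agr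
      ⌈⌉-complete (∀̇ x φ) full agr s v = ⌈⌉-complete φ (extend x full) (agree-bind agr x v) (s v)
      ⌈⌉-complete (∃̇ x φ) full agr (v , s) = v , ⌈⌉-complete φ (extend x full) (agree-bind agr x v) s
      ⌈⌉-complete (⋀ φ)   full agr s = ⋀′⁺ _ λ b → ⌈⌉-complete (φ b) full agr (s b)
      ⌈⌉-complete (⋁ φ)   full agr (b , s) = ⋁′⁺ _ b (⌈⌉-complete (φ b) full agr s)

      ∃′s-sound : ∀ xs {S} (cov : Covered xs S) φ {σ} → Sat G Xs (∃′s xs cov φ) σ → ∃ λ ρ → ⟦ φ ⟧ G Xs ρ
      ∃′s-sound []       cov φ {σ} s = (λ x → σ (x , covered⇒full cov x)) ,
        -- An assignment also receives a proof that its variable is in scope; such proofs are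
        -- unique, so it amounts to an environment.
        ⌈⌉-sound φ _ (λ y y∈ → cong (λ z → σ (y , z)) ([]=-irrelevant y∈ _)) s
      ∃′s-sound (x ∷ xs) cov φ (v , s) = ∃′s-sound xs (bind cov) φ s

      ∃′s-complete : ∀ xs {S} (cov : Covered xs S) φ {σ ρ} → Agree σ ρ → ⟦ φ ⟧ G Xs ρ → Sat G Xs (∃′s xs cov φ) σ
      ∃′s-complete []       cov φ agr s = ⌈⌉-complete φ _ agr s
      ∃′s-complete (x ∷ xs) cov φ {σ} {ρ} agr s = ρ x , ∃′s-complete xs (bind cov) φ agr′ s
        where
        agr′ : Agree (σ [ x ↦ ρ x ]) ρ
        agr′ y y∈ with agree-bind agr x (ρ x) y y∈
        ... | eq with y Fin.≟ x
        ...   | yes refl = eq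
        ...   | no  _    = eq

    sentence-sound : ∀ {n} (G : Graph n) φ → G ⊨ sentence φ → ∃ λ Xs → ∃ λ ρ → ⟦ φ ⟧ G Xs ρ
    sentence-sound G φ (Xs , s) = Xs , ∃′s-sound G Xs (allFin k) (inj₁ ∘ ∈-allFin) φ s

    sentence-complete : ∀ {n} (G : Graph n) φ Xs ρ → ⟦ φ ⟧ G Xs ρ → G ⊨ sentence φ
    sentence-complete G φ Xs ρ s =
      Xs , ∃′s-complete G Xs (allFin k) (inj₁ ∘ ∈-allFin) φ (λ y y∈∅ → ⊥-elim (∉⊥ y∈∅)) s

-- The tower sentence

module TowerSentence where

  open import Data.Bool.Base using (true)
  open import Data.Fin.Base using (Fin; suc)
  open import Data.Fin.Patterns using (0F; 1F; 2F; 3F)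
  open import Data.Nat.Base as ℕ using (ℕ; suc)
  open import Data.Product using (∃; _×_)
  open import Data.Sum using (_⊎_)
  open import Relation.Binary.PropositionalEquality
  open import Relation.Nullary using (¬_)
  open import Defs using (Graph; adjacent)
  open Formulas

  -- Roles 0, 1, 2 are the levels of the tower, role 3 is the side of the half
  -- graph that orders them, and role w# b is the b-th dominating set.
  w# : ∀ {B} → Fin B → Fin (4 ℕ.+ B)
  w# b = suc (suc (suc (suc b)))

  module Syntax {M c B : ℕ} (P : Fin (4 ℕ.+ B) → Fin (3 ℕ.+ c) → Raw M (3 ℕ.+ c)) where

    x y z : Fin (3 ℕ.+ c)
    x = 0F
    y = 1F
    z = 2F

    all : Fin (3 ℕ.+ c) → Raw M (3 ℕ.+ c)
    all u = u ≐ u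

    -- The order read off a half graph. The bound variable is a parameter so that whichever of the
    -- three variables is not being compared can be overwritten.
    lt : (bound u v : Fin (3 ℕ.+ c)) → Raw M (3 ℕ.+ c)
    lt w u v = ∃̇ w (P 3F w ∧̇ w ∼ u ∧̇ ¬̇ w ∼ v)

    module _ (A : Fin (3 ℕ.+ c) → Raw M (3 ℕ.+ c)) where

      -- Transitivity is not demanded; for this kind of order it follows from asymmetry, see
      -- `≺-trans`.
      ordered : Raw M (3 ℕ.+ c)
      ordered = ∀̇ x (∀̇ y (A x ⇒ A y ⇒
        (x ≐ y ∨̇ lt z x y ∨̇ lt z y x) ∧̇ ¬̇ (lt z x y ∧̇ lt z y x)))

      -- True when adding 1 to the neighbourhood of `x` flips the digit at `z`. The quantifier
      -- overwrites `y`, which holds the successor in `shattered`, and `lt` overwrites `x` only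
      -- within itself, so the last `x` is the outer one. This is how three variables suffice.
      carry : Raw M (3 ℕ.+ c)
      carry = ∀̇ y (A y ⇒ lt x y z ⇒ y ∼ x)

      module _ (Y : Fin (3 ℕ.+ c) → Raw M (3 ℕ.+ c)) where

        -- Addition is modulo `2 ^ |A|`, so the increments run through a single cycle of all
        -- subsets, and one starting vertex is enough to reach them all.
        shattered : Raw M (3 ℕ.+ c)
        shattered = ∃̇ x (Y x) ∧̇ ∀̇ x (Y x ⇒ ∃̇ y (Y y ∧̇ ∀̇ z (A z ⇒
          (carry ⇒ (z ∼ y ⇒ ¬̇ z ∼ x) ∧̇ (¬̇ z ∼ x ⇒ z ∼ y)) ∧̇
          (¬̇ carry ⇒ (z ∼ y ⇒ z ∼ x) ∧̇ (z ∼ x ⇒ z ∼ y)))))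

        separated : Raw M (3 ℕ.+ c)
        separated = ∀̇ x (∀̇ y (Y x ⇒ Y y ⇒
          ∀̇ z (A z ⇒ (z ∼ x ⇒ z ∼ y) ∧̇ (z ∼ y ⇒ z ∼ x)) ⇒ x ≐ y))

    -- The injection is encoded by adjacency: every vertex of the set has a neighbour in the top
    -- level, and no vertex there serves two of them.
    injected : Fin B → Raw M (3 ℕ.+ c)
    injected b =
      ∀̇ x (P (w# b) x ⇒ ∃̇ y (P 2F y ∧̇ x ∼ y)) ∧̇
      ∀̇ x (∀̇ y (∀̇ z (P (w# b) x ⇒ P (w# b) y ⇒ P 2F z ⇒ x ∼ z ⇒ y ∼ z ⇒ x ≐ y)))

    undominated : Raw M (3 ℕ.+ c)
    undominated = ∀̇ x (∃̇ y (⋁ (λ b → P (w# b) y) ∧̇ ¬̇ y ∼ x))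

    tower : Raw M (3 ℕ.+ c)
    tower = ordered (P 0F) ∧̇ ordered (P 1F) ∧̇ ordered (P 2F)
          ∧̇ shattered (P 0F) (P 1F) ∧̇ separated (P 0F) (P 1F)
          ∧̇ shattered (P 1F) (P 2F) ∧̇ separated (P 1F) (P 2F)
          ∧̇ shattered (P 2F) all
          ∧̇ ⋀ injected ∧̇ undominated

  -- Spelled so that ⟦ Syntax.tower P ⟧ reduces to Tower G R whenever ⟦ P j v ⟧
  -- reduces to R j applied to the value of v.
  module Semantics {n B : ℕ} (G : Graph n) (R : Fin (4 ℕ.+ B) → Fin n → Set) where

    infix 4 _~_ _≺_
    _~_ : Fin n → Fin n → Set
    u ~ v = adjacent G u v ≡ true

    All : Fin n → Set
    All v = v ≡ v

    _≺_ : Fin n → Fin n → Set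
    u ≺ v = ∃ λ w → R 3F w × w ~ u × ¬ w ~ v

    module _ (A : Fin n → Set) where

      Ordered : Set
      Ordered = ∀ u v → A u → A v → (u ≡ v ⊎ u ≺ v ⊎ v ≺ u) × ¬ (u ≺ v × v ≺ u)

      Carry : Fin n → Fin n → Set
      Carry v z = ∀ u → A u → u ≺ z → u ~ v

      Next : Fin n → Fin n → Set
      Next v v′ = ∀ z → A z →
        (Carry v z → (z ~ v′ → ¬ z ~ v) × (¬ z ~ v → z ~ v′)) ×
        (¬ Carry v z → (z ~ v′ → z ~ v) × (z ~ v → z ~ v′))

      module _ (Y : Fin n → Set) where

        Shattered : Set
        Shattered = ∃ Y × (∀ v → Y v → ∃ λ v′ → Y v′ × Next v v′)

        Separated : Set
        Separated = ∀ u v → Y u → Y v → (∀ z → A z → (z ~ u → z ~ v) × (z ~ v → z ~ u)) → u ≡ v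

    Injected : Fin B → Set
    Injected b = (∀ w → R (w# b) w → ∃ λ u → R 2F u × w ~ u) ×
      (∀ w w′ u → R (w# b) w → R (w# b) w′ → R 2F u → w ~ u → w′ ~ u → w ≡ w′)

    Undominated : Set
    Undominated = ∀ v → ∃ λ w → (∃ λ b → R (w# b) w) × ¬ w ~ v

    Tower : Set
    Tower = Ordered (R 0F) × Ordered (R 1F) × Ordered (R 2F)
          × Shattered (R 0F) (R 1F) × Separated (R 0F) (R 1F)
          × Shattered (R 1F) (R 2F) × Separated (R 1F) (R 2F)
          × Shattered (R 2F) All
          × (∀ b → Injected b) × Undominated

  open Semantics using (Tower) public

  module _ {B : ℕ} where
    φ₁ : Raw (4 ℕ.+ B) 3
    φ₁ = Syntax.tower {c = 0} {B} X


    -- The variables after the first three are not requantified inside `tower`, so each names one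
    -- vertex c throughout.
    φ₂ : Raw 1 (3 ℕ.+ (4 ℕ.+ B))
    φ₂ = Syntax.tower {c = 4 ℕ.+ B} {B} λ j v → X 0F v ∧̇ suc (suc (suc j)) ∼ v

-- What a tower implies in an extensible graph

module TowerSize where

  open import Data.Bool.Base using (Bool; true; false)
  import Data.Bool.Properties as Bool
  open import Data.Empty using (⊥-elim)
  open import Data.Fin.Base using (Fin; zero; suc)
  open import Data.Fin.Patterns using (0F; 1F; 2F)
  open import Data.List.Base using (List; []; _∷_; _++_; map; length; filter; allFin; concatMap)
  open import Data.List.Properties using (length-++; length-map; length-tabulate)
  open import Data.List.Membership.Propositional using (_∈_; lose)
  open import Data.List.Membership.Propositional.Properties
  open import Data.List.Relation.Unary.Any using (here; there)
  open import Data.List.Relation.Unary.All as All using (All; []; _∷_)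
  open import Data.List.Relation.Unary.AllPairs as AllPairs using (AllPairs; []; _∷_)
  open import Data.List.Relation.Unary.Unique.Propositional using (Unique)
  import Data.List.Relation.Unary.Unique.Propositional.Properties as Unique
  open import Data.Nat.Base as ℕ using (ℕ; zero; suc; s≤s; z≤n)
  import Data.Nat.Properties as ℕ
  open import Data.Product using (∃; _×_; _,_; proj₁; proj₂)
  open import Data.Sum using (_⊎_; inj₁; inj₂; [_,_]′)
  open import Data.Vec.Base using (Vec; []; _∷_; lookup)
  open import Data.Vec.Properties using (∷-injective)
  open import Function using (_∘_; id)
  open import Relation.Binary.PropositionalEquality hiding ([_])
  open import Relation.Nullary using (¬_; yes; no)
  open import Relation.Unary using (Decidable)
  open import Defs using (Graph; []; _∷_; adjacent; allBits)
  open Formulas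
  open TowerSentence
  open Extensibility using (Extensible; length-cartesianProductWith; ∈-bools)

  -- For a relation, since images arrive as existential witnesses. Injectivity allows the image of
  -- the head to be deleted from `ys` before the induction continues.
  pigeonhole : ∀ {A B : Set} (_↝_ : A → B → Set) → (∀ {x x′ y} → x ↝ y → x′ ↝ y → x ≡ x′) →
    ∀ {xs ys} → Unique xs → (∀ {x} → x ∈ xs → ∃ λ y → y ∈ ys × x ↝ y) → length xs ℕ.≤ length ys
  pigeonhole _↝_ inj []               f = z≤n
  pigeonhole _↝_ inj {x ∷ xs} (x∉ ∷ uniq) f with f (here refl)
  ... | y , y∈ , x↝y with ∈-∃++ y∈
  ... | ys₁ , ys₂ , refl = begin
    suc (length xs)                  ≤⟨ s≤s (pigeonhole _↝_ inj uniq g) ⟩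
    suc (length (ys₁ ++ ys₂))        ≡⟨ cong suc (length-++ ys₁) ⟩
    suc (length ys₁ ℕ.+ length ys₂)  ≡⟨ ℕ.+-suc (length ys₁) (length ys₂) ⟨
    length ys₁ ℕ.+ length (y ∷ ys₂)  ≡⟨ length-++ ys₁ ⟨
    length (ys₁ ++ y ∷ ys₂)          ∎
    where
    open ℕ.≤-Reasoning
    g : ∀ {x′} → x′ ∈ xs → ∃ λ y′ → y′ ∈ ys₁ ++ ys₂ × x′ ↝ y′
    g x′∈ with f (there x′∈)
    ... | y′ , y′∈ , x′↝y′ with ∈-++⁻ ys₁ y′∈
    ...   | inj₁ ∈₁           = y′ , ∈-++⁺ˡ ∈₁ , x′↝y′
    ...   | inj₂ (there ∈₂)   = y′ , ∈-++⁺ʳ ys₁ ∈₂ , x′↝y′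
    ...   | inj₂ (here refl)  = ⊥-elim (All.lookup x∉ x′∈ (inj x↝y x′↝y′))

  length-allBits : ∀ k → length (allBits k) ≡ 2 ℕ.^ k
  length-allBits zero    = refl
  length-allBits (suc k) = trans (length-cartesianProductWith _∷_ (true ∷ false ∷ []) (allBits k))
                                 (cong (2 ℕ.*_) (length-allBits k))

  allBits-unique : ∀ k → Unique (allBits k)
  allBits-unique zero    = [] ∷ []
  allBits-unique (suc k) =
    Unique.cartesianProductWith⁺ _∷_ ∷-injective (((λ ()) ∷ []) ∷ [] ∷ []) (allBits-unique k)

  ∈-allBits : ∀ {k} (bs : Vec Bool k) → bs ∈ allBits k
  ∈-allBits []       = here refl
  ∈-allBits (b ∷ bs) = ∈-cartesianProductWith⁺ _∷_ (∈-bools b) (∈-allBits bs)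

  inc : ∀ {k} → Vec Bool k → Vec Bool k
  inc []           = []
  inc (false ∷ bs) = true ∷ bs
  inc (true ∷ bs)  = false ∷ inc bs

  -- Two increments of a number with lowest bit 0 increment its higher bits, so the induction
  -- hypothesis reaches all even numbers; an odd start becomes even after one step, and odd targets
  -- lie one step further.
  inc-reaches-all : ∀ {k} (P : Vec Bool k → Set) → (∀ bs → P bs → P (inc bs)) →
                    ∀ bs → P bs → ∀ cs → P cs
  inc-reaches-all P closed []           p []       = p
  inc-reaches-all P closed (b ∷ bs)     p (c ∷ cs) = finish c
    where
    even : ∀ b bs → P (b ∷ bs) → ∃ λ ds → P (false ∷ ds)
    even false bs p = bs , p
    even true  bs p = inc bs , closed _ p
    evens : P (false ∷ cs)
    evens with even b bs p
    ... | ds , q = inc-reaches-all (λ ds → P (false ∷ ds)) (λ ds q → closed _ (closed _ q)) ds q cs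
    finish : ∀ c → P (c ∷ cs)
    finish false = evens
    finish true  = closed _ evens

  ≡true-ext : ∀ a b → (a ≡ true → b ≡ true) → (b ≡ true → a ≡ true) → a ≡ b
  ≡true-ext true  b     f g = sym (f refl)
  ≡true-ext false true  f g = g refl
  ≡true-ext false false f g = refl

  absurd : ∀ {A : Set} → false ≡ true → A
  absurd ()

  ≢true : ∀ {a} → a ≢ true → a ≡ false
  ≢true {true}  n = ⊥-elim (n refl)
  ≢true {false} n = refl

  length-concatMap-≤ : ∀ {A C : Set} (f : A → List C) {k} → (∀ a → length (f a) ℕ.≤ k) →
                       ∀ as → length (concatMap f as) ℕ.≤ length as ℕ.* k
  length-concatMap-≤ f ≤k []       = z≤n
  length-concatMap-≤ f ≤k (a ∷ as) =
    ℕ.≤-trans (ℕ.≤-reflexive (length-++ (f a))) (ℕ.+-mono-≤ (≤k a) (length-concatMap-≤ f ≤k as))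

  module Sizes {n B : ℕ} (G : Graph n) (R : Fin (4 ℕ.+ B) → Fin n → Set) where
    open Semantics G R hiding (All; Tower)

    ≺-irrefl : ∀ {u} → ¬ u ≺ u
    ≺-irrefl (w , _ , w~u , w≁u) = w≁u w~u

    Sorted : List (Fin n) → Set
    Sorted = AllPairs _≺_

    sorted⇒unique : ∀ {zs} → Sorted zs → Unique zs
    sorted⇒unique = AllPairs.map λ where u≺u refl → ≺-irrefl u≺u

    record Enumeration (A : Fin n → Set) : Set where
      field
        list   : List (Fin n)
        sorted : Sorted list
        sound  : ∀ {u} → u ∈ list → A u
        complete : ∀ {u} → A u → u ∈ list
    open Enumeration public

    code : (zs : List (Fin n)) → Fin n → Vec Bool (length zs)
    code []       v = []
    code (z ∷ zs) v = adjacent G z v ∷ code zs v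

    code-≡ : ∀ {zs u v} → code zs u ≡ code zs v → ∀ {z} → z ∈ zs → adjacent G z u ≡ adjacent G z v
    code-≡ {z ∷ zs} eq (here refl) = proj₁ (∷-injective eq)
    code-≡ {z ∷ zs} eq (there z∈)  = code-≡ (proj₂ (∷-injective eq)) z∈

    module _ {A : Fin n → Set} (A? : Decidable A) (ord : Ordered A) where

      ≺-asym : ∀ {u v} → A u → A v → u ≺ v → ¬ v ≺ u
      ≺-asym {u} {v} au av u≺v v≺u = proj₂ (ord u v au av) (u≺v , v≺u)

      -- The vertex separating `u` from `v` also separates `u` from `w`: otherwise it would witness
      -- `w ≺ v`.
      ≺-trans : ∀ {u v w} → A v → A w → u ≺ v → v ≺ w → u ≺ w
      ≺-trans av aw (c , rc , c~u , c≁v) v≺w =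
        c , rc , c~u , λ c~w → ≺-asym av aw v≺w (c , rc , c~w , c≁v)

      -- Comparisons are taken from the totality clause of `ord`, so `≺` is never decided.
      insert : ∀ {x} zs → A x → Sorted zs → All A zs →
        ∃ λ ws → Sorted ws × (∀ {y} → y ∈ ws → y ≡ x ⊎ y ∈ zs) × x ∈ ws × (∀ {y} → y ∈ zs → y ∈ ws)
      insert {x} [] ax [] [] = x ∷ [] , [] ∷ [] , (λ where (here e) → inj₁ e) , here refl , λ ()
      insert {x} (z ∷ zs) ax (z≺ ∷ srt) (az ∷ azs) with proj₁ (ord x z ax az)
      ... | inj₁ refl = z ∷ zs , z≺ ∷ srt , inj₂ , here refl , id
      ... | inj₂ (inj₁ x≺z) = x ∷ z ∷ zs
          , (x≺z ∷ All.zipWith (λ (z≺y , ay) → ≺-trans az ay x≺z z≺y) (z≺ , azs)) ∷ z≺ ∷ srt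
          , (λ where (here e) → inj₁ e ; (there y∈) → inj₂ y∈) , here refl , there
      ... | inj₂ (inj₂ z≺x) with insert zs ax srt azs
      ...   | ws , srt′ , from , x∈ , to = z ∷ ws
          , All.tabulate (λ y∈ → [ (λ where refl → z≺x) , All.lookup z≺ ]′ (from y∈)) ∷ srt′
          , (λ where (here e)   → inj₂ (here e)
                     (there y∈) → [ inj₁ , inj₂ ∘ there ]′ (from y∈))
          , there x∈
          , (λ where (here e) → here e ; (there y∈) → there (to y∈))

      enumerate : Enumeration A
      enumerate with go (allFin n)
        where
        go : ∀ xs → ∃ λ ws → Sorted ws × (∀ {y} → y ∈ ws → A y) × (∀ {y} → y ∈ xs → A y → y ∈ ws)
        go [] = [] , [] , (λ ()) , λ ()
        go (x ∷ xs) with A? x | go xs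
        ... | no ¬ax | ws , srt , snd , cmp =
          ws , srt , snd , λ where (here refl) ay → ⊥-elim (¬ax ay) ; (there y∈) ay → cmp y∈ ay
        ... | yes ax | ws , srt , snd , cmp with insert ws ax srt (All.tabulate snd)
        ...   | ws′ , srt′ , from , x∈ , to =
          ws′ , srt′ , (λ y∈ → [ (λ where refl → ax) , snd ]′ (from y∈))
          , λ where (here refl) ay → x∈ ; (there y∈) ay → to (cmp y∈ ay)
      ... | ws , srt , snd , cmp = record
        { list = ws ; sorted = srt ; sound = snd ; complete = λ {u} → cmp (∈-allFin u) }

      -- The last premise is the invariant of `code-Next`: every element of the level is still to be
      -- processed or already known to be adjacent to `v`.
      lowest-carries : ∀ {z zs v} → All (z ≺_) zs → A z → (∀ {u} → A u → u ∈ z ∷ zs ⊎ u ~ v) → Carry A v z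
      lowest-carries z≺ az low u au u≺z with low au
      ... | inj₂ u~v          = u~v
      ... | inj₁ (here refl)  = ⊥-elim (≺-irrefl u≺z)
      ... | inj₁ (there u∈zs) = ⊥-elim (≺-asym au az u≺z (All.lookup z≺ u∈zs))

      -- Positions are read from the lowest upwards. While they are 1 the carry persists and turns
      -- them to 0; the first 0 becomes 1 and blocks the carry at all later positions, which are
      -- copied.
      code-Next : ∀ {zs v v′} → Sorted zs → All A zs → (∀ {u} → A u → u ∈ zs ⊎ u ~ v) → Next A v v′ →
                  code zs v′ ≡ inc (code zs v)
      code-Next [] [] low next = refl
      code-Next {z ∷ zs} {v} {v′} (z≺ ∷ srt) (az ∷ azs) low next with adjacent G z v in z~v
      ... | true  = cong₂ _∷_ (≢true λ z~v′ → proj₁ (proj₁ (next z az) (lowest-carries z≺ az low)) z~v′ z~v)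
                              (code-Next srt azs low′ next)
        where
        low′ : ∀ {u} → A u → u ∈ zs ⊎ u ~ v
        low′ au with low au
        ... | inj₂ u~v          = inj₂ u~v
        ... | inj₁ (here refl)  = inj₂ z~v
        ... | inj₁ (there u∈zs) = inj₁ u∈zs
      ... | false = cong₂ _∷_ (proj₂ (proj₁ (next z az) (lowest-carries z≺ az low)) (absurd ∘ trans (sym z~v)))
                              (unchanged zs z≺ azs)
        where
        unchanged : ∀ ws → All (z ≺_) ws → All A ws → code ws v′ ≡ code ws v
        unchanged []       []         []         = refl
        unchanged (w ∷ ws) (z≺w ∷ z≺) (aw ∷ aws) =
          cong₂ _∷_ (≡true-ext _ _ (proj₁ same) (proj₂ same)) (unchanged ws z≺ aws)
          where
          same : (w ~ v′ → w ~ v) × (w ~ v → w ~ v′)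
          same = proj₂ (next w aw) λ carry → absurd (trans (sym z~v) (carry z az z≺w))

      module _ {Y : Fin n → Set} (e : Enumeration A) where

        shattered⇒all-codes : Shattered A Y → ∀ bs → ∃ λ v → Y v × code (list e) v ≡ bs
        shattered⇒all-codes ((v₀ , y₀) , next) =
          inc-reaches-all (λ bs → ∃ λ v → Y v × code (list e) v ≡ bs) closed _ (v₀ , y₀ , refl)
          where
          closed : ∀ bs → (∃ λ v → Y v × code (list e) v ≡ bs) → ∃ λ v → Y v × code (list e) v ≡ inc bs
          closed bs (v , yv , refl) with next v yv
          ... | v′ , yv′ , nxt =
            v′ , yv′ , code-Next (sorted e) (All.tabulate (sound e)) (inj₁ ∘ complete e) nxt

        shattered⇒≥ : Shattered A Y → ∀ {ys} → (∀ {v} → Y v → v ∈ ys) → 2 ℕ.^ length (list e) ℕ.≤ length ys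
        shattered⇒≥ sh ∈ys = ℕ.≤-trans (ℕ.≤-reflexive (sym (length-allBits (length (list e)))))
          (pigeonhole (λ bs v → code (list e) v ≡ bs) (λ p q → trans (sym p) q) (allBits-unique (length (list e)))
            λ {bs} _ → let v , yv , eq = shattered⇒all-codes sh bs in v , ∈ys yv , eq)

        separated⇒≤ : Separated A Y → ∀ {ys} → Unique ys → (∀ {v} → v ∈ ys → Y v) → length ys ℕ.≤ 2 ℕ.^ length (list e)
        separated⇒≤ sep {ys} uniq ∈Y = ℕ.≤-trans
          (pigeonhole (λ v bs → Y v × code (list e) v ≡ bs) inj uniq λ {v} v∈ → code (list e) v , ∈-allBits _ , ∈Y v∈ , refl)
          (ℕ.≤-reflexive (length-allBits (length (list e))))
          where
          inj : ∀ {u v bs} → Y u × code (list e) u ≡ bs → Y v × code (list e) v ≡ bs → u ≡ v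
          inj (yu , eq) (yv , eq′) = sep _ _ yu yv λ z az →
            let same = code-≡ {list e} (trans eq (sym eq′)) (complete e az) in trans (sym same) , trans same

    tower-size : (∀ j → Decidable (R j)) → ∀ {s} → Extensible s G → Tower G R →
      ∃ λ i → let K = 2 ℕ.^ (2 ℕ.^ i) in 2 ℕ.^ K ℕ.≤ n × ¬ B ℕ.* K ℕ.≤ s
    tower-size R? ext (ord₀ , ord₁ , ord₂ , sh₀₁ , sep₀₁ , sh₁₂ , sep₁₂ , sh₂ , injd , undom) =
      -- The exponent `i` is the size of the lowest level.
      length (list e₀) , subst (λ K → 2 ℕ.^ K ℕ.≤ n) size₂ top , dominated ∘ subst (λ K → B ℕ.* K ℕ.≤ _) (sym size₂)
      where
      e₀ = enumerate (R? 0F) ord₀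
      e₁ = enumerate (R? 1F) ord₁
      e₂ = enumerate (R? 2F) ord₂
      size₁ : length (list e₁) ≡ 2 ℕ.^ length (list e₀)
      size₁ = ℕ.≤-antisym (separated⇒≤ (R? 0F) ord₀ e₀ sep₀₁ (sorted⇒unique (sorted e₁)) (sound e₁))
                          (shattered⇒≥ (R? 0F) ord₀ e₀ sh₀₁ (complete e₁))
      size₂ : length (list e₂) ≡ 2 ℕ.^ (2 ℕ.^ length (list e₀))
      size₂ = trans (ℕ.≤-antisym (separated⇒≤ (R? 1F) ord₁ e₁ sep₁₂ (sorted⇒unique (sorted e₂)) (sound e₂))
                                 (shattered⇒≥ (R? 1F) ord₁ e₁ sh₁₂ (complete e₂)))
                    (cong (2 ℕ.^_) size₁)
      top : 2 ℕ.^ length (list e₂) ℕ.≤ n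
      top = ℕ.≤-trans (shattered⇒≥ (R? 2F) ord₂ e₂ sh₂ {allFin n} (λ {v} _ → ∈-allFin v))
                      (ℕ.≤-reflexive (length-tabulate {n = n} id))
      ws : Fin B → List (Fin n)
      ws b = filter (R? (w# b)) (allFin n)
      ws≤ : ∀ b → length (ws b) ℕ.≤ length (list e₂)
      ws≤ b = pigeonhole (λ w u → R (w# b) w × R 2F u × w ~ u)
        (λ (rw , ru , w~u) (rw′ , _ , w′~u) → proj₂ (injd b) _ _ _ rw rw′ ru w~u w′~u)
        (Unique.filter⁺ (R? (w# b)) (Unique.allFin⁺ n))
        λ {w} w∈ → let rw = proj₂ (∈-filter⁻ (R? (w# b)) {xs = allFin n} w∈)
                       u , ru , w~u = proj₁ (injd b) w rw
                   in u , complete e₂ ru , rw , ru , w~u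
      W : List (Fin n)
      W = concatMap ws (allFin B)
      W≤ : length W ℕ.≤ B ℕ.* length (list e₂)
      W≤ = ℕ.≤-trans (length-concatMap-≤ ws ws≤ (allFin B))
                     (ℕ.≤-reflexive (cong (ℕ._* length (list e₂)) (length-tabulate {n = B} id)))
      spec : List (Fin n × Bool)
      spec = map (_, true) W
      dominated : ¬ B ℕ.* length (list e₂) ℕ.≤ _
      dominated small with ext spec (ℕ.≤-trans (ℕ.≤-reflexive (length-map (_, true) W)) (ℕ.≤-trans W≤ small))
                               (λ u b c p q → trans (is-true p) (sym (is-true q)))
        where
        is-true : ∀ {u b} → (u , b) ∈ spec → b ≡ true
        is-true u∈ with ∈-map⁻ (_, true) u∈
        ... | _ , _ , refl = refl
      ... | v , adj with undom v
      ...   | w , (b , rw) , w≁v = w≁v (proj₂ (adj w true (∈-map⁺ (_, true)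
                (∈-concatMap⁺ ws (lose (∈-allFin b) (∈-filter⁺ (R? (w# b)) (∈-allFin w) rw))))))

-- Greedy choice of dominating vertices

module Sweeping where

  open import Data.Bool.Base using (Bool; true; false; not; if_then_else_)
  import Data.Bool.Properties as Bool
  open import Data.Empty using (⊥; ⊥-elim)
  open import Data.Fin.Base using (Fin; zero; suc)
  import Data.Fin.Properties as Fin
  open import Data.List.Base using (List; []; _∷_; _++_; map; length; filter; filterᵇ; allFin; tabulate)
  open import Data.Nat.ListAction using (sum)
  open import Data.List.Properties using (length-++; length-map; length-tabulate; length-filter)
  open import Data.List.Membership.Propositional using (_∈_; find)
  open import Data.List.Membership.Propositional.Properties
  open import Data.List.Relation.Unary.Any using (here; there; any?)
  open import Data.List.Relation.Unary.All as All using (All; []; _∷_)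
  import Data.List.Relation.Unary.All.Properties as All
  open import Data.Nat.Base as ℕ using (ℕ; zero; suc; s≤s; z≤n; _≤_; _<_; _+_; _*_; _^_)
  open import Data.Nat.Properties
  open import Data.Nat.Tactic.RingSolver using (solve-∀)
  open import Algebra.Properties.CommutativeSemigroup +-commutativeSemigroup using (interchange)
  open import Data.Product using (∃; ∃₂; _×_; _,_; proj₁; proj₂)
  open import Data.Sum using (_⊎_; inj₁; inj₂)
  open import Function using (_∘_; id)
  open import Relation.Binary.PropositionalEquality hiding ([_])
  open import Relation.Nullary using (¬_; Dec; yes; no)
  open import Relation.Nullary.Decidable using (_×-dec_; ¬?; map′)
  open import Defs using (Graph; []; _∷_; adjacent)
  open Extensibility using (Extensible; Functional)

  count : ∀ {A : Set} → (A → Bool) → List A → ℕ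
  count f xs = length (filterᵇ f xs)

  count-∷ : ∀ {A : Set} (f : A → Bool) x xs → count f (x ∷ xs) ≡ (if f x then 1 else 0) + count f xs
  count-∷ f x xs with f x
  ... | true  = refl
  ... | false = refl

  sum-map-+ : ∀ {A : Set} (f g : A → ℕ) xs → sum (map (λ x → f x + g x) xs) ≡ sum (map f xs) + sum (map g xs)
  sum-map-+ f g []       = refl
  sum-map-+ f g (x ∷ xs) = trans (cong (f x + g x +_) (sum-map-+ f g xs)) (interchange (f x) (g x) _ _)

  sum-bits : ∀ {A : Set} (f : A → Bool) xs → sum (map (λ x → if f x then 1 else 0) xs) ≡ count f xs
  sum-bits f []       = refl
  sum-bits f (x ∷ xs) = trans (cong ((if f x then 1 else 0) +_) (sum-bits f xs)) (sym (count-∷ f x xs))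

  sum-map-cong : ∀ {A : Set} {f g : A → ℕ} → (∀ x → f x ≡ g x) → ∀ xs → sum (map f xs) ≡ sum (map g xs)
  sum-map-cong f≡g []       = refl
  sum-map-cong f≡g (x ∷ xs) = cong₂ _+_ (f≡g x) (sum-map-cong f≡g xs)

  double-count : ∀ {A B : Set} (f : A → B → Bool) xs ys →
    sum (map (λ x → count (f x) ys) xs) ≡ sum (map (λ y → count (λ x → f x y) xs) ys)
  double-count f []       ys = sym (zeros ys)
    where
    zeros : ∀ ys → sum (map (λ _ → 0) ys) ≡ 0
    zeros []       = refl
    zeros (y ∷ ys) = zeros ys
  double-count f (x ∷ xs) ys = begin
    count (f x) ys + sum (map (λ x → count (f x) ys) xs)
      ≡⟨ cong₂ _+_ (sym (sum-bits (f x) ys)) (double-count f xs ys) ⟩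
    sum (map (λ y → if f x y then 1 else 0) ys) + sum (map (λ y → count (λ x → f x y) xs) ys)
      ≡⟨ sum-map-+ _ _ ys ⟨
    sum (map (λ y → (if f x y then 1 else 0) + count (λ x → f x y) xs) ys)
      ≡⟨ sum-map-cong (λ y → sym (count-∷ (λ x → f x y) x xs)) ys ⟩
    sum (map (λ y → count (λ x → f x y) (x ∷ xs)) ys) ∎
    where open ≡-Reasoning

  sum-upper : ∀ {A : Set} (f : A → ℕ) a m xs → All (λ x → a * f x ≤ m) xs → a * sum (map f xs) ≤ length xs * m
  sum-upper f a m []       []           = ≤-reflexive (*-zeroʳ a)
  sum-upper f a m (x ∷ xs) (≤m ∷ ≤ms) =
    ≤-trans (≤-reflexive (*-distribˡ-+ a (f x) _)) (+-mono-≤ ≤m (sum-upper f a m xs ≤ms))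

  sum-lower : ∀ {A : Set} (f : A → ℕ) a m xs → All (λ x → m ≤ a * f x) xs → length xs * m ≤ a * sum (map f xs)
  sum-lower f a m []       []           = z≤n
  sum-lower f a m (x ∷ xs) (m≤ ∷ m≤s) =
    ≤-trans (+-mono-≤ m≤ (sum-lower f a m xs m≤s)) (≤-reflexive (sym (*-distribˡ-+ a (f x) _)))

  -- If every `x` exceeded its share, summing over the nonempty list `x ∷ xs` would count more pairs
  -- than the bounds for the `y` permit.
  average : ∀ {A B : Set} (f : A → B → Bool) a {x xs ys} →
    All (λ y → a * count (λ x → f x y) (x ∷ xs) ≤ length (x ∷ xs)) ys →
    ∃ λ x′ → x′ ∈ x ∷ xs × a * count (f x′) ys ≤ length ys
  average f a {x} {xs} {ys} few with any? (λ x → a * count (f x) ys ≤? length ys) (x ∷ xs)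
  ... | yes some = find some
  ... | no  none = ⊥-elim (<⇒≱ strict (≤-trans
          (≤-reflexive (cong (a *_) (double-count f (x ∷ xs) ys)))
          (≤-trans (sum-upper (λ y → count (λ x → f x y) (x ∷ xs)) a (length (x ∷ xs)) ys few)
                   (≤-reflexive (*-comm (length ys) (length (x ∷ xs)))))))
    where
    many : All (λ x → suc (length ys) ≤ a * count (f x) ys) (x ∷ xs)
    many = All.map ≰⇒> (All.¬Any⇒All¬ (x ∷ xs) none)
    strict : length (x ∷ xs) * length ys < a * sum (map (λ x → count (f x) ys) (x ∷ xs))
    strict = <-≤-trans (*-monoʳ-< (length (x ∷ xs)) (n<1+n (length ys)))
                       (sum-lower (λ x → count (f x) ys) a (suc (length ys)) (x ∷ xs) many)

  ∈-filterᵇ : ∀ {A : Set} (f : A → Bool) {x} {xs} → x ∈ xs → f x ≡ true → x ∈ filterᵇ f xs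
  ∈-filterᵇ f {x} {y ∷ xs} x∈ fx with f y in fy | x∈
  ... | true  | here refl = here refl
  ... | true  | there x∈′ = there (∈-filterᵇ f x∈′ fx)
  ... | false | there x∈′ = ∈-filterᵇ f x∈′ fx
  ... | false | here refl with () ← trans (sym fx) fy

  filterᵇ-⊆ : ∀ {A : Set} (f : A → Bool) {x} xs → x ∈ filterᵇ f xs → x ∈ xs
  filterᵇ-⊆ f (y ∷ xs) x∈ with f y
  filterᵇ-⊆ f (y ∷ xs) (here refl) | true  = here refl
  filterᵇ-⊆ f (y ∷ xs) (there x∈)  | true  = there (filterᵇ-⊆ f xs x∈)
  filterᵇ-⊆ f (y ∷ xs) x∈          | false = there (filterᵇ-⊆ f xs x∈)

  count-not : ∀ {A : Set} (f : A → Bool) xs → count f xs + count (not ∘ f) xs ≡ length xs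
  count-not f []       = refl
  count-not f (x ∷ xs) with f x
  ... | true  = cong suc (count-not f xs)
  ... | false = trans (+-suc _ _) (cong suc (count-not f xs))

  module _ {n : ℕ} (G : Graph n) where

    Realises : List (Fin n × Bool) → Fin n → Set
    Realises us v = ∀ u b → (u , b) ∈ us → u ≢ v × adjacent G u v ≡ b

    realises? : ∀ us v → Dec (Realises us v)
    realises? us v = map′ (λ all u b → All.lookup all) (λ r → All.tabulate (r _ _))
      (All.all? (λ (u , b) → ¬? (u Fin.≟ v) ×-dec (adjacent G u v Bool.≟ b)) us)

    nonadjacent : Fin n → Fin n → Bool
    nonadjacent x z = not (adjacent G x z)

    Avoids : List (Fin n × Bool) → List (Fin n) → Set
    Avoids us P = ∀ {x b} → x ∈ P → ¬ (x , b) ∈ us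

    module Kill {s} (ext : Extensible s G) (a r : ℕ) (n<aʳ : n < a ^ r) where

      -- By `average`, some vertex of `P` is nonadjacent to at most a fraction 1/a of `zs`. Choosing
      -- it and recursing on that fraction exhausts fewer than `a ^ k` vertices in `k` choices.
      covering : ∀ P {x} → x ∈ P → ∀ k zs →
        All (λ z → a * count (λ x → nonadjacent x z) P ≤ length P) zs → length zs < a ^ k →
        ∃ λ xs → length xs ≤ k × (∀ {x} → x ∈ xs → x ∈ P) × (∀ {z} → z ∈ zs → ∃ λ x → x ∈ xs × adjacent G x z ≡ true)
      covering P x∈P zero    []       few _  = [] , z≤n , (λ ()) , λ ()
      covering P x∈P zero    (z ∷ zs) few (s≤s ())
      covering P@(_ ∷ _) x∈P (suc k) zs few zs<
        with x , x∈ , x-few ← average nonadjacent a few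
        with covering P x∈P k (filterᵇ (nonadjacent x) zs)
               (All.tabulate λ z∈ → All.lookup few (filterᵇ-⊆ (nonadjacent x) zs z∈))
               (*-cancelˡ-< a _ _ (≤-<-trans x-few zs<))
      ... | xs , xs≤k , xs⊆P , covers = x ∷ xs , s≤s xs≤k
          , (λ where (here refl) → x∈ ; (there x∈′) → xs⊆P x∈′) , covers′
        where
        covers′ : ∀ {z} → z ∈ zs → ∃ λ y → y ∈ x ∷ xs × adjacent G y z ≡ true
        covers′ {z} z∈ with adjacent G x z in x~z
        ... | true  = x , here refl , x~z
        ... | false with covers (∈-filterᵇ (nonadjacent x) z∈ (cong not x~z))
        ...   | y , y∈ , y~z = y , there y∈ , y~z

      -- Otherwise at most `r` vertices of `P` would cover all realisations of `us`, yet prescribing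
      -- nonadjacency to them as well yields a realisation they do not cover. The enlarged
      -- prescription is consistent by `Avoids`, and `r` is the room reserved for it within `s`.
      kill : ∀ us → Functional us → length us + r ≤ s → ∀ P → Avoids us P →
        ∃ λ z → Realises us z × length P ≤ a * count (λ x → nonadjacent x z) P
      kill us fun us+r≤s [] avoids with ext us (≤-trans (m≤m+n (length us) r) us+r≤s) fun
      ... | z , real = z , real , z≤n
      kill us fun us+r≤s P@(x₀ ∷ _) avoids
        with Fin.any? (λ z → realises? us z ×-dec (length P ≤? a * count (λ x → nonadjacent x z) P))
      ... | yes found = found
      ... | no  none  = ⊥-elim impossible
        where
        zs = filter (realises? us) (allFin n)
        few : All (λ z → a * count (λ x → nonadjacent x z) P ≤ length P) zs
        few = All.tabulate λ {z} z∈ → <⇒≤ (≰⇒> λ many →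
          none (z , proj₂ (∈-filter⁻ (realises? us) {xs = allFin n} z∈) , many))
        zs≤n : length zs ≤ n
        zs≤n = ≤-trans (length-filter (realises? us) (allFin n)) (≤-reflexive (length-tabulate {n = n} id))
        impossible : ⊥
        impossible with covering P (here refl) r zs few (≤-<-trans zs≤n n<aʳ)
        ... | xs , xs≤r , xs⊆P , covers with ext (us ++ map (_, false) xs) short functional
          where
          short : length (us ++ map (_, false) xs) ≤ s
          short = ≤-trans (≤-reflexive (trans (length-++ us) (cong (length us +_) (length-map _ xs))))
                          (≤-trans (+-monoʳ-≤ (length us) xs≤r) us+r≤s)
          new : ∀ {u b} → (u , b) ∈ map (_, false) xs → u ∈ xs × b ≡ false
          new u∈ with ∈-map⁻ (_, false) u∈
          ... | _ , x∈ , refl = x∈ , refl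
          functional : Functional (us ++ map (_, false) xs)
          functional u b c p q with ∈-++⁻ us p | ∈-++⁻ us q
          ... | inj₁ p′ | inj₁ q′ = fun u b c p′ q′
          ... | inj₁ p′ | inj₂ q′ = ⊥-elim (avoids (xs⊆P (proj₁ (new q′))) p′)
          ... | inj₂ p′ | inj₁ q′ = ⊥-elim (avoids (xs⊆P (proj₁ (new p′))) q′)
          ... | inj₂ p′ | inj₂ q′ = trans (proj₂ (new p′)) (sym (proj₂ (new q′)))
        ...   | z , real with covers (∈-filter⁺ (realises? us) (∈-allFin z) λ u b u∈ → real u b (∈-++⁺ˡ u∈))
        ...     | x , x∈ , x~z with () ← trans (sym x~z) (proj₂ (real x false (∈-++⁺ʳ us (∈-map⁺ (_, false) x∈))))

      abstract
        -- `kill` is applied once per prescription to the vertices adjacent to every choice so far,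
        -- of which at most the fraction `a′ / a` remains each time; the product form of the bound
        -- avoids division.
        sweep : ∀ {a′} → a ≡ suc a′ → ∀ N (us : Fin N → List (Fin n × Bool)) → (∀ j → Functional (us j)) →
          (∀ j → length (us j) + r ≤ s) → ∀ P → (∀ j → Avoids (us j) P) →
          ∃₂ λ (w : Fin N → Fin n) P′ → (∀ j → Realises (us j) (w j)) ×
            (∀ {x} → x ∈ P → x ∈ P′ ⊎ ∃ λ j → adjacent G x (w j) ≡ false) ×
            a ^ N * length P′ ≤ a′ ^ N * length P
        sweep refl zero    us fun short P avoids = (λ ()) , P , (λ ()) , inj₁ , ≤-refl
        sweep {a′} refl (suc N) us fun short P avoids
          with z , real , many ← kill (us zero) (fun zero) (short zero) P (avoids zero)
          with sweep refl N (us ∘ suc) (fun ∘ suc) (short ∘ suc) (filterᵇ (λ x → adjacent G x z) P)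
                     (λ j x∈ → avoids (suc j) (filterᵇ-⊆ _ P x∈))
        ... | w , P′ , reals , sweeps , shrink = w⁺ , P′ , reals⁺ , sweeps⁺ , shrink⁺
          where
          w⁺ : Fin (suc N) → Fin n
          w⁺ zero    = z
          w⁺ (suc j) = w j
          reals⁺ : ∀ j → Realises (us j) (w⁺ j)
          reals⁺ zero    = real
          reals⁺ (suc j) = reals j
          sweeps⁺ : ∀ {x} → x ∈ P → x ∈ P′ ⊎ ∃ λ j → adjacent G x (w⁺ j) ≡ false
          sweeps⁺ {x} x∈ with adjacent G x z in x~z
          ... | false = inj₂ (zero , x~z)
          ... | true with sweeps (∈-filterᵇ (λ x → adjacent G x z) x∈ x~z)
          ...   | inj₁ x∈′      = inj₁ x∈′
          ...   | inj₂ (j , nj) = inj₂ (suc j , nj)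
          alive dead : ℕ
          alive = count (λ x → adjacent G x z) P
          dead  = count (λ x → nonadjacent x z) P
          step : a * alive ≤ a′ * length P
          step = +-cancelˡ-≤ (length P) _ _ (begin
            length P + a * alive     ≤⟨ +-monoˡ-≤ (a * alive) many ⟩
            a * dead + a * alive     ≡⟨ *-distribˡ-+ a dead alive ⟨
            a * (dead + alive)       ≡⟨ cong (a *_) (trans (+-comm dead alive) (count-not (λ x → adjacent G x z) P)) ⟩
            a * length P             ∎)
            where open ≤-Reasoning
          shrink⁺ : a * a ^ N * length P′ ≤ a′ * a′ ^ N * length P
          shrink⁺ = begin
            a * a ^ N * length P′       ≡⟨ *-assoc a (a ^ N) (length P′) ⟩
            a * (a ^ N * length P′)     ≤⟨ *-monoʳ-≤ a shrink ⟩
            a * (a′ ^ N * alive)        ≡⟨ swap a (a′ ^ N) alive ⟩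
            a′ ^ N * (a * alive)        ≤⟨ *-monoʳ-≤ (a′ ^ N) step ⟩
            a′ ^ N * (a′ * length P)    ≡⟨ swap′ (a′ ^ N) a′ (length P) ⟩
            a′ * a′ ^ N * length P      ∎
            where
            open ≤-Reasoning
            swap : ∀ x y z → x * (y * z) ≡ y * (x * z)
            swap = solve-∀
            swap′ : ∀ x y z → x * (y * z) ≡ y * x * z
            swap′ = solve-∀

  -- That is, `(b / (b + 1)) ^ j ≤ (b + 1) / (b + 1 + j)`, which becomes ½ at `j = b + 1`.
  bernoulliℕ : ∀ b j → b ^ j * (suc b + j) ≤ suc b ^ suc j
  bernoulliℕ b zero    = ≤-reflexive (lemma b)
    where
    lemma : ∀ b → 1 * (suc b + 0) ≡ suc b * 1
    lemma = solve-∀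
  bernoulliℕ b (suc j) = begin
    b * b ^ j * (suc b + suc j)    ≤⟨ m≤m+n _ (b ^ j * suc j) ⟩
    b * b ^ j * (suc b + suc j) + b ^ j * suc j  ≡⟨ lemma b (b ^ j) j ⟩
    suc b * (b ^ j * (suc b + j))  ≤⟨ *-monoʳ-≤ (suc b) (bernoulliℕ b j) ⟩
    suc b * suc b ^ suc j          ∎
    where
    open ≤-Reasoning
    lemma : ∀ b x j → b * x * (suc b + suc j) + x * suc j ≡ suc b * (x * (suc b + j))
    lemma = solve-∀

  2*b^a≤a^a : ∀ b → 2 * b ^ suc b ≤ suc b ^ suc b
  2*b^a≤a^a b = *-cancelˡ-≤ (suc b) (begin
    suc b * (2 * b ^ suc b)          ≡⟨ lemma b (b ^ suc b) ⟩
    b ^ suc b * (suc b + suc b)      ≤⟨ bernoulliℕ b (suc b) ⟩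
    suc b * suc b ^ suc b            ∎)
    where
    open ≤-Reasoning
    lemma : ∀ b x → suc b * (2 * x) ≡ x * (suc b + suc b)
    lemma = solve-∀

  -- Every group of `suc b` rounds at least halves what remains, and `N` rounds contain `t` groups.
  2^t*b^N≤a^N : ∀ b t N → suc b * t ≤ N → 2 ^ t * b ^ N ≤ suc b ^ N
  2^t*b^N≤a^N b t N at≤N with k , refl ← m≤n⇒∃[o]m+o≡n at≤N = begin
    2 ^ t * b ^ (suc b * t + k)               ≡⟨ cong (2 ^ t *_) (^-distribˡ-+-* b (suc b * t) k) ⟩
    2 ^ t * (b ^ (suc b * t) * b ^ k)         ≡⟨ *-assoc (2 ^ t) (b ^ (suc b * t)) (b ^ k) ⟨
    2 ^ t * b ^ (suc b * t) * b ^ k           ≡⟨ cong (λ x → 2 ^ t * x * b ^ k) (^-*-assoc b (suc b) t) ⟨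
    2 ^ t * (b ^ suc b) ^ t * b ^ k           ≡⟨ cong (_* b ^ k) (^-distribʳ-* t 2 (b ^ suc b)) ⟨
    (2 * b ^ suc b) ^ t * b ^ k               ≤⟨ *-mono-≤ (^-monoˡ-≤ t (2*b^a≤a^a b)) (^-monoˡ-≤ k (n≤1+n b)) ⟩
    (suc b ^ suc b) ^ t * suc b ^ k           ≡⟨ cong (_* suc b ^ k) (^-*-assoc (suc b) (suc b) t) ⟩
    suc b ^ (suc b * t) * suc b ^ k           ≡⟨ ^-distribˡ-+-* (suc b) (suc b * t) k ⟨
    suc b ^ (suc b * t + k)                   ∎
    where
    open ≤-Reasoning
    ^-distribʳ-* : ∀ t x y → (x * y) ^ t ≡ x ^ t * y ^ t
    ^-distribʳ-* zero    x y = refl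
    ^-distribʳ-* (suc t) x y = trans (cong (x * y *_) (^-distribʳ-* t x y)) (swap x y (x ^ t) (y ^ t))
      where
      swap : ∀ x y u v → x * y * (u * v) ≡ x * u * (y * v)
      swap = solve-∀

-- Binary digits and the levels of a tower

module TowerLevels where

  open import Data.Bool.Base using (Bool; true; false; not; _∧_; if_then_else_; T)
  import Data.Bool.Properties as Bool
  open import Data.Empty using (⊥-elim)
  open import Data.Fin.Base using (Fin; zero; suc; toℕ; fromℕ<; inject≤)
  open import Data.Fin.Patterns using (2F; 3F)
  import Data.Fin.Properties as Fin
  open import Data.List.Base using (List; _∷_; tabulate)
  open import Data.List.Properties using (length-tabulate)
  open import Data.List.Membership.Propositional.Properties using (∈-tabulate⁺; ∈-tabulate⁻)
  open import Data.Nat.Base as ℕ using (ℕ; zero; suc; s≤s; z≤n; _≤_; _<_; _+_; _^_; ⌊_/2⌋; _≤ᵇ_)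
  open import Data.Nat.Properties
  open import Data.Product using (∃; ∃₂; _×_; _,_; proj₁; proj₂)
  open import Data.Sum using (_⊎_; inj₁; inj₂)
  open import Function using (_∘_; id; _⇔_; Injective)
  open import Function.Bundles using (module Equivalence)
  open Equivalence using (to; from)
  open import Relation.Binary.Definitions using (tri<; tri≈; tri>)
  open import Relation.Binary.PropositionalEquality hiding ([_])
  open import Relation.Nullary using (¬_; Dec; yes; no; does)
  open import Relation.Nullary.Decidable using (dec-true)
  open import Defs using (Graph; _∷_; adjacent)
  open Extensibility using (Extensible; Functional)
  open TowerSentence
  open Sweeping using (Realises)
  open TowerSize using (≡true-ext; absurd)

  odd : ℕ → Bool
  odd zero    = false
  odd (suc a) = not (odd a)

  bit : ℕ → ℕ → Bool
  bit a zero    = odd a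
  bit a (suc m) = bit ⌊ a /2⌋ m

  allBelow : (ℕ → Bool) → ℕ → Bool
  allBelow β zero    = true
  allBelow β (suc m) = β 0 ∧ allBelow (β ∘ suc) m

  incBit : (ℕ → Bool) → ℕ → Bool
  incBit β m = if allBelow β m then not (β m) else β m

  half-odd : ∀ a → ⌊ suc a /2⌋ ≡ (if odd a then suc ⌊ a /2⌋ else ⌊ a /2⌋)
  half-odd zero          = refl
  half-odd (suc zero)    = refl
  half-odd (suc (suc a)) with odd a | half-odd a
  ... | true  | eq = cong suc eq
  ... | false | eq = cong suc eq

  bit-suc : ∀ a m → bit (suc a) m ≡ incBit (bit a) m
  bit-suc a zero    = refl
  bit-suc a (suc m) with odd a | half-odd a
  ... | true  | eq = trans (cong (λ h → bit h m) eq) (bit-suc ⌊ a /2⌋ m)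
  ... | false | eq = cong (λ h → bit h m) eq

  odd-double : ∀ a → odd (a + a) ≡ false
  odd-double zero    = refl
  odd-double (suc a) rewrite +-suc a a = trans (Bool.not-involutive (odd (a + a))) (odd-double a)

  half-double : ∀ a → ⌊ a + a /2⌋ ≡ a
  half-double zero    = refl
  half-double (suc a) rewrite +-suc a a = cong suc (half-double a)

  2^suc : ∀ k → 2 ^ suc k ≡ 2 ^ k + 2 ^ k
  2^suc k = cong (2 ^ k +_) (+-identityʳ (2 ^ k))

  -- Needed where counting wraps around: the successor of the last index has the same lowest `k`
  -- digits as 0.
  bit-2^ : ∀ {k m} → m < k → bit (2 ^ k) m ≡ false
  bit-2^ {suc k} {zero}  _         rewrite 2^suc k = odd-double (2 ^ k)
  bit-2^ {suc k} {suc m} (s≤s m<k) rewrite 2^suc k | half-double (2 ^ k) = bit-2^ m<k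

  bit-0 : ∀ m → bit 0 m ≡ false
  bit-0 zero    = refl
  bit-0 (suc m) = bit-0 m

  half-decomposition : ∀ a → a ≡ (if odd a then 1 else 0) + (⌊ a /2⌋ + ⌊ a /2⌋)
  half-decomposition zero          = refl
  half-decomposition (suc zero)    = refl
  half-decomposition (suc (suc a)) with odd a | half-decomposition a
  ... | true  | eq rewrite +-suc ⌊ a /2⌋ ⌊ a /2⌋ = cong (2 +_) eq
  ... | false | eq rewrite +-suc ⌊ a /2⌋ ⌊ a /2⌋ = cong (2 +_) eq

  half-< : ∀ {a b} → a < b + b → ⌊ a /2⌋ < b
  half-< {a} {b} a<2b = ≰⇒> λ b≤ → <⇒≱ a<2b (≤-trans (+-mono-≤ b≤ b≤)
    (≤-trans (m≤n+m _ (if odd a then 1 else 0)) (≤-reflexive (sym (half-decomposition a)))))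

  bit-injective : ∀ k {a b} → a < 2 ^ k → b < 2 ^ k → (∀ m → m < k → bit a m ≡ bit b m) → a ≡ b
  bit-injective zero    (s≤s z≤n) (s≤s z≤n) same = refl
  bit-injective (suc k) {a} {b} a< b< same = begin
    a                                                    ≡⟨ half-decomposition a ⟩
    (if odd a then 1 else 0) + (⌊ a /2⌋ + ⌊ a /2⌋)       ≡⟨ cong₂ (λ o h → (if o then 1 else 0) + (h + h)) (same 0 (s≤s z≤n)) halves ⟩
    (if odd b then 1 else 0) + (⌊ b /2⌋ + ⌊ b /2⌋)       ≡⟨ half-decomposition b ⟨
    b                                                    ∎
    where
    open ≡-Reasoning
    halves : ⌊ a /2⌋ ≡ ⌊ b /2⌋
    halves = bit-injective k (half-< (subst (a <_) (2^suc k) a<)) (half-< (subst (b <_) (2^suc k) b<))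
                             (λ m m<k → same (suc m) (s≤s m<k))

  allBelow⁺ : ∀ β m → (∀ l → l < m → β l ≡ true) → allBelow β m ≡ true
  allBelow⁺ β zero    f = refl
  allBelow⁺ β (suc m) f rewrite f 0 (s≤s z≤n) = allBelow⁺ (β ∘ suc) m λ l l<m → f (suc l) (s≤s l<m)

  allBelow⁻ : ∀ β m → allBelow β m ≡ true → ∀ l → l < m → β l ≡ true
  allBelow⁻ β (suc m) eq zero    l<m with β 0
  ... | true = refl
  allBelow⁻ β (suc m) eq (suc l) (s≤s l<m) with β 0
  ... | true = allBelow⁻ (β ∘ suc) m eq l l<m

  ≤ᵇ-true : ∀ {a b} → a ≤ b → (a ≤ᵇ b) ≡ true
  ≤ᵇ-true {a} {b} a≤b with a ≤ᵇ b in eq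
  ... | true  = refl
  ... | false = ⊥-elim (subst T eq (≤⇒≤ᵇ a≤b))

  ≤ᵇ-true⁻ : ∀ {a b} → (a ≤ᵇ b) ≡ true → a ≤ b
  ≤ᵇ-true⁻ {a} {b} eq = ≤ᵇ⇒≤ a b (subst T (sym eq) _)

  adjacent-sym : ∀ {n} (G : Graph n) u v → adjacent G u v ≡ adjacent G v u
  adjacent-sym (r ∷ G) zero    zero    = refl
  adjacent-sym (r ∷ G) zero    (suc v) = refl
  adjacent-sym (r ∷ G) (suc u) zero    = refl
  adjacent-sym (r ∷ G) (suc u) (suc v) = adjacent-sym G u v

  does-true : ∀ {A : Set} (A? : Dec A) → does A? ≡ true → A
  does-true (yes a) _ = a

  assignment : ∀ {n h} → (Fin h → Fin n) → (Fin h → Bool) → List (Fin n × Bool)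
  assignment f β = tabulate λ i → f i , β i

  assignment-functional : ∀ {n h} {f : Fin h → Fin n} {β} → Injective _≡_ _≡_ f → Functional (assignment f β)
  assignment-functional inj u b c p q with ∈-tabulate⁻ p | ∈-tabulate⁻ q
  ... | i , refl | j , eq with refl ← inj (cong proj₁ eq) = sym (cong proj₂ eq)

  assignment-realised : ∀ {n h} (G : Graph n) (f : Fin h → Fin n) β {v} → Realises G (assignment f β) v →
    ∀ i → f i ≢ v × adjacent G (f i) v ≡ β i
  assignment-realised G f β real i = real _ _ (∈-tabulate⁺ i)

  module _ {n s : ℕ} {G : Graph n} (ext : Extensible s G) where

    realise : ∀ {h} (f : Fin h → Fin n) β → Injective _≡_ _≡_ f → h ≤ s →
      ∃ λ v → ∀ i → f i ≢ v × adjacent G (f i) v ≡ β i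
    realise f β inj h≤s
      with v , real ← ext (assignment f β) (≤-trans (≤-reflexive (length-tabulate _)) h≤s) (assignment-functional inj)
      = v , assignment-realised G f β real

    abstract
      -- The pattern without `zero` is placed first; then `zero` is found by prescribing its
      -- adjacency to everything placed. Injectivity comes from the inequalities in `Extensible`.
      embed : ∀ {h} (E : Fin h → Fin h → Bool) → (∀ i j → E i j ≡ E j i) → h ≤ s →
        ∃ λ (f : Fin h → Fin n) → Injective _≡_ _≡_ f × (∀ i j → i ≢ j → adjacent G (f i) (f j) ≡ E i j)
      embed {zero}  E E-sym h≤s = (λ ()) , (λ { {()} }) , λ ()
      embed {suc h} E E-sym h<s
        with f , inj , adj ← embed {h} (λ i j → E (suc i) (suc j)) (λ i j → E-sym (suc i) (suc j)) (<⇒≤ h<s)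
        with v , real ← realise f (E zero ∘ suc) inj (<⇒≤ h<s)
        = f⁺ , (λ {i} {j} → inj⁺ i j) , adj⁺
        where
        f⁺ : Fin (suc h) → Fin n
        f⁺ zero    = v
        f⁺ (suc i) = f i
        inj⁺ : ∀ i j → f⁺ i ≡ f⁺ j → i ≡ j
        inj⁺ zero    zero    eq = refl
        inj⁺ zero    (suc j) eq = ⊥-elim (proj₁ (real j) (sym eq))
        inj⁺ (suc i) zero    eq = ⊥-elim (proj₁ (real i) eq)
        inj⁺ (suc i) (suc j) eq = cong suc (inj eq)
        adj⁺ : ∀ i j → i ≢ j → adjacent G (f⁺ i) (f⁺ j) ≡ E i j
        adj⁺ zero    zero    i≢j = ⊥-elim (i≢j refl)
        adj⁺ zero    (suc j) i≢j = trans (adjacent-sym G v (f j)) (proj₂ (real j))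
        adj⁺ (suc i) zero    i≢j = trans (proj₂ (real i)) (E-sym zero (suc i))
        adj⁺ (suc i) (suc j) i≢j = adj i j (i≢j ∘ cong suc)

  Range : ∀ {A B : Set} → (A → B) → B → Set
  Range f y = ∃ λ x → y ≡ f x

  module Verify {n B : ℕ} (G : Graph n) (R : Fin (4 + B) → Fin n → Set)
                {K : ℕ} (cut : Fin K → Fin n) (R-cut : ∀ v → R 3F v ⇔ Range cut v) where
    open Semantics G R

    module Level {k : ℕ} (k≤K : k ≤ K) (q : Fin k → Fin n)
                 (cut-q : ∀ c a → adjacent G (cut c) (q a) ≡ (toℕ a ≤ᵇ toℕ c))
                 (A : Fin n → Set) (A-q : ∀ v → A v ⇔ Range q v) where

      ≺⁺ : ∀ {a b} → toℕ a < toℕ b → q a ≺ q b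
      ≺⁺ {a} {b} a<b = cut c , from (R-cut _) (c , refl)
        , trans (cut-q c a) (≤ᵇ-true (≤-reflexive (sym c≡a)))
        , λ c~b → <⇒≱ a<b (≤-trans (≤ᵇ-true⁻ (trans (sym (cut-q c b)) c~b)) (≤-reflexive c≡a))
        where
        -- The cut with the index of `a` is adjacent to exactly the elements up to `a`, so it
        -- separates `a` from everything above.
        c = inject≤ a k≤K
        c≡a : toℕ c ≡ toℕ a
        c≡a = Fin.toℕ-inject≤ a k≤K

      ≺⁻ : ∀ {a b} → q a ≺ q b → toℕ a < toℕ b
      ≺⁻ {a} {b} (w , rw , w~a , w≁b) with to (R-cut w) rw
      ... | c , refl = ≰⇒> λ b≤a → w≁b (trans (cut-q c b)
        (≤ᵇ-true (≤-trans b≤a (≤ᵇ-true⁻ (trans (sym (cut-q c a)) w~a)))))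

      level-ordered : Ordered A
      level-ordered u v au av with to (A-q u) au | to (A-q v) av
      ... | a , refl | b , refl = total , λ (u≺v , v≺u) → <-asym (≺⁻ {a} {b} u≺v) (≺⁻ {b} {a} v≺u)
        where
        total : q a ≡ q b ⊎ q a ≺ q b ⊎ q b ≺ q a
        total with <-cmp (toℕ a) (toℕ b)
        ... | tri< a<b _ _ = inj₂ (inj₁ (≺⁺ a<b))
        ... | tri≈ _ a≡b _ = inj₁ (cong q (Fin.toℕ-injective a≡b))
        ... | tri> _ _ b<a = inj₂ (inj₂ (≺⁺ b<a))

      Code : Fin n → (ℕ → Bool) → Set
      Code v β = ∀ a → adjacent G (q a) v ≡ β (toℕ a)

      -- `allBelow` is the carry expressed in digits, so `incBit` and `Next` flip the same
      -- positions.
      code⇒next : ∀ {v v′ β} → Code v β → Code v′ (incBit β) → Next A v v′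
      code⇒next {v} {v′} {β} cv cv′ z az with to (A-q z) az
      ... | c , refl = carried , uncarried
        where
        carry⇒below : Carry A v (q c) → allBelow β (toℕ c) ≡ true
        carry⇒below carry = allBelow⁺ β (toℕ c) λ l l<c →
          let l<k = <-trans l<c (Fin.toℕ<n c)
              a   = fromℕ< l<k
              a≡l = Fin.toℕ-fromℕ< l<k
          in trans (sym (trans (cv a) (cong β a≡l)))
                   (carry (q a) (from (A-q _) (a , refl)) (≺⁺ (≤-trans (≤-reflexive (cong suc a≡l)) l<c)))
        below⇒carry : allBelow β (toℕ c) ≡ true → Carry A v (q c)
        below⇒carry below u au u≺z with to (A-q u) au
        ... | a , refl = trans (cv a) (allBelow⁻ β (toℕ c) below (toℕ a) (≺⁻ {a} {c} u≺z))
        carried : Carry A v (q c) → (q c ~ v′ → ¬ q c ~ v) × (¬ q c ~ v → q c ~ v′)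
        carried carry rewrite cv′ c | cv c | carry⇒below carry with β (toℕ c)
        ... | true  = (λ ()) , λ n → ⊥-elim (n refl)
        ... | false = (λ _ ()) , λ _ → refl
        uncarried : ¬ Carry A v (q c) → (q c ~ v′ → q c ~ v) × (q c ~ v → q c ~ v′)
        uncarried ¬carry rewrite cv′ c | cv c with allBelow β (toℕ c) in eq
        ... | true  = ⊥-elim (¬carry (below⇒carry eq))
        ... | false = id , id

      module Power {k⁺ : ℕ} (k⁺≡ : k⁺ ≡ 2 ^ k) (q⁺ : Fin k⁺ → Fin n) (bits : ∀ a c → adjacent G (q c) (q⁺ a) ≡ bit (toℕ a) (toℕ c))
                   (Y : Fin n → Set) (Y-q⁺ : ∀ v → Y v ⇔ Range q⁺ v) where

        k⁺>0 : 0 < k⁺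
        k⁺>0 = subst (0 <_) (sym k⁺≡) (m^n>0 2 k)

        successor : ∀ (a : Fin k⁺) → ∃ λ (b : Fin k⁺) → ∀ c → c < k → bit (toℕ b) c ≡ incBit (bit (toℕ a)) c
        successor a with m≤n⇒m<n∨m≡n (Fin.toℕ<n a)
        ... | inj₁ a+1<k⁺ = fromℕ< a+1<k⁺ , λ c _ →
                trans (cong (λ x → bit x c) (Fin.toℕ-fromℕ< a+1<k⁺)) (bit-suc (toℕ a) c)
        ... | inj₂ a+1≡k⁺ = fromℕ< k⁺>0 , λ c c<k → trans (cong (λ x → bit x c) (Fin.toℕ-fromℕ< k⁺>0))
                (trans (bit-0 c) (trans (sym (bit-2^ c<k)) (trans (cong (λ x → bit x c) (trans (sym k⁺≡) (sym a+1≡k⁺))) (bit-suc (toℕ a) c))))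

        level-shattered : Shattered A Y
        level-shattered = (q⁺ 0# , from (Y-q⁺ _) (0# , refl)) , next
          where
          0# = fromℕ< k⁺>0
          next : ∀ v → Y v → ∃ λ v′ → Y v′ × Next A v v′
          next v yv with to (Y-q⁺ v) yv
          ... | a , refl with successor a
          ...   | b , b≡ = q⁺ b , from (Y-q⁺ _) (b , refl)
                , code⇒next {β = bit (toℕ a)} (bits a) (λ c → trans (bits b c) (b≡ (toℕ c) (Fin.toℕ<n c)))

        level-separated : Separated A Y
        level-separated u v yu yv same with to (Y-q⁺ u) yu | to (Y-q⁺ v) yv
        ... | a , refl | b , refl = cong q⁺ (Fin.toℕ-injective
                (bit-injective k (subst (toℕ a <_) k⁺≡ (Fin.toℕ<n a)) (subst (toℕ b <_) k⁺≡ (Fin.toℕ<n b)) same-bits))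
          where
          same-bits : ∀ m → m < k → bit (toℕ a) m ≡ bit (toℕ b) m
          same-bits m m<k = subst (λ m → bit (toℕ a) m ≡ bit (toℕ b) m) (Fin.toℕ-fromℕ< m<k)
            (trans (sym (bits a c)) (trans (≡true-ext _ _ (proj₁ s) (proj₂ s)) (bits b c)))
            where
            c = fromℕ< m<k
            s = same (q c) (from (A-q _) (c , refl))

      -- No vertices are prepared above the top level: extensibility realises the incremented code
      -- directly.
      shatters-all : ∀ {s} → Extensible s G → k ≤ s → Injective _≡_ _≡_ q → Fin n → Shattered A All
      shatters-all ext k≤s inj v₀ = (v₀ , refl) , λ v _ →
        let v′ , real = realise {G = G} ext q (incBit (β v) ∘ toℕ) inj k≤s
        in v′ , refl , code⇒next {β = β v} (β-code v) (proj₂ ∘ real)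
        where
        β : Fin n → ℕ → Bool
        β v m with m <? k
        ... | yes m<k = adjacent G (q (fromℕ< m<k)) v
        -- A default value beyond the level; only positions below `k` are ever read.
        ... | no  _   = false
        β-code : ∀ v → Code v (β v)
        β-code v a with toℕ a <? k
        ... | yes a<k = cong (λ c → adjacent G (q c) v) (sym (Fin.fromℕ<-toℕ a a<k))
        ... | no  a≮k = ⊥-elim (a≮k (Fin.toℕ<n a))

    module Dominators (q : Fin K → Fin n) (w : Fin B → Fin K → Fin n)
      (R-q : ∀ v → R 2F v ⇔ Range q v) (R-w : ∀ b v → R (w# b) v ⇔ Range (w b) v)
      (matched : ∀ b u x → adjacent G (w b u) (q x) ≡ does (u Fin.≟ x))
      (unadjacent : ∀ v → ∃₂ λ b u → adjacent G (w b u) v ≡ false) where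

      all-injected : ∀ b → Injected b
      all-injected b = (λ v rv → total v (to (R-w b v) rv)) , inj
        where
        total : ∀ v → Range (w b) v → ∃ λ u → R 2F u × v ~ u
        total _ (u , refl) = q u , from (R-q _) (u , refl) , trans (matched b u u) (dec-true (u Fin.≟ u) refl)
        match⇒≡ : ∀ {u x} → w b u ~ q x → u ≡ x
        match⇒≡ {u} {x} eq = does-true (u Fin.≟ x) (trans (sym (matched b u x)) eq)
        inj : ∀ v v′ x → R (w# b) v → R (w# b) v′ → R 2F x → v ~ x → v′ ~ x → v ≡ v′
        inj v v′ x rv rv′ rx v~x v′~x with to (R-w b v) rv | to (R-w b v′) rv′ | to (R-q x) rx
        ... | u , refl | u′ , refl | y , refl = cong (w b) (trans (match⇒≡ v~x) (sym (match⇒≡ v′~x)))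

      undominated : Undominated
      undominated v with unadjacent v
      ... | b , u , wv = w b u , (b , from (R-w b _) (u , refl)) , absurd ∘ trans (sym wv)

-- Existence of the tower in an extensible graph

module TowerExistence where

  open import Data.Bool.Base using (Bool; true; false; _∨_)
  import Data.Bool.Properties as Bool
  open import Data.Empty using (⊥-elim)
  open import Data.Fin.Base using (Fin; zero; suc; toℕ; fromℕ<; combine; remQuot)
  open import Data.Fin.Patterns using (0F; 1F; 2F; 3F)
  open import Data.Fin.Subset using (Subset) renaming (_∈_ to _∈ₛ_)
  import Data.Fin.Properties as Fin
  open import Data.List.Base using (List; []; _∷_; length; filter; allFin)
  open import Data.List.Properties using (length-tabulate; length-filter)
  open import Data.List.Membership.Propositional using (_∈_)
  open import Data.List.Membership.Propositional.Properties using (∈-tabulate⁻; ∈-filter⁺; ∈-filter⁻; ∈-allFin)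
  open import Data.List.Relation.Unary.Any using (here; there)
  open import Data.Nat.Base as ℕ using (ℕ; zero; suc; s≤s; z≤n; _≤_; _<_; _+_; _*_; _^_; _≤ᵇ_)
  open import Data.Nat.Properties
  open import Data.Nat.Tactic.RingSolver using (solve-∀)
  open import Data.Product using (∃; ∃₂; _×_; _,_; proj₁; proj₂)
  open import Data.Sum using (_⊎_; inj₁; inj₂)
  open import Data.Sum.Function.Propositional using (_⊎-↔_)
  open import Data.Vec.Base as Vec using (Vec)
  open import Data.Vec.Properties using (lookup∘tabulate; []=⇒lookup; lookup⇒[]=)
  open import Function using (_∘_; id; _⇔_; mk⇔; Injective; _↔_; Inverse)
  open import Function.Bundles using (module Equivalence)
  open import Function.Construct.Composition using (_↔-∘_)
  open import Function.Construct.Identity using (↔-id)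
  open Equivalence using (to; from)
  open import Relation.Binary.PropositionalEquality hiding ([_])
  open import Relation.Nullary using (¬_; Dec; yes; no; does)
  open import Relation.Nullary.Decidable using (dec-true; dec-false; _⊎-dec_; _×-dec_; ¬?)
  open import Relation.Unary using (Decidable)
  open import Defs using (Graph; []; _∷_; adjacent; _⊨_)
  open Formulas using (sentence; sentence-complete)
  open Extensibility using (Extensible)
  open TowerSentence
  open Sweeping
  open TowerSize using (absurd)
  open TowerLevels

  subset : ∀ {n} {P : Fin n → Set} → Decidable P → Subset n
  subset P? = Vec.tabulate (does ∘ P?)

  ∈-subset : ∀ {n} {P : Fin n → Set} (P? : Decidable P) v → v ∈ₛ subset P? ⇔ P v
  ∈-subset {P = P} P? v = mk⇔ ⇒ ⇐
    where
    ⇒ : v ∈ₛ subset P? → P v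
    ⇒ v∈ with P? v | trans (sym (lookup∘tabulate (does ∘ P?) v)) ([]=⇒lookup v∈)
    ... | yes pv | _ = pv
    ⇐ : P v → v ∈ₛ subset P?
    ⇐ pv = lookup⇒[]= v _ (trans (lookup∘tabulate (does ∘ P?) v) (dec-true (P? v) pv))

  range? : ∀ {m n} (f : Fin m → Fin n) → Decidable (Range f)
  range? f v = Fin.any? λ x → v Fin.≟ f x

  module Pattern (B k₀ k₁ K : ℕ) where

    Node : Set
    Node = Fin (4 + B) ⊎ Fin k₀ ⊎ Fin k₁ ⊎ Fin K ⊎ Fin K

    pattern role j = inj₁ j
    pattern lev₀ a = inj₂ (inj₁ a)
    pattern lev₁ a = inj₂ (inj₂ (inj₁ a))
    pattern lev₂ a = inj₂ (inj₂ (inj₂ (inj₁ a)))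
    pattern cut  a = inj₂ (inj₂ (inj₂ (inj₂ a)))

    #nodes : ℕ
    #nodes = (4 + B) + (k₀ + (k₁ + (K + K)))

    nodes : Fin #nodes ↔ Node
    nodes = (↔-id _ ⊎-↔ ((↔-id _ ⊎-↔ ((↔-id _ ⊎-↔ Fin.+↔⊎ {K} {K}) ↔-∘ Fin.+↔⊎ {k₁} {K + K}))
                        ↔-∘ Fin.+↔⊎ {k₀} {k₁ + (K + K)}))
          ↔-∘ Fin.+↔⊎ {4 + B} {k₀ + (k₁ + (K + K))}

    -- Each kind of pair is given in one orientation; the embedding symmetrises. `role j` is the
    -- vertex c of the j-th role, the cuts form half graphs with all three levels, and each level
    -- lists the binary digits of the next.
    link : Node → Node → Bool
    link (role j) (lev₀ _) = does (j Fin.≟ 0F)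
    link (role j) (lev₁ _) = does (j Fin.≟ 1F)
    link (role j) (lev₂ _) = does (j Fin.≟ 2F)
    link (role j) (cut  _) = does (j Fin.≟ 3F)
    link (cut c)  (lev₀ a) = toℕ a ≤ᵇ toℕ c
    link (cut c)  (lev₁ a) = toℕ a ≤ᵇ toℕ c
    link (cut c)  (lev₂ a) = toℕ a ≤ᵇ toℕ c
    link (lev₀ c) (lev₁ a) = bit (toℕ a) (toℕ c)
    link (lev₁ c) (lev₂ a) = bit (toℕ a) (toℕ c)
    link _        _        = false

    -- The dominators are not nodes of the pattern: only their adjacency to it is prescribed, which
    -- leaves the freedom needed to make them dominate the rest of the graph.
    dominatorLink : Fin B → Fin K → Node → Bool
    dominatorLink b u (role j) = does (j Fin.≟ w# b)
    dominatorLink b u (lev₂ x) = does (u Fin.≟ x)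
    dominatorLink b u _        = false

  other : ∀ {m} → 2 ≤ m → (x : Fin m) → ∃ λ y → y ≢ x
  other {suc (suc m)} _ zero    = suc zero , λ ()
  other {suc (suc m)} _ (suc x) = zero , λ ()
  other {suc zero} (s≤s ())

  module Construct {n s B i k₁ K a′ t : ℕ} (k₁≡ : k₁ ≡ 2 ^ i) (K≡ : K ≡ 2 ^ k₁) (i≤K : i ≤ K) (k₁≤K : k₁ ≤ K)
    (B≥2 : 2 ≤ B) (K≥2 : 2 ≤ K) (a′>0 : 0 < a′) (n≤2^t : n ≤ 2 ^ t) (n<aᴷ : n < suc a′ ^ K) (enough : suc a′ * suc t ≤ B * K)
    {h : ℕ} (nodes : Fin h ↔ Pattern.Node B i k₁ K) (h+K≤s : h + K ≤ s) (G : Graph n) (ext : Extensible s G) where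

    open Pattern B i k₁ K hiding (nodes)

    a : ℕ
    a = suc a′

    K≤s : K ≤ s
    K≤s = ≤-trans (m≤n+m K h) h+K≤s

    node : Fin h → Node
    node = Inverse.to nodes

    index : Node → Fin h
    index = Inverse.from nodes

    node-index : ∀ l → node (index l) ≡ l
    node-index = Inverse.strictlyInverseˡ nodes

    embedding = embed {G = G} ext (λ x y → link (node x) (node y) ∨ link (node y) (node x))
                      (λ x y → Bool.∨-comm (link (node x) (node y)) _)
                      (≤-trans (m≤m+n h K) h+K≤s)

    g : Fin h → Fin n
    g = proj₁ embedding

    g-injective : Injective _≡_ _≡_ g
    g-injective = proj₁ (proj₂ embedding)

    f : Node → Fin n
    f l = g (index l)

    f-injective : ∀ {l l′} → f l ≡ f l′ → l ≡ l′
    f-injective {l} {l′} eq = trans (sym (node-index l)) (trans (cong node (g-injective eq)) (node-index l′))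

    f-adjacent : ∀ l l′ → l ≢ l′ → adjacent G (f l) (f l′) ≡ link l l′ ∨ link l′ l
    f-adjacent l l′ l≢l′ = trans (proj₂ (proj₂ embedding) (index l) (index l′) (l≢l′ ∘ λ eq →
        trans (sym (node-index l)) (trans (cong node eq) (node-index l′))))
      (cong₂ (λ x y → link x y ∨ link y x) (node-index l) (node-index l′))

    target : Fin (B * K) → Fin h → Bool
    target j = let b , u = remQuot {B} K j in dominatorLink b u ∘ node

    -- Adjacency to the pattern is already prescribed for the dominators, so the sweep concerns the
    -- other vertices only; those of the pattern are treated by `miss`.
    outer : List (Fin n)
    outer = filter (¬? ∘ range? g) (allFin n)

    outer-avoids : ∀ j → Avoids G (assignment g (target j)) outer
    outer-avoids j x∈ x∈spec with y , eq ← ∈-tabulate⁻ {f = λ x → g x , target j x} x∈spec =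
      proj₂ (∈-filter⁻ (¬? ∘ range? g) {xs = allFin n} x∈) (y , cong proj₁ eq)

    swept : ∃₂ λ (w : Fin (B * K) → Fin n) P′ →
      (∀ j → Realises G (assignment g (target j)) (w j)) ×
      (∀ {x} → x ∈ outer → x ∈ P′ ⊎ ∃ λ j → adjacent G x (w j) ≡ false) ×
      a ^ (B * K) * length P′ ≤ a′ ^ (B * K) * length outer
    swept = Kill.sweep G ext a K n<aᴷ refl (B * K) (λ j → assignment g (target j))
      (λ j → assignment-functional {β = target j} g-injective)
      (λ j → ≤-trans (≤-reflexive (cong (_+ K) (length-tabulate (λ x → g x , target j x)))) h+K≤s)
      outer outer-avoids

    w : Fin B → Fin K → Fin n
    w b u = proj₁ swept (combine b u)

    survivors : List (Fin n)
    survivors = proj₁ (proj₂ swept)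

    -- The sweep affords `suc t` halvings against at most `2 ^ t` vertices; the spare halving makes
    -- the contradiction strict.
    no-survivors : ∀ {v} → ¬ v ∈ survivors
    no-survivors {v} v∈ = <-irrefl refl (begin-strict
      A * 2 ^ t                 <⟨ m<m+n (A * 2 ^ t) (*-mono-≤ (m^n>0 a′ {{ℕ.>-nonZero a′>0}} N) (m^n>0 2 t)) ⟩
      A * 2 ^ t + A * 2 ^ t     ≡⟨ lemma A (2 ^ t) ⟩
      2 ^ suc t * A             ≤⟨ 2^t*b^N≤a^N a′ (suc t) N enough ⟩
      a ^ N                     ≡⟨ *-identityʳ (a ^ N) ⟨
      a ^ N * 1                 ≤⟨ *-monoʳ-≤ (a ^ N) (nonempty v∈) ⟩
      a ^ N * length survivors  ≤⟨ proj₂ (proj₂ (proj₂ (proj₂ swept))) ⟩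
      A * length outer          ≤⟨ *-monoʳ-≤ A (≤-trans (length-filter (¬? ∘ range? g) (allFin n))
                                                        (≤-trans (≤-reflexive (length-tabulate {n = n} id)) n≤2^t)) ⟩
      A * 2 ^ t                 ∎)
      where
      open ≤-Reasoning
      N = B * K
      A = a′ ^ N
      lemma : ∀ x y → x * y + x * y ≡ 2 * y * x
      lemma = solve-∀
      nonempty : ∀ {v xs} → v ∈ xs → 1 ≤ length xs
      nonempty (here _)  = s≤s z≤n
      nonempty (there _) = s≤s z≤n

    w-adjacent : ∀ b u l → adjacent G (f l) (w b u) ≡ dominatorLink b u l
    w-adjacent b u l = trans
      (proj₂ (assignment-realised G g (target (combine b u)) (proj₁ (proj₂ (proj₂ swept)) (combine b u)) (index l)))
      (cong₂ (λ (b , u) → dominatorLink b u) (Fin.remQuot-combine b u) (node-index l))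

    0ᴮ : Fin B
    0ᴮ = fromℕ< (≤-trans (s≤s z≤n) B≥2)
    0ᴷ : Fin K
    0ᴷ = fromℕ< (≤-trans (s≤s z≤n) K≥2)

    -- A role vertex is adjacent to the dominators of at most one set, and a vertex of the top level
    -- to only one in each set. Hence two sets, and two dominators in each, are enough.
    miss : ∀ l → ∃₂ λ b u → dominatorLink b u l ≡ false
    miss (role 0F) = 0ᴮ , 0ᴷ , refl
    miss (role 1F) = 0ᴮ , 0ᴷ , refl
    miss (role 2F) = 0ᴮ , 0ᴷ , refl
    miss (role 3F) = 0ᴮ , 0ᴷ , refl
    miss (role (suc (suc (suc (suc b))))) with other B≥2 b
    ... | b′ , b′≢b = b′ , 0ᴷ , dec-false (w# b Fin.≟ w# b′) (λ where refl → b′≢b refl)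
    miss (lev₀ _) = 0ᴮ , 0ᴷ , refl
    miss (lev₁ _) = 0ᴮ , 0ᴷ , refl
    miss (lev₂ x) with other K≥2 x
    ... | u , u≢x = 0ᴮ , u , dec-false (u Fin.≟ x) u≢x
    miss (cut _)  = 0ᴮ , 0ᴷ , refl

    unadjacent : ∀ v → ∃₂ λ b u → adjacent G (w b u) v ≡ false
    unadjacent v with range? g v
    ... | no  v∉g with proj₁ (proj₂ (proj₂ (proj₂ swept))) (∈-filter⁺ (¬? ∘ range? g) (∈-allFin v) v∉g)
    ...   | inj₁ v∈survivors = ⊥-elim (no-survivors v∈survivors)
    ...   | inj₂ (j , v≁w) = let b , u = remQuot K j in b , u ,
      trans (adjacent-sym G (w b u) v) (trans (cong (λ j → adjacent G v (proj₁ swept j)) (Fin.combine-remQuot {B} K j)) v≁w)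
    unadjacent v | yes (x , refl) with b , u , eq ← miss (node x) = b , u ,
      trans (adjacent-sym G (w b u) (g x))
        (trans (cong (λ y → adjacent G (g y) (w b u)) (sym (Inverse.strictlyInverseʳ nodes x)))
               (trans (w-adjacent b u (node x)) eq))

    q₀ : Fin i → Fin n
    q₀ a = f (lev₀ a)

    q₁ : Fin k₁ → Fin n
    q₁ a = f (lev₁ a)

    q₂ cuts : Fin K → Fin n
    q₂ a   = f (lev₂ a)
    cuts a = f (cut a)

    -- This becomes the single set of `φ₂`. Within it the neighbourhood of `role j` is exactly the
    -- j-th role, which also serves as the j-th set of `φ₁`.
    Coloured : Fin n → Set
    Coloured v = Range q₀ v ⊎ Range q₁ v ⊎ Range q₂ v ⊎ Range cuts v ⊎ ∃ λ b → Range (w b) v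

    coloured? : Decidable Coloured
    coloured? v = range? q₀ v ⊎-dec range? q₁ v ⊎-dec range? q₂ v ⊎-dec range? cuts v ⊎-dec
                  Fin.any? λ b → range? (w b) v

    Role : Fin (4 + B) → Fin n → Set
    Role j v = Coloured v × adjacent G (f (role j)) v ≡ true

    role-≡ : ∀ j l → (∀ {j} → l ≢ role j) → adjacent G (f (role j)) (f l) ≡ true → link (role j) l ∨ link l (role j) ≡ true
    role-≡ j l l≢role = trans (sym (f-adjacent (role j) l (l≢role ∘ sym)))

    role⇒₀ : ∀ v → Role 0F v ⇔ Range q₀ v
    role⇒₀ v = mk⇔ ⇒ λ where (a , refl) → inj₁ (a , refl) , f-adjacent (role 0F) (lev₀ a) (λ ())
      where
      ⇒ : Role 0F v → Range q₀ v
      ⇒ (inj₁ r , _) = r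
      ⇒ (inj₂ (inj₁ (a , refl)) , e) = absurd (role-≡ 0F (lev₁ a) (λ ()) e)
      ⇒ (inj₂ (inj₂ (inj₁ (a , refl))) , e) = absurd (role-≡ 0F (lev₂ a) (λ ()) e)
      ⇒ (inj₂ (inj₂ (inj₂ (inj₁ (a , refl)))) , e) = absurd (role-≡ 0F (cut a) (λ ()) e)
      ⇒ (inj₂ (inj₂ (inj₂ (inj₂ (b , u , refl)))) , e) = absurd (trans (sym (w-adjacent b u (role 0F))) e)

    role⇒₁ : ∀ v → Role 1F v ⇔ Range q₁ v
    role⇒₁ v = mk⇔ ⇒ λ where (a , refl) → inj₂ (inj₁ (a , refl)) , f-adjacent (role 1F) (lev₁ a) (λ ())
      where
      ⇒ : Role 1F v → Range q₁ v
      ⇒ (inj₁ (a , refl) , e) = absurd (role-≡ 1F (lev₀ a) (λ ()) e)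
      ⇒ (inj₂ (inj₁ r) , _) = r
      ⇒ (inj₂ (inj₂ (inj₁ (a , refl))) , e) = absurd (role-≡ 1F (lev₂ a) (λ ()) e)
      ⇒ (inj₂ (inj₂ (inj₂ (inj₁ (a , refl)))) , e) = absurd (role-≡ 1F (cut a) (λ ()) e)
      ⇒ (inj₂ (inj₂ (inj₂ (inj₂ (b , u , refl)))) , e) = absurd (trans (sym (w-adjacent b u (role 1F))) e)

    role⇒₂ : ∀ v → Role 2F v ⇔ Range q₂ v
    role⇒₂ v = mk⇔ ⇒ λ where (a , refl) → inj₂ (inj₂ (inj₁ (a , refl))) , f-adjacent (role 2F) (lev₂ a) (λ ())
      where
      ⇒ : Role 2F v → Range q₂ v
      ⇒ (inj₁ (a , refl) , e) = absurd (role-≡ 2F (lev₀ a) (λ ()) e)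
      ⇒ (inj₂ (inj₁ (a , refl)) , e) = absurd (role-≡ 2F (lev₁ a) (λ ()) e)
      ⇒ (inj₂ (inj₂ (inj₁ r)) , _) = r
      ⇒ (inj₂ (inj₂ (inj₂ (inj₁ (a , refl)))) , e) = absurd (role-≡ 2F (cut a) (λ ()) e)
      ⇒ (inj₂ (inj₂ (inj₂ (inj₂ (b , u , refl)))) , e) = absurd (trans (sym (w-adjacent b u (role 2F))) e)

    role⇒₃ : ∀ v → Role 3F v ⇔ Range cuts v
    role⇒₃ v = mk⇔ ⇒ λ where (a , refl) → inj₂ (inj₂ (inj₂ (inj₁ (a , refl)))) , f-adjacent (role 3F) (cut a) (λ ())
      where
      ⇒ : Role 3F v → Range cuts v
      ⇒ (inj₁ (a , refl) , e) = absurd (role-≡ 3F (lev₀ a) (λ ()) e)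
      ⇒ (inj₂ (inj₁ (a , refl)) , e) = absurd (role-≡ 3F (lev₁ a) (λ ()) e)
      ⇒ (inj₂ (inj₂ (inj₁ (a , refl))) , e) = absurd (role-≡ 3F (lev₂ a) (λ ()) e)
      ⇒ (inj₂ (inj₂ (inj₂ (inj₁ r))) , _) = r
      ⇒ (inj₂ (inj₂ (inj₂ (inj₂ (b , u , refl)))) , e) = absurd (trans (sym (w-adjacent b u (role 3F))) e)

    role⇒w : ∀ b v → Role (w# b) v ⇔ Range (w b) v
    role⇒w b v = mk⇔ ⇒ λ where
        (u , refl) → inj₂ (inj₂ (inj₂ (inj₂ (b , u , refl)))) ,
          trans (w-adjacent b u (role (w# b))) (dec-true (w# b Fin.≟ w# b) refl)
      where
      ⇒ : Role (w# b) v → Range (w b) v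
      ⇒ (inj₁ (a , refl) , e) = absurd (role-≡ (w# b) (lev₀ a) (λ ()) e)
      ⇒ (inj₂ (inj₁ (a , refl)) , e) = absurd (role-≡ (w# b) (lev₁ a) (λ ()) e)
      ⇒ (inj₂ (inj₂ (inj₁ (a , refl))) , e) = absurd (role-≡ (w# b) (lev₂ a) (λ ()) e)
      ⇒ (inj₂ (inj₂ (inj₂ (inj₁ (a , refl)))) , e) = absurd (role-≡ (w# b) (cut a) (λ ()) e)
      ⇒ (inj₂ (inj₂ (inj₂ (inj₂ (b′ , u , refl)))) , e)
        with refl ← does-true (w# b Fin.≟ w# b′) (trans (sym (w-adjacent b′ u (role (w# b)))) e) = u , refl

    -- Stated up to equivalence of the roles, so that both encodings share it.
    tower-exists : ∀ (R : Fin (4 + B) → Fin n → Set) → (∀ j v → R j v ⇔ Role j v) → Tower G R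
    tower-exists R R⇔ =
        L₀.level-ordered , L₁.level-ordered , L₂.level-ordered
      , P₀.level-shattered , P₀.level-separated
      , P₁.level-shattered , P₁.level-separated
      , L₂.shatters-all {s} ext K≤s (inj₂-injective ∘ f-injective) (q₂ (fromℕ< (≤-trans (s≤s z≤n) K≥2)))
      , Dom.all-injected , Dom.undominated
      where
      infixr 5 _⨟_
      _⨟_ : ∀ {A B C : Set} → A ⇔ B → B ⇔ C → A ⇔ C
      p ⨟ q = mk⇔ (to q ∘ to p) (from p ∘ from q)
      inj₂-injective : ∀ {a b} → _≡_ {A = Node} (lev₂ a) (lev₂ b) → a ≡ b
      inj₂-injective refl = refl
      open Verify G R cuts (λ v → R⇔ 3F v ⨟ role⇒₃ v)
      half : ∀ c l → l ≢ cut c → link l (cut c) ≡ false → adjacent G (cuts c) (f l) ≡ link (cut c) l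
      half c l l≢ eq = trans (f-adjacent (cut c) l (l≢ ∘ sym))
                             (trans (cong (link (cut c) l ∨_) eq) (Bool.∨-identityʳ _))
      module L₀ = Level i≤K q₀ (λ c a → half c (lev₀ a) (λ ()) refl) (R 0F) (λ v → R⇔ 0F v ⨟ role⇒₀ v)
      module L₁ = Level k₁≤K q₁ (λ c a → half c (lev₁ a) (λ ()) refl) (R 1F) (λ v → R⇔ 1F v ⨟ role⇒₁ v)
      module L₂ = Level ≤-refl q₂ (λ c a → half c (lev₂ a) (λ ()) refl) (R 2F) (λ v → R⇔ 2F v ⨟ role⇒₂ v)
      module P₀ = L₀.Power k₁≡ q₁ (λ a c → trans (f-adjacent (lev₀ c) (lev₁ a) (λ ())) (Bool.∨-identityʳ _))
                              (R 1F) (λ v → R⇔ 1F v ⨟ role⇒₁ v)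
      module P₁ = L₁.Power K≡ q₂ (λ a c → trans (f-adjacent (lev₁ c) (lev₂ a) (λ ())) (Bool.∨-identityʳ _))
                              (R 2F) (λ v → R⇔ 2F v ⨟ role⇒₂ v)
      module Dom = Dominators q₂ w (λ v → R⇔ 2F v ⨟ role⇒₂ v) (λ b v → R⇔ (w# b) v ⨟ role⇒w b v)
        (λ b u x → trans (adjacent-sym G (w b u) (q₂ x)) (w-adjacent b u (lev₂ x))) unadjacent

    role? : ∀ j v → Dec (Role j v)
    role? j v = coloured? v ×-dec (adjacent G (f (role j)) v Bool.≟ true)

    φ₁-holds : G ⊨ sentence (φ₁ {B})
    φ₁-holds = sentence-complete G φ₁ Xs (λ _ → f (role 0F)) (tower-exists (λ j v → v ∈ₛ Vec.lookup Xs j) λ j v →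
      subst (λ S → v ∈ₛ S ⇔ Role j v) (sym (lookup∘tabulate (λ j → subset (role? j)) j)) (∈-subset (role? j) v))
      where
      Xs : Vec (Subset n) (4 + B)
      Xs = Vec.tabulate λ j → subset (role? j)

    φ₂-holds : G ⊨ sentence (φ₂ {B})
    φ₂-holds = sentence-complete G φ₂ (subset coloured? Vec.∷ Vec.[]) ρ
      (tower-exists (λ j v → v ∈ₛ subset coloured? × adjacent G (f (role j)) v ≡ true) λ j v →
        mk⇔ (λ (v∈ , c~v) → to (∈-subset coloured? v) v∈ , c~v)
            (λ (col , c~v) → from (∈-subset coloured? v) col , c~v))
      where
      ρ : Fin (3 + (4 + B)) → Fin n
      ρ (suc (suc (suc j))) = f (role j)
      -- Any vertex would do here: `tower` requantifies the first three variables.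
      ρ _                   = f (role 0F)

-- Choice of constants and divergence

module Divergence where

  open import Data.Bool.Base using (Bool; true)
  import Data.Bool.Properties as Bool
  open import Data.Empty using (⊥-elim)
  open import Data.Fin.Base using (Fin; suc)
  open import Data.Fin.Patterns using (0F)
  open import Data.Fin.Subset using () renaming (_∈_ to _∈ₛ_)
  open import Data.Fin.Subset.Properties using (_∈?_)
  open import Data.Integer.Base as ℤ using (ℤ; +_; +[1+_])
  import Data.Integer.Properties as ℤ
  import Data.Integer.Tactic.RingSolver as ℤ-Solver
  open import Data.Nat.Base as ℕ using (ℕ; zero; suc; s≤s; z≤n)
  import Data.Nat.Properties as ℕ
  open import Data.Nat.Tactic.RingSolver using (solve-∀)
  open import Data.Product using (∃; _×_; _,_; proj₁; proj₂)
  open import Data.Rational.Base as ℚ using (ℚ; 0ℚ; 1ℚ; ½; _+_; _*_; _-_; -_; _≤_; mkℚ; toℚᵘ)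
  open import Data.Rational.Properties
  open import Data.Rational.Solver using (module +-*-Solver)
  open import Data.Rational.Unnormalised.Base as ℚᵘ using (mkℚᵘ; *≡*; *≤*; _≃_)
  import Data.Rational.Unnormalised.Properties as ℚᵘ
  open import Data.Sum using (inj₁; inj₂)
  open import Data.Vec.Base using (lookup)
  open import Relation.Binary.PropositionalEquality hiding ([_])
  open import Relation.Nullary using (¬_; Dec)
  open import Relation.Nullary.Decidable using (_×-dec_)
  open import Defs using (Graph; adjacent; ℝ; seq; fromℚ; 0ℝ; 1ℝ; Converges; EMSO; _⊨_; _⊨?_; ℙ[G⟨_,_⟩⊨_])
  import Defs
  open Rationals
  open RandomGraphs
  open Extensibility
  open Formulas
  open TowerSentence
  open TowerSize
  open TowerExistence

  ⅛ : ℚ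
  ⅛ = ¼ * ½

  0<⅛ : 0ℚ ℚ.< ⅛
  0<⅛ = positive⁻¹ ⅛

  -- The Archimedean property: denominator times fraction is the numerator, a positive integer.
  denominator-·-≥1 : ∀ δ → ℚ.Positive δ → 1ℚ ≤ ℚ.denominatorℕ δ · δ
  denominator-·-≥1 δ@(mkℚ +[1+ k ] d-1 c) _ =
    toℚᵘ-cancel-≤ (ℚᵘ.≤-respʳ-≃ (ℚᵘ.≃-sym (scale (suc d-1))) (*≤* bound))
    where
    D = +[1+ d-1 ]
    N = +[1+ k ]
    lemma : ∀ N D m → (N ℤ.* D ℤ.+ m ℤ.* N ℤ.* D) ℤ.* D ≡ ((+ 1 ℤ.+ m) ℤ.* N) ℤ.* (D ℤ.* D)
    lemma = ℤ-Solver.solve-∀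
    scale : ∀ m → toℚᵘ (m · δ) ≃ mkℚᵘ (+ m ℤ.* N) d-1
    scale zero    = *≡* refl
    scale (suc m) = ℚᵘ.≃-trans (toℚᵘ-homo-+ δ (m · δ))
      (ℚᵘ.≃-trans (ℚᵘ.+-congʳ (toℚᵘ δ) (scale m)) (*≡* (lemma N D (+ m))))
    bound : + 1 ℤ.* D ℤ.≤ D ℤ.* N ℤ.* + 1
    bound = subst₂ ℤ._≤_ (sym (ℤ.*-identityˡ D)) (sym (ℤ.*-identityʳ (D ℤ.* N)))
      (ℤ.≤-trans (ℤ.≤-reflexive (sym (ℤ.*-identityʳ D))) (ℤ.*-monoˡ-≤-nonNeg D (ℤ.+≤+ (s≤s z≤n))))

  ½^-below : ∀ {δ} → 0ℚ ℚ.< δ → ∃ λ d → ½ ^ d ≤ δ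
  ½^-below {δ} 0<δ = m , (begin
    ½ ^ m                     ≡⟨ *-identityˡ (½ ^ m) ⟨
    1ℚ * ½ ^ m                ≤⟨ *-monoʳ-≤-nonNeg (½ ^ m) {{ℚ.nonNegative (0≤^ m 0≤½)}} large ⟩
    (2 ℕ.^ m) · δ * ½ ^ m     ≡⟨ ·-*-assoc (2 ℕ.^ m) δ (½ ^ m) ⟨
    (2 ℕ.^ m) · (δ * ½ ^ m)   ≡⟨ cong ((2 ℕ.^ m) ·_) (*-comm δ (½ ^ m)) ⟩
    (2 ℕ.^ m) · (½ ^ m * δ)   ≡⟨ ·-*-assoc (2 ℕ.^ m) (½ ^ m) δ ⟩
    (2 ℕ.^ m) · (½ ^ m) * δ   ≡⟨ cong (_* δ) (2^n·½^n m) ⟩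
    1ℚ * δ                    ≡⟨ *-identityˡ δ ⟩
    δ                         ∎)
    where
    open ≤-Reasoning
    m = ℚ.denominatorℕ δ
    large : 1ℚ ≤ (2 ℕ.^ m) · δ
    large = ≤-trans (denominator-·-≥1 δ (ℚ.positive 0<δ)) (·-mono (<⇒≤ 0<δ) (ℕ.<⇒≤ (D<2^D m)))

  p≤∣p∣ : ∀ p → p ≤ ℚ.∣ p ∣
  p≤∣p∣ p with ∣p∣≡p∨∣p∣≡-p p
  ... | inj₁ eq = ≤-reflexive (sym eq)
  ... | inj₂ eq with ≤-total 0ℚ p
  ...   | inj₁ 0≤p = ≤-reflexive (sym (0≤p⇒∣p∣≡p 0≤p))
  ...   | inj₂ p≤0 = ≤-trans p≤0 (0≤∣p∣ p)

  Eventually : (ℕ → Set) → Set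
  Eventually P = ∃ λ M → ∀ i → M ℕ.≤ i → P i

  -- A limit would be within ⅛ of a value at least ¾ and of a value at most ¼. All four estimates
  -- are compared at one index beyond their thresholds.
  oscillation⇒¬converges : (a : ℕ → ℝ) →
    (∀ N → ∃ λ n → N ℕ.≤ n × Eventually λ i → 1ℚ ≤ seq (a n) i + ¼) →
    (∀ N → ∃ λ n → N ℕ.≤ n × Eventually λ i → seq (a n) i ≤ ¼) → ¬ Converges a
  oscillation⇒¬converges a high low (L , a⟶L)
    with N , close ← a⟶L (fromℚ ⅛) (⅛ , 0<⅛ , 0 , λ _ _ → ≤-reflexive (+-identityˡ ⅛))
    with m , N≤m , M₁ , above ← high N | n , N≤n , M₂ , below ← low N
    with δ₁ , 0<δ₁ , M₃ , close₁ ← close m N≤m | δ₂ , 0<δ₂ , M₄ , close₂ ← close n N≤n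
    = ⊥-elim (<-irrefl refl (begin-strict
      1ℚ                          ≤⟨ above i (ℕ.≤-trans (ℕ.m≤m⊔n M₁ M₂) (ℕ.m≤m⊔n _ (M₃ ℕ.⊔ M₄))) ⟩
      u + ¼                       ≡⟨ split u v l ⟩
      (u - l) + - (v - l) + v + ¼
        ≤⟨ +-monoˡ-≤ ¼ (+-mono-≤ (+-mono-≤ near₁ near₂) (below i (ℕ.≤-trans (ℕ.m≤n⊔m M₁ M₂) (ℕ.m≤m⊔n _ (M₃ ℕ.⊔ M₄))))) ⟩
      ⅛ + ⅛ + ¼ + ¼               <⟨ ¾<1 ⟩
      1ℚ                          ∎))
    where
    open ≤-Reasoning
    open +-*-Solver
    i = (M₁ ℕ.⊔ M₂) ℕ.⊔ (M₃ ℕ.⊔ M₄)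
    u = seq (a m) i
    v = seq (a n) i
    l = seq L i
    ¾<1 : ⅛ + ⅛ + ¼ + ¼ ℚ.< 1ℚ
    ¾<1 = ℚ.*<* (ℤ.+<+ (ℕ.<ᵇ⇒< _ _ _))
    weaken : ∀ {x δ} → 0ℚ ℚ.< δ → x + δ ≤ ⅛ → x ≤ ⅛
    weaken {x} 0<δ x+δ≤ = ≤-trans (≤-trans (≤-reflexive (sym (+-identityʳ x))) (+-monoʳ-≤ x (<⇒≤ 0<δ))) x+δ≤
    near₁ : u - l ≤ ⅛
    near₁ = ≤-trans (p≤∣p∣ (u - l)) (weaken 0<δ₁ (close₁ i (ℕ.≤-trans (ℕ.m≤m⊔n M₃ M₄) (ℕ.m≤n⊔m (M₁ ℕ.⊔ M₂) _))))
    near₂ : - (v - l) ≤ ⅛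
    near₂ = ≤-trans (≤-trans (p≤∣p∣ (- (v - l))) (≤-reflexive (∣-p∣≡∣p∣ (v - l))))
      (weaken 0<δ₂ (close₂ i (ℕ.≤-trans (ℕ.m≤n⊔m M₃ M₄) (ℕ.m≤n⊔m (M₁ ℕ.⊔ M₂) _))))
    split : ∀ u v l → u + ¼ ≡ (u - l) + - (v - l) + v + ¼
    split = solve 3 (λ u v l → u :+ con ¼ := (u :- l) :+ :- (v :- l) :+ v :+ con ¼) refl

  infix 9 2^2^_
  2^2^_ : ℕ → ℕ
  2^2^ i = 2 ℕ.^ (2 ℕ.^ i)

  i≤2^2^i : ∀ i → i ℕ.≤ 2^2^ i
  i≤2^2^i i = ℕ.≤-trans (ℕ.<⇒≤ (D<2^D i)) (ℕ.<⇒≤ (D<2^D (2 ℕ.^ i)))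

  2^2^-suc : ∀ i → 2^2^ suc i ≡ 2^2^ i ℕ.* 2^2^ i
  2^2^-suc i = trans (cong (2 ℕ.^_) (cong (2 ℕ.^ i ℕ.+_) (ℕ.+-identityʳ (2 ℕ.^ i)))) (ℕ.^-distribˡ-+-* 2 (2 ℕ.^ i) (2 ℕ.^ i))

  2^2^-mono : ∀ {i j} → i ℕ.≤ j → 2^2^ i ℕ.≤ 2^2^ j
  2^2^-mono i≤j = ℕ.^-monoʳ-≤ 2 (ℕ.^-monoʳ-≤ 2 i≤j)

  -- Passing from `j` to `suc j` squares the number, and one of the two factors absorbs `2 d B`.
  2^2^-gap : ∀ d B {i j} → d ℕ.* B ℕ.+ d ℕ.* B ℕ.< 2^2^ j → j ℕ.< i →
           d ℕ.* (B ℕ.* 2^2^ j) ℕ.+ d ℕ.* (B ℕ.* 2^2^ j) ℕ.< 2^2^ i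
  2^2^-gap d B {i} {j} 2dB<K j<i = begin-strict
    d ℕ.* (B ℕ.* 2^2^ j) ℕ.+ d ℕ.* (B ℕ.* 2^2^ j)  ≡⟨ lemma d B (2^2^ j) ⟩
    (d ℕ.* B ℕ.+ d ℕ.* B) ℕ.* 2^2^ j             <⟨ ℕ.*-monoˡ-< (2^2^ j) {{ℕ.m^n≢0 2 (2 ℕ.^ j)}} 2dB<K ⟩
    2^2^ j ℕ.* 2^2^ j                              ≡⟨ 2^2^-suc j ⟨
    2^2^ suc j                                   ≤⟨ 2^2^-mono j<i ⟩
    2^2^ i                                       ∎
    where
    open ℕ.≤-Reasoning
    lemma : ∀ d B K → d ℕ.* (B ℕ.* K) ℕ.+ d ℕ.* (B ℕ.* K) ≡ (d ℕ.* B ℕ.+ d ℕ.* B) ℕ.* K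
    lemma = solve-∀

  -- With `t = 16 d K` and `n = 2 ^ t`, the choice of `e` gives `t < e K`, hence `n < a ^ K` for
  -- `a = 2 ^ e`, so greedy covers have at most `K` vertices. `B = a e` then provides the
  -- `a (t + 1)` rounds that leave no survivor.
  module Main {d e a′ B : ℕ} (d≥1 : 1 ℕ.≤ d) (e≡ : e ≡ suc (16 ℕ.* d)) (a≡ : suc a′ ≡ 2 ℕ.^ e) (B≡ : B ≡ suc a′ ℕ.* e) where

    e≥1 : 1 ℕ.≤ e
    e≥1 = subst (1 ℕ.≤_) (sym e≡) (s≤s z≤n)

    a≥2 : 2 ℕ.≤ suc a′
    a≥2 = ℕ.≤-trans (ℕ.^-monoʳ-≤ 2 e≥1) (ℕ.≤-reflexive (sym a≡))

    B≥2 : 2 ℕ.≤ B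
    B≥2 = ℕ.≤-trans (ℕ.*-mono-≤ a≥2 e≥1) (ℕ.≤-reflexive (sym B≡))

    s≤ds : ∀ s → s ℕ.≤ d ℕ.* s
    s≤ds s = ℕ.m≤n*m s d {{ℕ.>-nonZero d≥1}}

    order : ℕ → ℕ
    order s = 2 ℕ.^ (d ℕ.* s ℕ.+ d ℕ.* s)

    s≤order : ∀ s → s ℕ.≤ order s
    s≤order s = ℕ.≤-trans (s≤ds s) (ℕ.≤-trans (ℕ.m≤m+n (d ℕ.* s) _) (ℕ.<⇒≤ (D<2^D _)))

    module _ (i : ℕ) (4+B≤K : 4 ℕ.+ B ℕ.≤ 2^2^ i) (G : Graph (order (8 ℕ.* 2^2^ i))) (ext : Extensible (8 ℕ.* 2^2^ i) G) where

      private
        K = 2^2^ i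
        t = d ℕ.* (8 ℕ.* K) ℕ.+ d ℕ.* (8 ℕ.* K)

        t<eK : t ℕ.< e ℕ.* K
        t<eK = ℕ.≤-trans (ℕ.+-monoˡ-≤ t (ℕ.m^n>0 2 (2 ℕ.^ i)))
          (ℕ.≤-reflexive (trans (lemma d K) (cong (ℕ._* K) (sym e≡))))
          where
          lemma : ∀ d K → K ℕ.+ (d ℕ.* (8 ℕ.* K) ℕ.+ d ℕ.* (8 ℕ.* K)) ≡ suc (16 ℕ.* d) ℕ.* K
          lemma = solve-∀

        n<aᴷ : 2 ℕ.^ t ℕ.< suc a′ ℕ.^ K
        n<aᴷ = ℕ.<-≤-trans (ℕ.^-monoʳ-< 2 (s≤s (s≤s z≤n)) t<eK)
          (ℕ.≤-reflexive (trans (sym (ℕ.^-*-assoc 2 e K)) (cong (ℕ._^ K) (sym a≡))))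

        enough : suc a′ ℕ.* suc t ℕ.≤ B ℕ.* K
        enough = ℕ.≤-trans (ℕ.*-monoʳ-≤ (suc a′) t<eK)
          (ℕ.≤-reflexive (trans (sym (ℕ.*-assoc (suc a′) e K)) (cong (ℕ._* K) (sym B≡))))

        -- The five parts of the pattern and the reserve for greedy covers are each at most `K`, so
        -- `6 K` would already do.
        fits : Pattern.#nodes B i (2 ℕ.^ i) K ℕ.+ K ℕ.≤ 8 ℕ.* K
        fits = ℕ.≤-trans
          (ℕ.+-monoˡ-≤ K (ℕ.+-mono-≤ 4+B≤K (ℕ.+-mono-≤ (i≤2^2^i i) (ℕ.+-monoˡ-≤ (K ℕ.+ K) (ℕ.<⇒≤ (D<2^D (2 ℕ.^ i)))))))
          (ℕ.≤-trans (ℕ.m≤m+n _ (2 ℕ.* K)) (ℕ.≤-reflexive (lemma K)))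
          where
          lemma : ∀ K → (K ℕ.+ (K ℕ.+ (K ℕ.+ (K ℕ.+ K)))) ℕ.+ K ℕ.+ 2 ℕ.* K ≡ 8 ℕ.* K
          lemma = solve-∀

        module C = Construct {B = B} {i = i} {t = t} refl refl (i≤2^2^i i) (ℕ.<⇒≤ (D<2^D (2 ℕ.^ i))) B≥2
          (ℕ.^-monoʳ-≤ 2 (ℕ.m^n>0 2 i))
          (ℕ.s≤s⁻¹ a≥2)
          ℕ.≤-refl n<aᴷ enough (Pattern.nodes B i (2 ℕ.^ i) K) fits G ext

      φ₁-holds : G ⊨ sentence (φ₁ {B})
      φ₁-holds = C.φ₁-holds

      φ₂-holds : G ⊨ sentence (φ₂ {B})
      φ₂-holds = C.φ₂-holds

    module _ (j : ℕ) (2dB<K : d ℕ.* B ℕ.+ d ℕ.* B ℕ.< 2^2^ j)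
             (G : Graph (order (B ℕ.* 2^2^ j))) (ext : Extensible (B ℕ.* 2^2^ j) G) where

      -- Extensibility excludes heights `i ≤ j`; for `i > j` the top level would need `2 ^ 2^2^ i`
      -- vertices, more than there are.
      no-tower : (R : Fin (4 ℕ.+ B) → Fin (order (B ℕ.* 2^2^ j)) → Set) → (∀ j v → Dec (R j v)) → ¬ Tower G R
      no-tower R R? tower =
        let i , 2^Kᵢ≤n , large = Sizes.tower-size G R R? ext tower
            j<i = ℕ.≰⇒> λ i≤j → large (ℕ.*-monoʳ-≤ B (2^2^-mono i≤j))
        in ℕ.<⇒≱ (ℕ.^-monoʳ-< 2 (s≤s (s≤s z≤n)) (2^2^-gap d B {i} {j} 2dB<K j<i)) 2^Kᵢ≤n

      φ₁-fails : ¬ G ⊨ sentence (φ₁ {B})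
      φ₁-fails sat = let Xs , ρ , tower = sentence-sound G (φ₁ {B}) sat in
        no-tower (λ j v → v ∈ₛ lookup Xs j) (λ j v → v ∈? lookup Xs j) tower

      φ₂-fails : ¬ G ⊨ sentence (φ₂ {B})
      φ₂-fails sat = let Xs , ρ , tower = sentence-sound G (φ₂ {B}) sat in
        no-tower (λ j v → v ∈ₛ lookup Xs 0F × adjacent G (ρ (suc (suc (suc j)))) v ≡ true)
                 (λ j v → (v ∈? lookup Xs 0F) ×-dec (adjacent G (ρ (suc (suc (suc j)))) v Bool.≟ true)) tower

    module _ (p : ℝ) (M : ℕ) (inner : ∀ i → M ℕ.≤ i → ½ ^ d ≤ seq p i × ½ ^ d ≤ 1ℚ - seq p i) where

      module _ {m k : ℕ} (φ : EMSO m k)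
        (holds : ∀ i → 4 ℕ.+ B ℕ.≤ 2^2^ i → ∀ (G : Graph (order (8 ℕ.* 2^2^ i))) → Extensible (8 ℕ.* 2^2^ i) G → G ⊨ φ)
        (fails : ∀ j → d ℕ.* B ℕ.+ d ℕ.* B ℕ.< 2^2^ j → ∀ (G : Graph (order (B ℕ.* 2^2^ j))) → Extensible (B ℕ.* 2^2^ j) G → ¬ G ⊨ φ)
        where

        diverges : ¬ Converges (λ n → ℙ[G⟨ n , p ⟩⊨ φ ])
        diverges = oscillation⇒¬converges (λ n → ℙ[G⟨ n , p ⟩⊨ φ ]) high low
          where
          high : ∀ N → ∃ λ n → N ℕ.≤ n × Eventually λ i → 1ℚ ≤ seq ℙ[G⟨ n , p ⟩⊨ φ ] i + ¼
          high N = order s , ℕ.≤-trans (ℕ.m≤m+n N (4 ℕ.+ B)) (ℕ.≤-trans (i≤2^2^i i₀) (ℕ.≤-trans K≤s (s≤order s)))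
            , M , λ i M≤i → subst (λ x → 1ℚ ≤ x + ¼) (sym (seq-ℙ p i (order s) (_⊨? φ)))
              (likely (seq p i) d (proj₁ (inner i M≤i)) (proj₂ (inner i M≤i)) s 8≤D (s≤ds s) (_⊨? φ)
                (holds i₀ (ℕ.≤-trans (ℕ.m≤n+m (4 ℕ.+ B) N) (i≤2^2^i i₀))))
            where
            -- `N` makes the graph large, and `4 + B` keeps the role vertices within `K`.
            i₀ = N ℕ.+ (4 ℕ.+ B)
            s = 8 ℕ.* 2^2^ i₀
            K≤s : 2^2^ i₀ ℕ.≤ s
            K≤s = ℕ.m≤m+n (2^2^ i₀) _
            8≤D : 8 ℕ.≤ d ℕ.* s
            8≤D = ℕ.≤-trans (ℕ.m≤m*n 8 (2^2^ i₀) {{ℕ.m^n≢0 2 (2 ℕ.^ i₀)}}) (s≤ds s)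
          low : ∀ N → ∃ λ n → N ℕ.≤ n × Eventually λ i → seq ℙ[G⟨ n , p ⟩⊨ φ ] i ≤ ¼
          low N = order s , ℕ.≤-trans (ℕ.m≤m+n N _) (ℕ.≤-trans (i≤2^2^i j₀) (ℕ.≤-trans K≤s (s≤order s)))
            , M , λ i M≤i → subst (_≤ ¼) (sym (seq-ℙ p i (order s) (_⊨? φ)))
              (unlikely (seq p i) d (proj₁ (inner i M≤i)) (proj₂ (inner i M≤i)) s
                (ℕ.≤-trans (ℕ.≤-trans (ℕ.≤-trans (ℕ.m≤m+n 8 x) (ℕ.m≤n+m (8 ℕ.+ x) N)) (ℕ.≤-trans (i≤2^2^i j₀) K≤s)) (s≤ds s))
                (s≤ds s) (_⊨? φ)
                (fails j₀ (ℕ.≤-trans (ℕ.≤-trans (s≤s (ℕ.m≤n+m x 7)) (ℕ.m≤n+m (8 ℕ.+ x) N)) (i≤2^2^i j₀))))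
            where
            x = d ℕ.* B ℕ.+ d ℕ.* B
            -- `N` makes the graph large, 8 serves the union bound, and `x` the gap.
            j₀ = N ℕ.+ (8 ℕ.+ x)
            s = B ℕ.* 2^2^ j₀
            K≤s : 2^2^ j₀ ℕ.≤ s
            K≤s = ℕ.m≤n*m (2^2^ j₀) B {{ℕ.>-nonZero (ℕ.≤-trans (s≤s z≤n) B≥2)}}

      sentences-diverge :
        (∃ λ m → ∃ λ (φ₁ : EMSO m 3) → ¬ Converges (λ n → ℙ[G⟨ n , p ⟩⊨ φ₁ ])) ×
        (∃ λ k → ∃ λ (φ₂ : EMSO 1 k) → ¬ Converges (λ n → ℙ[G⟨ n , p ⟩⊨ φ₂ ]))
      sentences-diverge = (_ , sentence (φ₁ {B}) , diverges (sentence (φ₁ {B})) φ₁-holds φ₁-fails)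
                   , (_ , sentence (φ₂ {B}) , diverges (sentence (φ₂ {B})) φ₂-holds φ₂-fails)

  ½^-anti : ∀ {m n} → m ℕ.≤ n → ½ ^ n ≤ ½ ^ m
  ½^-anti = ^-anti 0≤½ ½≤1

  both-diverge : (p : ℝ) → 0ℝ Defs.< p → p Defs.< 1ℝ →
      (∃ λ m → ∃ λ (φ₁ : EMSO m 3) → ¬ Converges (λ n → ℙ[G⟨ n , p ⟩⊨ φ₁ ])) ×
      (∃ λ k → ∃ λ (φ₂ : EMSO 1 k) → ¬ Converges (λ n → ℙ[G⟨ n , p ⟩⊨ φ₂ ]))
  both-diverge p (δ₁ , 0<δ₁ , M₁ , above) (δ₂ , 0<δ₂ , M₂ , below)
    with d₁ , ½^d₁≤δ₁ ← ½^-below 0<δ₁ | d₂ , ½^d₂≤δ₂ ← ½^-below 0<δ₂ =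
      Main.sentences-diverge {d = suc d-1} (s≤s z≤n) refl (ℕ.suc-pred _ {{ℕ.m^n≢0 2 (suc (16 ℕ.* suc d-1))}}) refl p M inner
    where
    -- The sum puts `½ ^ d` below both gaps `δ₁` and `δ₂`; the successor taken of it secures
    -- `d ≥ 1`.
    d-1 = d₁ ℕ.+ d₂
    M = M₁ ℕ.+ M₂
    inner : ∀ i → M ℕ.≤ i → ½ ^ suc d-1 ≤ seq p i × ½ ^ suc d-1 ≤ 1ℚ - seq p i
    inner i M≤i =
        (begin
          ½ ^ suc d-1  ≤⟨ ½^-anti (ℕ.≤-trans (ℕ.m≤m+n d₁ d₂) (ℕ.n≤1+n d-1)) ⟩
          ½ ^ d₁       ≤⟨ ½^d₁≤δ₁ ⟩
          δ₁           ≡⟨ +-identityˡ δ₁ ⟨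
          0ℚ + δ₁      ≤⟨ above i (ℕ.≤-trans (ℕ.m≤m+n M₁ M₂) M≤i) ⟩
          seq p i      ∎)
      , (begin
          ½ ^ suc d-1  ≤⟨ ½^-anti (ℕ.≤-trans (ℕ.m≤n+m d₂ d₁) (ℕ.n≤1+n d-1)) ⟩
          ½ ^ d₂       ≤⟨ ½^d₂≤δ₂ ⟩
          δ₂           ≡⟨ cancel δ₂ (seq p i) ⟩
          seq p i + δ₂ - seq p i ≤⟨ +-monoˡ-≤ (- seq p i) (below i (ℕ.≤-trans (ℕ.m≤n+m M₂ M₁) M≤i)) ⟩
          1ℚ - seq p i ∎)
      where
      open ≤-Reasoning
      open +-*-Solver
      cancel : ∀ x y → x ≡ y + x - y
      cancel = solve 2 (λ x y → x := y :+ x :- y) refl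

open import Data.Product using (∃; _×_)
open import Relation.Nullary using (¬_)
open import Defs

theorem3 : (p : ℝ) → 0ℝ < p → p < 1ℝ →
    (∃ λ m → ∃ λ (φ₁ : EMSO m 3) → ¬ Converges (λ n → ℙ[G⟨ n , p ⟩⊨ φ₁ ])) ×
    (∃ λ k → ∃ λ (φ₂ : EMSO 1 k) → ¬ Converges (λ n → ℙ[G⟨ n , p ⟩⊨ φ₂ ]))
theorem3 = Divergence.both-diverge
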